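{- Let $C$ be a clone on $\{0,1\}$ and let $I_c$ be the clone of all projections on $\{0,1\}$. Then: (i) the lattice of $(C,I_c)$-clonoids is finite if and only if $C$ contains the discriminator function $t$; (ii) the lattice of $(C,I_c)$-clonoids is countably infinite if and only if $\langle \wedge,\vee\rangle \subseteq C \subseteq \langle \wedge,\vee,0,1\rangle$; (iii) otherwise, the lattice of $(C,I_c)$-clonoids has the cardinality of the continuum.
   Context: A Boolean function is a map $f\colon\{0,1\}^n\to\{0,1\}$ for some $n\ge 1$. For sets $I,J$ of Boolean functions, $IJ:=\{f(g_1,\dots,g_n) : f\in I \text{ is } n\text{ -ary},\ g_1,\dots,g_n\in J \text{ all } m\text{ -ary}\}$, where $f(g_1,\dots,g_n)(\mathbf{x})=f(g_1(\mathbf{x}),\dots,g_n(\mathbf{x}))$. A clone on $\{0,1\}$ is a set of Boolean functions containing all projections $(x_1,\dots,x_n)\mapsto x_i$ and closed under composition; $\langle F\rangle$ denotes the clone generated by $F$. For clones $C_1,C_2$ on $\{0,1\}$, a $(C_1,C_2)$-clonoid is a set $K$ of Boolean functions with $KC_1\subseteq K$ and $C_2K\subseteq K$; these form a lattice under inclusion. The discriminator function is the ternary $t(x,y,z)=z$ if $x=y$ and $t(x,y,z)=x$ otherwise. In $\langle\wedge,\vee,0,1\rangle$, $0$ and $1$ denote the constant functions. -}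

module Defs where

open import Level using (Level; 0ℓ) renaming (suc to lsuc)
open import Data.Bool using (Bool; true; false; _∧_; _∨_)
open import Data.Nat using (ℕ; zero; suc)
open import Data.Fin using (Fin; zero; suc)
open import Data.Product using (Σ; ∃; _×_; _,_)


open import Relation.Binary.PropositionalEquality using (_≡_; trans)
open import Data.Bool.Properties using () renaming (_≟_ to _≟B_)
open import Relation.Nullary using (yes; no)

-- Boolean functions.  A Boolean function has arity n ≥ 1; we write the
-- arity as (suc n).  Inputs are functional vectors Fin (suc n) → Bool.

BFun : ℕ → Set
BFun n = (Fin (suc n) → Bool) → Bool

_≐f_ : ∀ {n} → BFun n → BFun n → Set
f ≐f g = ∀ x → f x ≡ g x

compose : ∀ {k m} → BFun k → (Fin (suc k) → BFun m) → BFun m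
compose f gs x = f (λ i → gs i x)

-- Sets of Boolean functions.  Since functions are compared extensionally
-- in the paper, a set must not distinguish pointwise-equal functions.

record BSet : Set₁ where
  field
    mem : ∀ {n} → BFun n → Set
    ext : ∀ {n} {f g : BFun n} → f ≐f g → mem f → mem g
open BSet public

_∈_ : ∀ {n} → BFun n → BSet → Set
f ∈ S = mem S f

_⊆_ : BSet → BSet → Set
S ⊆ T = ∀ {n} (f : BFun n) → f ∈ S → f ∈ T

_≋_ : BSet → BSet → Set
S ≋ T = (S ⊆ T) × (T ⊆ S)

CompIn : BSet → BSet → BSet → Set
CompIn I J K = ∀ {k m} (f : BFun k) (gs : Fin (suc k) → BFun m) →
  f ∈ I → (∀ i → gs i ∈ J) → compose f gs ∈ K

proj : ∀ {n} → Fin (suc n) → BFun n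
proj i x = x i

record IsClone (C : BSet) : Set where
  field
    projections : ∀ {n} (i : Fin (suc n)) → proj i ∈ C
    closed      : CompIn C C C

Ic : BSet
Ic = record
  { mem = λ {n} f → Σ (Fin (suc n)) λ i → proj i ≐f f
  ; ext = λ { f≐g (i , p) → i , λ x → trans (p x) (f≐g x) } }

data Gen (F : BSet) : ∀ {n} → BFun n → Set where
  gproj : ∀ {n} (i : Fin (suc n)) → Gen F (proj i)
  ggen  : ∀ {n} {f : BFun n} → f ∈ F → Gen F f
  gcomp : ∀ {k m} {f : BFun k} {gs : Fin (suc k) → BFun m} →
          Gen F f → (∀ i → Gen F (gs i)) → Gen F (compose f gs)
  gext  : ∀ {n} {f g : BFun n} → f ≐f g → Gen F f → Gen F g

⟨_⟩ : BSet → BSet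
⟨ F ⟩ = record { mem = Gen F ; ext = gext }

record IsClonoid (C₁ C₂ K : BSet) : Set where
  field
    right : CompIn K C₁ K
    left  : CompIn C₂ K K

Clonoid : BSet → BSet → Set₁
Clonoid C₁ C₂ = Σ BSet (IsClonoid C₁ C₂)

_≋c_ : ∀ {C₁ C₂} → Clonoid C₁ C₂ → Clonoid C₁ C₂ → Set
(K , _) ≋c (L , _) = K ≋ L

LatticeFinite : BSet → BSet → Set₁
LatticeFinite C₁ C₂ = Σ ℕ λ n → Σ (Fin n → Clonoid C₁ C₂) λ e →
  ∀ K → Σ (Fin n) λ i → e i ≋c K

LatticeCountablyInfinite : BSet → BSet → Set₁
LatticeCountablyInfinite C₁ C₂ = Σ (ℕ → Clonoid C₁ C₂) λ e →
  (∀ i j → e i ≋c e j → i ≡ j) × (∀ K → Σ ℕ λ i → e i ≋c K)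

LatticeContinuum : BSet → BSet → Set₁
LatticeContinuum C₁ C₂ = Σ ((ℕ → Bool) → Clonoid C₁ C₂) λ e →
  (∀ a b → e a ≋c e b → ∀ i → a i ≡ b i) ×
  (∀ K → Σ (ℕ → Bool) λ a → e a ≋c K)

disc : BFun 2
disc x with x zero ≟B x (suc zero)
... | yes _ = x (suc (suc zero))
... | no  _ = x zero

and₂ or₂ : BFun 1
and₂ x = x zero ∧ x (suc zero)
or₂  x = x zero ∨ x (suc zero)

-- constant functions 0 and 1 (taken unary; arity ≥ 1)
const0 const1 : BFun 0
const0 _ = false
const1 _ = true

data DiscMem : ∀ {n} → BFun n → Set where
  isDisc : ∀ {f} → disc ≐f f → DiscMem f

DiscSet : BSet
DiscSet = record { mem = DiscMem ; ext = λ { e (isDisc p) → isDisc (λ x → trans (p x) (e x)) } }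

data AndOrMem : ∀ {n} → BFun n → Set where
  isAnd : ∀ {f} → and₂ ≐f f → AndOrMem f
  isOr  : ∀ {f} → or₂ ≐f f → AndOrMem f

AndOr : BSet
AndOr = record
  { mem = AndOrMem
  ; ext = λ { e (isAnd p) → isAnd (λ x → trans (p x) (e x))
            ; e (isOr p)  → isOr  (λ x → trans (p x) (e x)) } }

data AndOr01Mem : ∀ {n} → BFun n → Set where
  isAnd : ∀ {f} → and₂ ≐f f → AndOr01Mem f
  isOr  : ∀ {f} → or₂ ≐f f → AndOr01Mem f
  is0   : ∀ {f} → const0 ≐f f → AndOr01Mem f
  is1   : ∀ {f} → const1 ≐f f → AndOr01Mem f

AndOr01 : BSet
AndOr01 = record
  { mem = AndOr01Mem
  ; ext = λ { e (isAnd p) → isAnd (λ x → trans (p x) (e x))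
            ; e (isOr p)  → isOr  (λ x → trans (p x) (e x))
            ; e (is0 p)   → is0   (λ x → trans (p x) (e x))
            ; e (is1 p)   → is1   (λ x → trans (p x) (e x)) } }

{-# OPTIONS --safe #-}
-- A (C, I_c)-clonoid is a down-set of the quasi-order in which f ≤ g means
-- f = g ∘ h for a map h with all coordinates in C, so everything depends on how
-- complicated this quasi-order is.
--
-- If C contains the discriminator, then by Baker–Pixley it contains all idempotent
-- self-dual functions, and f ≤ g depends only on the values of f and g at the
-- constant tuples and on the pairs (f x , f ¬x) that occur: finitely many classes.
-- If ⟨∧,∨⟩ ⊆ C ⊆ ⟨∧,∨,0,1⟩, then f ≤ g is governed by the values at the constant
-- tuples and the length of the longest alternating chain, so there are infinitely
-- many clonoids, each described by finitely many elements of ℕ ∪ {ω}.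
-- In all other cases, up to duality, C preserves disjointness of tuples, or consists
-- of affine functions, or of join homomorphisms.  Each of these three conditions
-- admits an infinite antichain: for affine functions and joins the indicator
-- functions of {x : |x| = 1 or |x| = n}, for disjointness the indicator functions of
-- families of sets whose disjointness graphs are shift graphs of growing odd girth
-- and chromatic number.  An infinite antichain gives 2^ℕ down-sets, and there are only countably
-- many classes.  Finally diagonalisation and the pigeonhole principle make the three
-- cardinalities exclusive, which turns the implications into equivalences.
--
-- Boolean functions are not assumed to respect pointwise equality of their
-- arguments, so the classes of ≤ are described through the set of values a function
-- takes on all representatives of a tuple.
module Submission where

open import Defs
open import Level using (0ℓ; Lift; lift) renaming (suc to lsuc)
open import Axiom.ExcludedMiddle using (ExcludedMiddle)
open import Data.Bool using (Bool; true; false; _∧_; _∨_; not; _xor_; if_then_else_)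
open import Data.Bool.Properties using (not-involutive; not-injective; ¬-not; not-¬; ∧-zeroʳ; ∨-zeroʳ; ∨-idem; ∨-identityʳ; xor-comm; xor-identityʳ) renaming (_≟_ to _≟ᵇ_)
open import Data.Nat using (ℕ; zero; suc; _+_; _*_; _^_; _≤_; _<_; z≤n; s≤s)
import Data.Nat.Properties as ℕₚ
open import Data.Fin using (Fin; zero; suc; toℕ; fromℕ<; inject≤; combine; remQuot; finToFun; funToFin)
import Data.Fin.Properties as Finₚ
open import Data.List using (List; []; _∷_; tabulate)
open import Data.List.Relation.Unary.All using (All; []; _∷_)
open import Data.List.Relation.Unary.All.Properties using (tabulate⁻)
open import Data.Product using (Σ; _×_; _,_; proj₁; proj₂)
open import Data.Sum using (_⊎_; inj₁; inj₂)
open import Data.Empty using (⊥; ⊥-elim)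
open import Relation.Nullary using (¬_; Dec; yes; no; does)
open import Relation.Nullary.Decidable using (from-yes; _→-dec_; _×-dec_; ¬?; map′)
open import Relation.Binary.PropositionalEquality using (_≡_; _≢_; refl; sym; trans; cong; cong₂; subst; subst₂)
open import Relation.Binary.Definitions using (tri<; tri≈; tri>)
open import Relation.Binary.Structures using (IsEquivalence)
open import Function.Bundles using (_⇔_; mk⇔)

-- Post's classification is not invoked. The failure of an invariant of `C` is condensed into a
-- single ternary function of `C` whose prescribed values all have first argument false: that
-- argument stands in for a constant which `C` may lack. Five such functions (`HasM`, `HasU`, `HasL`
-- and the duals of the last two) are combined according to the unary functions in `C`, and the
-- identities involved are checked on truth tables. If monotonicity is the only invariant that
-- survives, then outside the interval a lattice operation is missing, and its absence forces the
-- members of `C` to preserve the other one. The infinite cardinalities ask for enumerations that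
-- are injective and surjective up to `_≋c_`. Instead of normal forms for clonoids, injections in
-- both directions are given and combined by a Schröder-Bernstein argument on setoids. That argument
-- decides statements quantifying over clonoids, which is why excluded middle is taken one level up.

X : ℕ → Set
X n = Fin (suc n) → Bool

infix 4 _≐_ _≼_

_≐_ : ∀ {k} (x y : Fin k → Bool) → Set
x ≐ y = ∀ i → x i ≡ y i

_≼_ : ∀ {k} (x y : Fin k → Bool) → Set
x ≼ y = ∀ i → x i ≡ true → y i ≡ true

Ext : ∀ {n} → BFun n → Set
Ext f = ∀ {x y} → x ≐ y → f x ≡ f y

Mono : ∀ {n} → BFun n → Set
Mono f = ∀ {x y} → x ≼ y → f x ≡ true → f y ≡ true

≐-sym : ∀ {k} {x y : Fin k → Bool} → x ≐ y → y ≐ x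
≐-sym p i = sym (p i)

≐-trans : ∀ {k} {x y z : Fin k → Bool} → x ≐ y → y ≐ z → x ≐ z
≐-trans p q i = trans (p i) (q i)

neg : ∀ {k} → (Fin k → Bool) → (Fin k → Bool)
neg x i = not (x i)

neg-cong : ∀ {k} {x y : Fin k → Bool} → x ≐ y → neg x ≐ neg y
neg-cong p i = cong not (p i)

≐⇒≼ : ∀ {k} {x y : Fin k → Bool} → x ≐ y → x ≼ y
≐⇒≼ p i xi = trans (sym (p i)) xi

true≢false : true ≢ false
true≢false ()

≡-by-true : ∀ {a b} → (a ≡ true → b ≡ true) → (b ≡ true → a ≡ true) → a ≡ b
≡-by-true {true}  {_}     p q = sym (p refl)
≡-by-true {false} {true}  p q = q refl
≡-by-true {false} {false} p q = refl

Mono⇒Ext : ∀ {n} {f : BFun n} → Mono f → Ext f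
Mono⇒Ext mono p = ≡-by-true (mono (≐⇒≼ p)) (mono (≐⇒≼ (≐-sym p)))

-- The map h may pick different representatives for pointwise equal inputs;
-- only its coordinates are required to lie in C.
infix 4 _≤[_]_
_≤[_]_ : ∀ {m n} → BFun m → BSet → BFun n → Set
_≤[_]_ {m} {n} f C g =
  Σ (X m → X n) λ h → (∀ i → (λ z → h z i) ∈ C) × (∀ z → f z ≡ g (h z))

≤-mem : ∀ {C D K m n} {f : BFun m} {g : BFun n} →
        IsClonoid C D K → g ∈ K → f ≤[ C ] g → f ∈ K
≤-mem {K = K} {g = g} isK g∈ (h , hc , eq) =
  ext K (λ z → sym (eq z)) (IsClonoid.right isK g (λ i z → h z i) g∈ hc)

-- Composing a projection with members of `K` returns one of them up to `_≐f_`, so left closure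
-- under `Ic` is automatic.
mkClonoid : ∀ {C} (K : BSet) → CompIn K C K → IsClonoid C Ic K
mkClonoid K r = record
  { right = r
  ; left  = λ { f gs (i , p) gs∈ → ext K (λ x → p (λ j → gs j x)) (gs∈ i) } }

↓ : (C : BSet) {I : Set} (F : I → Σ ℕ BFun) → BSet
↓ C {I} F = record
  { mem = λ f → Σ I λ i → f ≤[ C ] proj₂ (F i)
  ; ext = λ { f≐g (i , h , hc , eq) → i , h , hc , λ z → trans (sym (f≐g z)) (eq z) } }

↓-clonoid : ∀ {C} → IsClone C → {I : Set} (F : I → Σ ℕ BFun) → Clonoid C Ic
↓-clonoid {C} isC F = ↓ C F , mkClonoid (↓ C F)
  λ { f gs (i , h , hc , eq) gs∈ →
      i , (λ z → h (λ j → gs j z))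
        , (λ j → IsClone.closed isC (λ z → h z j) gs (hc j) gs∈)
        , λ z → eq (λ j → gs j z) }

≤-proj-closed : ∀ {C m n} → IsClone C → (h : X m → X n) (s : Fin (suc n) → Fin (suc m)) →
                (∀ z i → h z i ≡ z (s i)) → ∀ i → (λ z → h z i) ∈ C
≤-proj-closed {C} isC h s eq i =
  ext C (λ z → sym (eq z i)) (IsClone.projections isC (s i))

≋-equiv : ∀ {C D} → IsEquivalence (_≋c_ {C} {D})
≋-equiv = record
  { refl  = (λ f p → p) , (λ f p → p)
  ; sym   = λ { (p , q) → q , p }
  ; trans = λ { (p , q) (p' , q') → (λ f x → p' f (p f x)) , (λ f x → q f (q' f x)) } }

≋-span : ∀ {C D} (M K L : Clonoid C D) → M ≋c K → M ≋c L → K ≋c L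
≋-span M K L p q =
  IsEquivalence.trans ≋-equiv {K} {M} {L} (IsEquivalence.sym ≋-equiv {M} {K} p) q

-- Numbering points of the cube and coding tuples of numbers

bit : Bool → Fin 2
bit false = zero
bit true  = suc zero

bit-injective : ∀ {a b} → bit a ≡ bit b → a ≡ b
bit-injective {false} {false} _ = refl
bit-injective {true}  {true}  _ = refl

unbit : Fin 2 → Bool
unbit zero       = false
unbit (suc zero) = true

unbit-bit : ∀ b → unbit (bit b) ≡ b
unbit-bit false = refl
unbit-bit true  = refl

funToFin-cong : ∀ {m n} {f g : Fin m → Fin n} → (∀ i → f i ≡ g i) → funToFin f ≡ funToFin g
funToFin-cong {zero}  p = refl
funToFin-cong {suc m} p = cong₂ combine (p zero) (funToFin-cong (λ i → p (suc i)))

funToFin-injective : ∀ {m n} {f g : Fin m → Fin n} → funToFin f ≡ funToFin g → ∀ i → f i ≡ g i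
funToFin-injective {f = f} {g} p i =
  trans (sym (Finₚ.finToFun-funToFin f i))
        (trans (cong (λ k → finToFun k i) p) (Finₚ.finToFun-funToFin g i))

-- `point (index x)` is a canonical representative of `x`: pointwise equal inputs receive the same
-- number. Choices made through it therefore respect pointwise equality.
index : ∀ {n} → X n → Fin (2 ^ suc n)
index x = funToFin (λ i → bit (x i))

point : ∀ {n} → Fin (2 ^ suc n) → X n
point k i = unbit (finToFun k i)

point-index : ∀ {n} (x : X n) → point (index x) ≐ x
point-index x i =
  trans (cong unbit (Finₚ.finToFun-funToFin (λ i → bit (x i)) i)) (unbit-bit (x i))

index-cong : ∀ {n} {x y : X n} → x ≐ y → index x ≡ index y
index-cong p = funToFin-cong (λ i → cong bit (p i))

-- Since `a ≤ s` for `s = a + b`, the code `s * s + a` stays below the next square, so `s` and then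
-- `a` can be recovered. Only injectivity is wanted.
pair : ℕ → ℕ → ℕ
pair a b = (a + b) * (a + b) + a

pair-< : ∀ a b a' b' → a + b < a' + b' → pair a b < pair a' b'
pair-< a b a' b' s<s' = begin-strict
  s * s + a         ≤⟨ ℕₚ.+-monoʳ-≤ (s * s) (ℕₚ.m≤m+n a b) ⟩
  s * s + s         ≡⟨ ℕₚ.+-comm (s * s) s ⟩
  suc s * s         <⟨ ℕₚ.m<m+n (suc s * s) (s≤s z≤n) ⟩
  suc s * s + suc s ≡⟨ ℕₚ.+-comm (suc s * s) (suc s) ⟩
  suc s + suc s * s ≡⟨ ℕₚ.*-suc (suc s) s ⟨
  suc s * suc s     ≤⟨ ℕₚ.*-mono-≤ s<s' s<s' ⟩
  s' * s'           ≤⟨ ℕₚ.m≤m+n (s' * s') a' ⟩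
  s' * s' + a'      ∎
  where
  open ℕₚ.≤-Reasoning
  s s' : ℕ
  s  = a + b
  s' = a' + b'

pair-injective : ∀ a b a' b' → pair a b ≡ pair a' b' → a ≡ a' × b ≡ b'
pair-injective a b a' b' p with ℕₚ.<-cmp (a + b) (a' + b')
... | tri< s<s' _ _ = ⊥-elim (ℕₚ.<-irrefl p (pair-< a b a' b' s<s'))
... | tri> _ _ s>s' = ⊥-elim (ℕₚ.<-irrefl (sym p) (pair-< a' b' a b s>s'))
... | tri≈ _ s≡s' _ = a≡a' , ℕₚ.+-cancelˡ-≡ a b b' (trans s≡s' (cong (_+ b') (sym a≡a')))
  where
  a≡a' : a ≡ a'
  a≡a' = ℕₚ.+-cancelˡ-≡ ((a + b) * (a + b)) a a'
           (trans p (cong (λ s → s * s + a') (sym s≡s')))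

abstract
  -- Abstract, because `number` applies it to sixteen components and unfolding would nest the
  -- quadratic `pair` as often.
  encode : ∀ k → (Fin k → ℕ) → ℕ
  encode zero    s = zero
  encode (suc k) s = pair (s zero) (encode k (λ i → s (suc i)))

  encode-cong : ∀ k {s t : Fin k → ℕ} → (∀ i → s i ≡ t i) → encode k s ≡ encode k t
  encode-cong zero    p = refl
  encode-cong (suc k) p = cong₂ pair (p zero) (encode-cong k (λ i → p (suc i)))

  encode-injective : ∀ k (s t : Fin k → ℕ) → encode k s ≡ encode k t → ∀ i → s i ≡ t i
  encode-injective (suc k) s t p with pair-injective (s zero) _ (t zero) _ p
  ... | p₀ , p₊ = λ { zero → p₀ ; (suc i) → encode-injective k _ _ p₊ i }

-- Incomparability is asked of every map whose coordinates satisfy `P`, without reference to a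
-- clone, so that one antichain serves all clones whose members satisfy `P`.
record Antichain (P : ∀ {n} → BFun n → Set) : Set where
  field
    ar     : ℕ → ℕ
    fn     : ∀ k → BFun (ar k)
    fn-ext : ∀ k → Ext (fn k)
    incomp : ∀ j k → j ≢ k → (h : X (ar j) → X (ar k)) →
             (∀ i → P (λ z → h z i)) → ¬ (∀ z → fn j z ≡ fn k (h z))

infixl 9 _ᵈ
_ᵈ : ∀ {n} → BFun n → BFun n
(f ᵈ) x = not (f (neg x))

-- Conjugating `h` by `neg` replaces its coordinates by their duals and turns a reduction between
-- the functions precomposed with `neg` into one between the original functions; the values stay as
-- they are. `fn-ext` absorbs the double negation.
dualAntichain : {P Q : ∀ {n} → BFun n → Set} → (∀ {n} (f : BFun n) → Q f → P (f ᵈ)) →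
                Antichain P → Antichain Q
dualAntichain {P} {Q} Q⇒P A = record
  { ar     = ar
  ; fn     = λ k x → fn k (neg x)
  ; fn-ext = λ k p → fn-ext k (neg-cong p)
  ; incomp = λ j k j≢k h hQ eq → incomp j k j≢k (λ z → neg (h (neg z)))
      (λ i → Q⇒P (λ z → h z i) (hQ i))
      λ z → trans (fn-ext j (λ i → sym (not-involutive (z i)))) (eq (neg z)) }
  where open Antichain A

-- Classical reasoning, Schröder-Bernstein and the size of lattices of clonoids

module Classical (em : ExcludedMiddle (lsuc 0ℓ)) where

  dec : (P : Set) → Dec P
  dec P with em {Lift (lsuc 0ℓ) P}
  ... | yes (lift p) = yes p
  ... | no ¬p        = no (λ p → ¬p (lift p))

  ind : Set → Bool
  ind P = does (dec P)

  ind⁺ : ∀ {P} → P → ind P ≡ true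
  ind⁺ {P} p with dec P
  ... | yes _ = refl
  ... | no ¬p = ⊥-elim (¬p p)

  ind⁻ : ∀ {P} → ind P ≡ true → P
  ind⁻ {P} eq with dec P
  ... | yes p = p
  ind⁻ {P} () | no _

  ind-cong : ∀ {P Q} → (P → Q) → (Q → P) → ind P ≡ ind Q
  ind-cong p q = ≡-by-true (λ e → ind⁺ (p (ind⁻ e))) (λ e → ind⁺ (q (ind⁻ e)))

  module _ {A : Set} {B : Set₁} {_~_ : A → A → Set} {_≈_ : B → B → Set}
           (~-equiv : IsEquivalence _~_) (≈-equiv : IsEquivalence _≈_) where

    private
      module A = IsEquivalence ~-equiv
      module B = IsEquivalence ≈-equiv

    -- An element that traces back along `g` and `f` to one outside the image of `g` is sent through
    -- `f`; every other element has a preimage under `g` and is sent there. All comparisons are up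
    -- to the two equivalences.
    schröder-bernstein :
      (f : A → B) → (∀ {a b} → a ~ b → f a ≈ f b) → (∀ {a b} → f a ≈ f b → a ~ b) →
      (g : B → A) → (∀ {x y} → x ≈ y → g x ~ g y) → (∀ {x y} → g x ~ g y → x ≈ y) →
      Σ (A → B) λ e → (∀ a b → e a ≈ e b → a ~ b) × (∀ y → Σ A λ a → e a ≈ y)
    schröder-bernstein f f-cong f-inj g g-cong g-inj =
      (λ a → choose a em) , (λ a b → injective a b em em) , surjective
      where
      iter : ℕ → A → A
      iter zero    a = a
      iter (suc n) a = g (f (iter n a))

      Image : A → Set₁
      Image a = Σ B λ y → g y ~ a

      Origin : A → Set₁
      Origin a = Σ ℕ λ n → Σ A λ a₀ → (¬ Image a₀) × (iter n a₀ ~ a)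

      preimage : ∀ a → ¬ Origin a → Image a
      preimage a ¬o with em {Image a}
      ... | yes i = i
      ... | no ¬i = ⊥-elim (¬o (0 , a , ¬i , A.refl))

      -- The decision is an argument, so that the lemmas can split on it without unfolding `em`.
      choose : ∀ a → Dec (Origin a) → B
      choose a (yes _) = f a
      choose a (no ¬o) = proj₁ (preimage a ¬o)

      mixed : ∀ a b (o : Origin a) (¬o : ¬ Origin b) → ¬ (f a ≈ proj₁ (preimage b ¬o))
      mixed a b (n , a₀ , ¬i , p) ¬o q =
        ¬o (suc n , a₀ , ¬i ,
            A.trans (g-cong (B.trans (f-cong p) q)) (proj₂ (preimage b ¬o)))

      injective : ∀ a b (d : Dec (Origin a)) (d' : Dec (Origin b)) → choose a d ≈ choose b d' → a ~ b
      injective a b (yes _) (yes _)  q = f-inj q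
      injective a b (yes o) (no ¬o)  q = ⊥-elim (mixed a b o ¬o q)
      injective a b (no ¬o) (yes o)  q = ⊥-elim (mixed b a o ¬o (B.sym q))
      injective a b (no ¬o) (no ¬o') q =
        A.trans (A.sym (proj₂ (preimage a ¬o)))
                (A.trans (g-cong q) (proj₂ (preimage b ¬o')))

      hits : ∀ a y (d : Dec (Origin a)) → Origin a → f a ≈ y → choose a d ≈ y
      hits a y (yes _) o q = q
      hits a y (no ¬o) o q = ⊥-elim (¬o o)

      surjective : ∀ y → Σ A λ a → choose a em ≈ y
      surjective y = go em
        where
        go : Dec (Origin (g y)) → Σ A λ a → choose a em ≈ y
        go (yes (zero , a₀ , ¬i , p))  = ⊥-elim (¬i (y , A.sym p))
        go (yes (suc n , a₀ , ¬i , p)) =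
          iter n a₀ , hits (iter n a₀) y em (n , a₀ , ¬i , A.refl) (g-inj p)
        go (no ¬o) = g y , back em
          where
          back : (d : Dec (Origin (g y))) → choose (g y) d ≈ y
          back (yes o)  = ⊥-elim (¬o o)
          back (no ¬o') = g-inj (proj₂ (preimage (g y) ¬o'))

  val? : ∀ {n} → BFun n → X n → Bool → Bool
  val? {n} f x b = ind (Σ (X n) λ x' → (x' ≐ x) × f x' ≡ b)

  -- f need not respect pointwise equality, so all that matters about it at x
  -- is the set of values it takes on the representatives of x.
  profile : ∀ {n} → BFun n → X n → Fin (2 * 2)
  profile f x = combine (bit (val? f x true)) (bit (val? f x false))

  profile-lift : ∀ {m n} (f : BFun m) (g : BFun n) {x y} → profile f x ≡ profile g y →
                 ∀ {x'} → x' ≐ x → Σ (X n) λ y' → (y' ≐ y) × g y' ≡ f x'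
  profile-lift {n = n} f g {x} {y} p {x'} x'≐x = ind⁻ (go (f x') refl)
    where
    q = Finₚ.combine-injective (bit (val? f x true)) (bit (val? f x false))
                               (bit (val? g y true)) (bit (val? g y false)) p
    go : ∀ b → f x' ≡ b → val? g y b ≡ true
    go true  e = trans (sym (bit-injective (proj₁ q))) (ind⁺ (x' , x'≐x , e))
    go false e = trans (sym (bit-injective (proj₂ q))) (ind⁺ (x' , x'≐x , e))

  code : ∀ {n} → BFun n → ℕ
  code {n} f = pair n (toℕ (funToFin (λ k → profile f (point {n} k))))

  -- Equal codes mean equal arity and equal profiles at all points. The reduction then only
  -- exchanges representatives within a pointwise class, so its coordinates are projections up to
  -- pointwise equality.
  code-≤ : ∀ {C m n} → IsClone C → (f : BFun m) (g : BFun n) → code f ≡ code g → f ≤[ C ] g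
  code-≤ {C} {m} {n} isC f g p with pair-injective m _ n _ p
  ... | refl , q = h , ≤-proj-closed isC h (λ i → i) (λ z → proj₁ (proj₂ (lifted z)))
                     , λ z → sym (proj₂ (proj₂ (lifted z)))
    where
    lifted : ∀ z → Σ (X m) λ y → (y ≐ z) × g y ≡ f z
    lifted z with profile-lift f g
                    (funToFin-injective {f = λ k → profile f (point {m} k)} {λ k → profile g (point {m} k)}
                      (Finₚ.toℕ-injective q) (index z)) (≐-sym (point-index z))
    ... | y , y≐ , e = y , ≐-trans y≐ (point-index z) , e
    h : X m → X m
    h z = proj₁ (lifted z)

  signature : ∀ {C} → Clonoid C Ic → ℕ → Bool
  signature (K , _) j = ind (Σ ℕ λ n → Σ (BFun n) λ f → f ∈ K × code f ≡ j)

  signature-⊆ : ∀ {C} → IsClone C → (K L : Clonoid C Ic) →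
                (∀ j → signature K j ≡ signature L j) → proj₁ K ⊆ proj₁ L
  signature-⊆ isC K L p f f∈K with ind⁻ (trans (sym (p (code f))) (ind⁺ (_ , f , f∈K , refl)))
  ... | n , g , g∈L , eq = ≤-mem {K = proj₁ L} (proj₂ L) g∈L (code-≤ isC f g (sym eq))

  continuum : ∀ {C} → IsClone C → {P : ∀ {n} → BFun n → Set} → Antichain P →
              (∀ {n} (f : BFun n) → f ∈ C → P f) → LatticeContinuum C Ic
  continuum {C} isC {P} A C⊆P = schröder-bernstein
    (record { refl = λ _ → refl ; sym = λ p i → sym (p i) ; trans = λ p q i → trans (p i) (q i) })
    ≋-equiv family (λ p → family-⊆ p , family-⊆ (λ i → sym (p i)))
    (λ {a} {b} p i → ≡-by-true (family-inj {a} {b} (proj₁ p) i) (family-inj {b} {a} (proj₂ p) i))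
    signature
    (λ { {K} {L} (p , q) j → ind-cong (λ { (n , f , f∈ , e) → n , f , p f f∈ , e })
                                      (λ { (n , f , f∈ , e) → n , f , q f f∈ , e }) })
    λ {K} {L} p → signature-⊆ isC K L p , signature-⊆ isC L K (λ j → sym (p j))
    where
    open Antichain A
    member : (a : ℕ → Bool) → (Σ ℕ λ i → a i ≡ true) → Σ ℕ BFun
    member a (i , _) = ar i , fn i
    family : (ℕ → Bool) → Clonoid C Ic
    family a = ↓-clonoid isC (member a)
    family-⊆ : ∀ {a b} → (∀ i → a i ≡ b i) → proj₁ (family a) ⊆ proj₁ (family b)
    family-⊆ p f ((i , ai) , f≤) = (i , trans (sym (p i)) ai) , f≤
    family-inj : ∀ {a b} → proj₁ (family a) ⊆ proj₁ (family b) → ∀ i → a i ≡ true → b i ≡ true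
    family-inj {a} {b} s i ai
      with s (fn i) ((i , ai) , (λ z → z) , (λ j → IsClone.projections isC j) , λ z → refl)
    ... | (j , bj) , h , hc , eq with i ℕₚ.≟ j
    ...   | yes refl = bj
    ...   | no i≢j   = ⊥-elim (incomp i j i≢j h (λ k → C⊆P _ (hc k)) eq)

  -- A clonoid is generated by all functions whose type is realised in it, hence determined by a
  -- subset of `Fin k`. Finiteness asks only for a surjection, so different subsets may give the
  -- same clonoid.
  finite : ∀ {C} → IsClone C → ∀ k (τ : ∀ {n} → BFun n → Fin k) →
           (∀ {m n} (f : BFun m) (g : BFun n) → τ f ≡ τ g → f ≤[ C ] g) → LatticeFinite C Ic
  finite {C} isC k τ τ-≤ = 2 ^ k , family , onto
    where
    Selected : Fin (2 ^ k) → Set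
    Selected s = Σ (Σ ℕ BFun) λ g → finToFun s (τ (proj₂ g)) ≡ suc zero
    family : Fin (2 ^ k) → Clonoid C Ic
    family s = ↓-clonoid isC {Selected s} proj₁
    onto : (K : Clonoid C Ic) → Σ (Fin (2 ^ k)) λ s → family s ≋c K
    onto (K , isK) = funToFin types , to , from
      where
      Realised : Fin k → Set
      Realised t = Σ ℕ λ n → Σ (BFun n) λ f → f ∈ K × τ f ≡ t
      types : Fin k → Fin 2
      types t = bit (ind (Realised t))
      to : proj₁ (family (funToFin types)) ⊆ K
      to f (((n , g) , sel) , f≤g)
        with ind⁻ {Realised (τ g)} (bit-injective (trans (sym (Finₚ.finToFun-funToFin types (τ g))) sel))
      ... | _ , g' , g'∈K , eq =
        ≤-mem {K = K} isK (≤-mem {K = K} isK g'∈K (τ-≤ g g' (sym eq))) f≤g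
      from : K ⊆ proj₁ (family (funToFin types))
      from f f∈K = ((_ , f) , trans (Finₚ.finToFun-funToFin types (τ f))
                                    (cong bit (ind⁺ {Realised (τ f)} (_ , f , f∈K , refl))))
                 , τ-≤ f f refl

  ¬finite : ∀ {C} (e : ℕ → Clonoid C Ic) → (∀ i j → e i ≋c e j → i ≡ j) → ¬ LatticeFinite C Ic
  ¬finite {C} e e-inj (n , d , onto)
    with Finₚ.pigeonhole {n} {suc n} ℕₚ.≤-refl (λ i → proj₁ (onto (e (toℕ i))))
  ... | i , j , i<j , eq = ℕₚ.<⇒≢ i<j (e-inj (toℕ i) (toℕ j)
        (≋-span (d (proj₁ (onto (e (toℕ i))))) (e (toℕ i)) (e (toℕ j)) (proj₂ (onto (e (toℕ i))))
                (subst (λ k → d k ≋c e (toℕ j)) (sym eq) (proj₂ (onto (e (toℕ j)))))))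

  ¬finite×countable : ∀ {C} → LatticeFinite C Ic → ¬ LatticeCountablyInfinite C Ic
  ¬finite×countable {C} fin (e , e-inj , _) = ¬finite {C} e e-inj fin

  ¬finite×continuum : ∀ {C} → LatticeFinite C Ic → ¬ LatticeContinuum C Ic
  ¬finite×continuum {C} fin (e , e-inj , _) = ¬finite {C} (λ i → e (single i)) inj fin
    where
    single : ℕ → ℕ → Bool
    single i k = ind (i ≡ k)
    inj : ∀ i j → e (single i) ≋c e (single j) → i ≡ j
    inj i j p = ind⁻ (trans (e-inj (single i) (single j) p j) (ind⁺ refl))

  ¬countable×continuum : ∀ {C} → LatticeCountablyInfinite C Ic → ¬ LatticeContinuum C Ic
  ¬countable×continuum {C} (e , _ , e-onto) (c , c-inj , c-onto) =
    not-¬ refl (sym (c-inj diagonal (seq j) (≋-span (e j) (c diagonal) (c (seq j)) (proj₂ (e-onto (c diagonal)))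
                (IsEquivalence.sym ≋-equiv {c (seq j)} {e j} (proj₂ (c-onto (e j))))) j))
    where
    seq : ℕ → ℕ → Bool
    seq i = proj₁ (c-onto (e i))
    diagonal : ℕ → Bool
    diagonal i = not (seq i i)
    j = proj₁ (e-onto (c diagonal))

-- Clones containing the discriminator

-- Makes statements about finitely many Booleans decidable, so that `from-yes` proves them by
-- evaluating the truth table.
∀ᵇ? : {P : Bool → Set} → (∀ b → Dec (P b)) → Dec (∀ b → P b)
∀ᵇ? {P} d = map′ (λ { (pf , pt) → λ { false → pf ; true → pt } }) (λ p → p false , p true)
                 (d false ×-dec d true)

fun₁ : (Bool → Bool) → BFun 0
fun₁ u x = u (x zero)

fun₂ : (Bool → Bool → Bool) → BFun 1
fun₂ b x = b (x zero) (x (suc zero))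

fun₃ : (Bool → Bool → Bool → Bool) → BFun 2
fun₃ t x = t (x zero) (x (suc zero)) (x (suc (suc zero)))

ext₁ : ∀ C {u v} → (∀ a → u a ≡ v a) → fun₁ u ∈ C → fun₁ v ∈ C
ext₁ C p = ext C (λ x → p (x zero))

ext₂ : ∀ C {u v} → (∀ a b → u a b ≡ v a b) → fun₂ u ∈ C → fun₂ v ∈ C
ext₂ C p = ext C (λ x → p (x zero) (x (suc zero)))

ext₃ : ∀ C {u v} → (∀ a b c → u a b c ≡ v a b c) → fun₃ u ∈ C → fun₃ v ∈ C
ext₃ C p = ext C (λ x → p (x zero) (x (suc zero)) (x (suc (suc zero))))

module CloneOps {C : BSet} (isC : IsClone C) where
  open IsClone isC

  app₁ : ∀ u {m} {s : BFun m} → fun₁ u ∈ C → s ∈ C → (λ x → u (s x)) ∈ C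
  app₁ u {s = s} u∈ s∈ = closed (fun₁ u) (λ _ → s) u∈ (λ _ → s∈)

  app₂ : ∀ b {m} {s t : BFun m} → fun₂ b ∈ C → s ∈ C → t ∈ C → (λ x → b (s x) (t x)) ∈ C
  app₂ b {m} {s} {t} b∈ s∈ t∈ = closed (fun₂ b) args b∈ args∈
    where
    args : Fin 2 → BFun m
    args zero       = s
    args (suc zero) = t
    args∈ : ∀ i → args i ∈ C
    args∈ zero       = s∈
    args∈ (suc zero) = t∈

  app₃ : ∀ t {m} {p q r : BFun m} → fun₃ t ∈ C → p ∈ C → q ∈ C → r ∈ C →
         (λ x → t (p x) (q x) (r x)) ∈ C
  app₃ t {m} {p} {q} {r} t∈ p∈ q∈ r∈ = closed (fun₃ t) args t∈ args∈
    where
    args : Fin 3 → BFun m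
    args zero             = p
    args (suc zero)       = q
    args (suc (suc zero)) = r
    args∈ : ∀ i → args i ∈ C
    args∈ zero             = p∈
    args∈ (suc zero)       = q∈
    args∈ (suc (suc zero)) = r∈

  π : ∀ {n} (i : Fin (suc n)) → proj i ∈ C
  π = projections

maj : Bool → Bool → Bool → Bool
maj x y z = (x ∧ y) ∨ ((x ∨ y) ∧ z)

disc₃ : Bool → Bool → Bool → Bool
disc₃ x y z = if x xor y then x else z

maj-agree : ∀ a b c {d} → (a ≡ d × b ≡ d) ⊎ (a ≡ d × c ≡ d) ⊎ (b ≡ d × c ≡ d) → maj a b c ≡ d
maj-agree a .a c (inj₁ (refl , refl)) = from-yes (∀ᵇ? λ a → ∀ᵇ? λ c → maj a a c ≟ᵇ a) a c
maj-agree a b .a (inj₂ (inj₁ (refl , refl))) = from-yes (∀ᵇ? λ a → ∀ᵇ? λ b → maj a b a ≟ᵇ a) a b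
maj-agree a b .b (inj₂ (inj₂ (refl , refl))) = from-yes (∀ᵇ? λ a → ∀ᵇ? λ b → maj a b b ≟ᵇ b) a b

lattice⇒maj : ∀ {C} → IsClone C → fun₂ _∧_ ∈ C → fun₂ _∨_ ∈ C → fun₃ maj ∈ C
lattice⇒maj isC ∧∈ ∨∈ = app₂ _∨_ ∨∈ (app₂ _∧_ ∧∈ (π zero) (π (suc zero)))
    (app₂ _∧_ ∧∈ (app₂ _∨_ ∨∈ (π zero) (π (suc zero))) (π (suc (suc zero))))
  where open CloneOps isC

module BakerPixley {C : BSet} (isC : IsClone C) (maj∈ : fun₃ maj ∈ C)
                   {m : ℕ} (s : BFun m) (s-ext : Ext s) where
  open CloneOps isC

  Interpolant : X m → X m → List (X m) → Set
  Interpolant a b l =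
    Σ (BFun m) λ g → g ∈ C × Ext g × g a ≡ s a × g b ≡ s b × All (λ c → g c ≡ s c) l

  -- The three recursive interpolants are all correct on `l`, and each of `a`, `b`, `c` is handled
  -- by two of them; their majority is therefore correct everywhere.
  interpolate : (∀ a b → Interpolant a b []) → ∀ a b l → Interpolant a b l
  interpolate two a b [] = two a b
  interpolate two a b (c ∷ l)
    with interpolate two a b l | interpolate two a c l | interpolate two b c l
  ... | g , g∈ , gx , ga , gb , gl | h , h∈ , hx , ha , hc , hl | k , k∈ , kx , kb , kc , kl =
    (λ x → maj (g x) (h x) (k x))
    , app₃ maj maj∈ g∈ h∈ k∈
    , (λ {x} {y} p → majority-cong (gx p) (hx p) (kx p))
    , maj-agree (g a) (h a) (k a) (inj₁ (ga , ha))
    , maj-agree (g b) (h b) (k b) (inj₂ (inj₁ (gb , kb)))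
    , maj-agree (g c) (h c) (k c) (inj₂ (inj₂ (hc , kc)))
    ∷ rest gl hl
    where
    majority-cong : ∀ {p p' q q' r r'} → p ≡ p' → q ≡ q' → r ≡ r' → maj p q r ≡ maj p' q' r'
    majority-cong refl refl refl = refl
    rest : ∀ {l} → All (λ c → g c ≡ s c) l → All (λ c → h c ≡ s c) l →
           All (λ c → maj (g c) (h c) (k c) ≡ s c) l
    rest []       []       = []
    rest (p ∷ ps) (q ∷ qs) = maj-agree _ _ _ (inj₁ (p , q)) ∷ rest ps qs

  baker-pixley : (∀ a b → Σ (BFun m) λ g → g ∈ C × Ext g × g a ≡ s a × g b ≡ s b) → s ∈ C
  baker-pixley two with interpolate (λ a b → let (g , g∈ , gx , ga , gb) = two a b in g , g∈ , gx , ga , gb , [])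
                                    -- The two distinguished points are arbitrary: the list already
                                    -- contains a representative of every point.
                                    (λ _ → false) (λ _ → false) (tabulate (point {m}))
  ... | g , g∈ , gx , _ , _ , gl =
    ext C (λ z → trans (gx (≐-sym (point-index z)))
                       (trans (tabulate⁻ gl (index z)) (s-ext (point-index z)))) g∈

disc-disc₃ : ∀ x → disc x ≡ fun₃ disc₃ x
disc-disc₃ x with x zero ≟ᵇ x (suc zero)
... | yes p = from-yes (∀ᵇ? λ a → ∀ᵇ? λ b → ∀ᵇ? λ c → (a ≟ᵇ b) →-dec (c ≟ᵇ disc₃ a b c))
                (x zero) (x (suc zero)) (x (suc (suc zero))) p
... | no ¬p = from-yes (∀ᵇ? λ a → ∀ᵇ? λ b → ∀ᵇ? λ c → ¬? (a ≟ᵇ b) →-dec (a ≟ᵇ disc₃ a b c))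
                (x zero) (x (suc zero)) (x (suc (suc zero))) ¬p

disc₃⇒disc : ∀ {C} → fun₃ disc₃ ∈ C → disc ∈ C
disc₃⇒disc {C} = ext C (λ x → sym (disc-disc₃ x))

module Discriminator (em : ExcludedMiddle (lsuc 0ℓ)) {C : BSet} (isC : IsClone C) (disc∈ : disc ∈ C) where
  open CloneOps isC
  open Classical em

  disc₃∈ : fun₃ disc₃ ∈ C
  disc₃∈ = ext C disc-disc₃ disc∈

  maj∈ : fun₃ maj ∈ C
  maj∈ = ext₃ C {λ x y z → disc₃ x (disc₃ x y z) z}
           (from-yes (∀ᵇ? λ x → ∀ᵇ? λ y → ∀ᵇ? λ z → disc₃ x (disc₃ x y z) z ≟ᵇ maj x y z))
           (app₃ disc₃ disc₃∈ (π zero) disc₃∈ (π (suc (suc zero))))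

  excluded-pairs : ∀ α β p q → ¬ (p ≡ α × q ≡ β) → ¬ (p ≡ not α × q ≡ not β) →
                   q ≡ (if α xor β then p else not p)
  excluded-pairs = from-yes (∀ᵇ? λ α → ∀ᵇ? λ β → ∀ᵇ? λ p → ∀ᵇ? λ q →
    ¬? ((p ≟ᵇ α) ×-dec (q ≟ᵇ β)) →-dec
    (¬? ((p ≟ᵇ not α) ×-dec (q ≟ᵇ not β)) →-dec (q ≟ᵇ (if α xor β then p else not p))))

  other : ∀ {α β p q : Bool} → ¬ (p ≡ α × q ≡ β) → p ≡ α → q ≡ not β
  other {α} {β} {p} {q} = from-yes (∀ᵇ? λ α → ∀ᵇ? λ β → ∀ᵇ? λ p → ∀ᵇ? λ q →
    ¬? ((p ≟ᵇ α) ×-dec (q ≟ᵇ β)) →-dec ((p ≟ᵇ α) →-dec (q ≟ᵇ not β))) α β p q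

  disc₃-first : ∀ α p → disc₃ α (not α) p ≡ α
  disc₃-first = from-yes (∀ᵇ? λ α → ∀ᵇ? λ p → disc₃ α (not α) p ≟ᵇ α)

  disc₃-last : ∀ α p → disc₃ α α p ≡ p
  disc₃-last = from-yes (∀ᵇ? λ α → ∀ᵇ? λ p → disc₃ α α p ≟ᵇ p)

  module _ {m} (s : BFun m) (s-ext : Ext s) (s-false : s (λ _ → false) ≡ false)
           (s-neg : ∀ x → s (neg x) ≡ not (s x)) where

    s-const : ∀ b → s (λ _ → b) ≡ b
    s-const false = s-false
    s-const true  = trans (s-neg (λ _ → false)) (cong not s-false)

    attained : ∀ a → Σ (Fin (suc m)) λ i → a i ≡ s a
    attained a with dec (Σ (Fin (suc m)) λ i → a i ≡ s a)
    ... | yes p = p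
    ... | no ¬p = ⊥-elim (not-¬ refl (sym (trans (sym (s-const (not (s a))))
                                            (sym (s-ext (λ i → ¬-not (λ e → ¬p (i , e))))))))

    -- If no coordinate shows the pair `(s a , s b)` or its complement, then `b` is `a` or `neg a`,
    -- and the values of `s` there contradict self-duality. Otherwise some `k` shows the complement.
    -- With `i` and `j` attaining the values at `a` and `b`, the term `disc₃ (x i) (x k) (x j)`
    -- returns its first argument at `a`, where `x i` and `x k` differ, and its last at `b`, where
    -- they agree.
    two-points : ∀ a b → Σ (BFun m) λ g → g ∈ C × Ext g × g a ≡ s a × g b ≡ s b
    two-points a b with dec (Σ (Fin (suc m)) λ i → a i ≡ s a × b i ≡ s b)
    ... | yes (i , p , q) = proj i , π i , (λ e → e i) , p , q
    ... | no none with dec (Σ (Fin (suc m)) λ k → a k ≡ not (s a) × b k ≡ not (s b))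
    ...   | no none' = ⊥-elim (impossible (s a xor s b) refl)
      where
      impossible : ∀ c → s a xor s b ≡ c → ⊥
      impossible c e = contra (s a) (s b) c e
          (trans (s-ext {b} {λ i → if c then a i else not (a i)} (λ i →
                   trans (excluded-pairs (s a) (s b) (a i) (b i) (λ p → none (i , p)) (λ p → none' (i , p)))
                         (cong (λ d → if d then a i else not (a i)) e)))
                 (value c))
        where
        value : ∀ c → s (λ i → if c then a i else not (a i)) ≡ (if c then s a else not (s a))
        value true  = refl
        value false = s-neg a
        contra : ∀ α β c → α xor β ≡ c → β ≡ (if c then α else not α) → ⊥
        contra true  true  true  () _
        contra true  true  false _ ()
        contra true  false true  _ ()
        contra true  false false () _
        contra false true  true  _ ()
        contra false true  false () _
        contra false false true  () _
        contra false false false _ ()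
    ...   | yes (k , pk , qk) with attained a | attained b
    ...     | i , ai | j , bj =
      (λ x → disc₃ (x i) (x k) (x j))
      , app₃ disc₃ disc₃∈ (π i) (π k) (π j)
      , (λ e → cong₃ (e i) (e k) (e j))
      , trans (cong₃ ai pk refl) (disc₃-first (s a) (a j))
      , trans (cong₃ (other (λ p → none (i , p)) ai) qk bj) (disc₃-last (not (s b)) (s b))
      where
      cong₃ : ∀ {p p' q q' r r'} → p ≡ p' → q ≡ q' → r ≡ r' → disc₃ p q r ≡ disc₃ p' q' r'
      cong₃ refl refl refl = refl

    self-dual-idempotent∈ : s ∈ C
    self-dual-idempotent∈ = BakerPixley.baker-pixley isC maj∈ s s-ext two-points

  profile² : ∀ {n} → BFun n → X n → Fin ((2 * 2) * (2 * 2))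
  profile² f x = combine (profile f x) (profile f (neg x))

  profile²-split : ∀ {m n} (f : BFun m) (g : BFun n) {x y} → profile² f x ≡ profile² g y →
                   profile f x ≡ profile g y × profile f (neg x) ≡ profile g (neg y)
  profile²-split f g {x} {y} =
    Finₚ.combine-injective (profile f x) (profile f (neg x)) (profile g y) (profile g (neg y))

  Occurs : ∀ {n} → BFun n → Fin ((2 * 2) * (2 * 2)) → Set
  Occurs {n} f p = Σ (X n) λ x → profile² f x ≡ p

  τ : ∀ {n} → BFun n → Fin (((2 * 2) * (2 * 2)) * (2 ^ ((2 * 2) * (2 * 2))))
  τ f = combine (profile² f (λ _ → false)) (funToFin (λ p → bit (ind (Occurs f p))))

  module _ {m n} (f : BFun m) (g : BFun n) (same : τ f ≡ τ g) where

    private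
      parts = Finₚ.combine-injective (profile² f (λ _ → false)) (funToFin (λ p → bit (ind (Occurs f p))))
                                     (profile² g (λ _ → false)) (funToFin (λ p → bit (ind (Occurs g p)))) same

    -- The last clause sends the zero tuple to the zero tuple, which idempotence of the coordinates
    -- requires; `τ` records the profiles there for this purpose.
    Target : X m → Set
    Target x = Σ (X n) λ y → profile² f x ≡ profile² g y × (x ≐ (λ _ → false) → y ≐ (λ _ → false))

    target : ∀ x → Dec (x ≐ (λ _ → false)) → Target x
    target x (no ¬0) with ind⁻ {Occurs g (profile² f x)} (trans (sym (bit-injective
        (funToFin-injective {f = λ p → bit (ind (Occurs f p))} {λ p → bit (ind (Occurs g p))} (proj₂ parts) (profile² f x))))
        (ind⁺ (x , refl)))
    ... | y , e = y , sym e , λ x0 → ⊥-elim (¬0 x0)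
    target x (yes x0) = (λ _ → false) , trans zero-cong (proj₁ parts) , λ _ _ → refl
      where
      profile-cong : ∀ {x y : X m} → x ≐ y → profile f x ≡ profile f y
      profile-cong {x} {y} p = cong₂ (λ a b → combine (bit a) (bit b)) (go true) (go false)
        where
        go : ∀ b → val? f x b ≡ val? f y b
        go b = ind-cong (λ { (x' , q , e) → x' , ≐-trans q p , e })
                        (λ { (x' , q , e) → x' , ≐-trans q (≐-sym p) , e })
      zero-cong : profile² f x ≡ profile² f (λ _ → false)
      zero-cong = cong₂ combine (profile-cong x0) (profile-cong (neg-cong x0))

    base : (x : X m) → X n
    base x = proj₁ (target (point (index x)) (dec _))

    base-cong : ∀ {x y} → x ≐ y → base x ≡ base y
    base-cong p = cong (λ k → proj₁ (target (point k) (dec _))) (index-cong p)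

    base-zero : ∀ x → x ≐ (λ _ → false) → base x ≐ (λ _ → false)
    base-zero x p = proj₂ (proj₂ (target (point (index x)) (dec _))) (≐-trans (point-index x) p)

    -- Choosing the image freely on half of the points and extending by
    -- complementation makes every coordinate self-dual.
    image : Bool → X m → X n
    image false z = base z
    image true  z = neg (base (neg z))

    select : X m → X n
    select z = image (z zero) z

    select-cong : ∀ {x y} → x ≐ y → select x ≐ select y
    select-cong {x} {y} p i rewrite p zero = go (y zero)
      where
      go : ∀ b → image b x i ≡ image b y i
      go false = cong (λ v → v i) (base-cong p)
      go true  = cong (λ v → not (v i)) (base-cong (neg-cong p))

    select-zero : ∀ i → select (λ _ → false) i ≡ false
    select-zero = base-zero (λ _ → false) (λ _ → refl)

    select-neg : ∀ i z → select (neg z) i ≡ not (select z i)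
    select-neg i z = go (z zero)
      where
      go : ∀ b → image (not b) (neg z) i ≡ not (image b z i)
      go false = cong (λ v → not (v i)) (base-cong (λ j → not-involutive (z j)))
      go true  = sym (not-involutive (base (neg z) i))

    select∈ : ∀ i → (λ z → select z i) ∈ C
    select∈ i = self-dual-idempotent∈ (λ z → select z i) (λ p → select-cong p i) (select-zero i) (select-neg i)

    lifted : ∀ z → Σ (X n) λ y → (y ≐ select z) × g y ≡ f z
    lifted z = go (z zero)
      where
      go : ∀ b → Σ (X n) λ y → (y ≐ image b z) × g y ≡ f z
      go false = profile-lift f g
        (proj₁ (profile²-split f g (proj₁ (proj₂ (target (point (index z)) (dec _))))))
        (≐-sym (point-index z))
      go true = profile-lift f g
        (proj₂ (profile²-split f g (proj₁ (proj₂ (target (point (index (neg z))) (dec _))))))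
        (λ i → trans (sym (not-involutive (z i))) (sym (cong not (point-index (neg z) i))))

    τ-≤ : f ≤[ C ] g
    τ-≤ = (λ z → proj₁ (lifted z))
        , (λ i → ext C (λ z → sym (proj₁ (proj₂ (lifted z)) i)) (select∈ i))
        , λ z → sym (proj₂ (proj₂ (lifted z)))

  disc⇒finite : LatticeFinite C Ic
  disc⇒finite = finite isC _ τ τ-≤

-- Monotone functions and alternating chains

module MonotoneClone (em : ExcludedMiddle (lsuc 0ℓ)) {C : BSet} (isC : IsClone C)
                     (∧∈ : fun₂ _∧_ ∈ C) (∨∈ : fun₂ _∨_ ∈ C) where
  open CloneOps isC
  open Classical em

  -- By Baker-Pixley two points suffice. If `s` takes different values on them, monotonicity
  -- supplies a separating coordinate. If the values agree, a meet or join of two coordinates works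
  -- unless one of the points is a constant tuple, and only then is a constant function called for.
  monotone∈ : ∀ {m} (s : BFun m) → Mono s →
              (s (λ _ → false) ≡ true → (λ (_ : X m) → true) ∈ C) →
              (s (λ _ → true) ≡ false → (λ (_ : X m) → false) ∈ C) → s ∈ C
  monotone∈ {m} s mono one∈ zero∈ = BakerPixley.baker-pixley isC (lattice⇒maj isC ∧∈ ∨∈) s s-ext two-points
    where
    s-ext : Ext s
    s-ext = Mono⇒Ext mono

    Interpolated : X m → X m → Bool → Bool → Set
    Interpolated a b α β = Σ (BFun m) λ g → g ∈ C × Ext g × g a ≡ α × g b ≡ β

    search : ∀ (a : X m) c → (Σ (Fin (suc m)) λ i → a i ≡ c) ⊎ (a ≐ λ _ → not c)
    search a c with dec (Σ (Fin (suc m)) λ i → a i ≡ c)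
    ... | yes p = inj₁ p
    ... | no ¬p = inj₂ (λ i → ¬-not (λ e → ¬p (i , e)))

    separated : ∀ a b → s a ≡ true → s b ≡ false → Σ (Fin (suc m)) λ i → a i ≡ true × b i ≡ false
    separated a b sa sb with dec (Σ (Fin (suc m)) λ i → a i ≡ true × b i ≡ false)
    ... | yes p = p
    ... | no ¬p = ⊥-elim (true≢false (trans (sym (mono {a} {b} a≼b sa)) sb))
      where
      a≼b : a ≼ b
      a≼b i ai = ¬-not (λ bi → ¬p (i , ai , bi))

    both-false : ∀ a b → s a ≡ false → s b ≡ false → Interpolated a b false false
    both-false a b sa sb with search a false | search b false
    ... | inj₂ a1 | _ = (λ _ → false) , zero∈ (trans (sym (s-ext a1)) sa) , (λ _ → refl) , refl , refl
    ... | inj₁ _ | inj₂ b1 = (λ _ → false) , zero∈ (trans (sym (s-ext b1)) sb) , (λ _ → refl) , refl , refl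
    ... | inj₁ (i , ai) | inj₁ (j , bj) =
      (λ x → x i ∧ x j) , app₂ _∧_ ∧∈ (π i) (π j) , (λ p → cong₂ _∧_ (p i) (p j))
      , cong (_∧ a j) ai , trans (cong (b i ∧_) bj) (∧-zeroʳ (b i))

    both-true : ∀ a b → s a ≡ true → s b ≡ true → Interpolated a b true true
    both-true a b sa sb with search a true | search b true
    ... | inj₂ a0 | _ = (λ _ → true) , one∈ (trans (sym (s-ext a0)) sa) , (λ _ → refl) , refl , refl
    ... | inj₁ _ | inj₂ b0 = (λ _ → true) , one∈ (trans (sym (s-ext b0)) sb) , (λ _ → refl) , refl , refl
    ... | inj₁ (i , ai) | inj₁ (j , bj) =
      (λ x → x i ∨ x j) , app₂ _∨_ ∨∈ (π i) (π j) , (λ p → cong₂ _∨_ (p i) (p j))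
      , cong (_∨ a j) ai , trans (cong (b i ∨_) bj) (∨-zeroʳ (b i))

    two-points : ∀ a b → Interpolated a b (s a) (s b)
    two-points a b = go (s a) (s b) refl refl
      where
      go : ∀ α β → s a ≡ α → s b ≡ β → Interpolated a b α β
      go false false sa sb = both-false a b sa sb
      go true  true  sa sb = both-true a b sa sb
      go true  false sa sb with separated a b sa sb
      ... | i , ai , bi = proj i , π i , (λ p → p i) , ai , bi
      go false true  sa sb with separated b a sb sa
      ... | i , bi , ai = proj i , π i , (λ p → p i) , ai , bi

par : Bool → ℕ → Bool
par b zero    = b
par b (suc k) = not (par b k)

-- An ascending chain of `k + 1` points on which `f` takes the values `b`, `not b`, `b`, and so on.
-- The index `z` is an upper bound rather than the last point, so that chains can be raised before
-- they are prolonged.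
data Chain {m} (f : BFun m) (b : Bool) : ℕ → X m → Set where
  base : ∀ {x z} → f x ≡ b → x ≼ z → Chain f b zero z
  next : ∀ {k x z} → Chain f b k x → f x ≡ par b (suc k) → x ≼ z → Chain f b (suc k) z

≼-refl : ∀ {k} {x : Fin k → Bool} → x ≼ x
≼-refl i p = p

≼-trans : ∀ {k} {x y z : Fin k → Bool} → x ≼ y → y ≼ z → x ≼ z
≼-trans p q i e = q i (p i e)

chain-raise : ∀ {m} {f : BFun m} {b k z w} → Chain f b k z → z ≼ w → Chain f b k w
chain-raise (base e p)    z≼w = base e (λ i → λ xi → z≼w i (p i xi))
chain-raise (next ch e p) z≼w = next ch e (λ i → λ xi → z≼w i (p i xi))

chain-drop : ∀ {m} {f : BFun m} {b k z} → Chain f b (suc k) z → Chain f b k z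
chain-drop (next ch e p) = chain-raise ch p

chain-drop-≤ : ∀ {m} {f : BFun m} {b j k z} → j ≤ k → Chain f b k z → Chain f b j z
chain-drop-≤ {j = j} {zero}  z≤n ch = ch
chain-drop-≤ {j = j} {suc k} j≤k ch with ℕₚ.m≤n⇒m<n∨m≡n j≤k
... | inj₁ (s≤s j≤k') = chain-drop-≤ j≤k' (chain-drop ch)
... | inj₂ refl       = ch

chain-map : ∀ {m n} {f : BFun m} {g : BFun n} {b k z} (h : X m → X n) →
            (∀ {x y} → x ≼ y → h x ≼ h y) → (∀ x → f x ≡ g (h x)) → Chain f b k z → Chain g b k (h z)
chain-map h h-mono eq (base {x} e p)    = base (trans (sym (eq x)) e) (h-mono p)
chain-map h h-mono eq (next {x = x} ch e p) = next (chain-map h h-mono eq ch) (trans (sym (eq x)) e) (h-mono p)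

chain-ext : ∀ {m} {f g : BFun m} {b k z} → f ≐f g → Chain f b k z → Chain g b k z
chain-ext p = chain-map (λ x → x) (λ q → q) p

module _ {m} {f : BFun m} {b : Bool} where

  chain-point : ∀ {k z} → Chain f b k z → ℕ → X m
  chain-point (base {x} _ _) i = x
  chain-point (next {k} {x} ch _ _) i with i ℕₚ.≤? k
  ... | yes _ = chain-point ch i
  ... | no  _ = x

  chain-point-≼ : ∀ {k z} (ch : Chain f b k z) i → chain-point ch i ≼ z
  chain-point-≼ (base _ p) i = p
  chain-point-≼ (next {k} ch e p) i with i ℕₚ.≤? k
  ... | yes _ = ≼-trans (chain-point-≼ ch i) p
  ... | no  _ = p

  chain-point-mono : ∀ {k z} (ch : Chain f b k z) {i j} → i ≤ j → chain-point ch i ≼ chain-point ch j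
  chain-point-mono (base _ _) i≤j = ≼-refl
  chain-point-mono (next {k} ch e p) {i} {j} i≤j with i ℕₚ.≤? k | j ℕₚ.≤? k
  ... | yes _  | yes _  = chain-point-mono ch i≤j
  ... | yes _  | no _   = chain-point-≼ ch i
  ... | no _   | no _   = ≼-refl
  ... | no i≰k | yes j≤k = ⊥-elim (i≰k (ℕₚ.≤-trans i≤j j≤k))

  chain-point-val : ∀ {k z} (ch : Chain f b k z) {i} → i ≤ k → f (chain-point ch i) ≡ par b i
  chain-point-val (base e _) z≤n = e
  chain-point-val (next {k} ch e p) {i} i≤sk with i ℕₚ.≤? k
  ... | yes i≤k = chain-point-val ch i≤k
  ... | no i≰k with ℕₚ.m≤n⇒m<n∨m≡n i≤sk
  ...   | inj₁ (s≤s i≤k) = ⊥-elim (i≰k i≤k)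
  ...   | inj₂ refl      = e

weight : ∀ {k} → (Fin k → Bool) → ℕ
weight {zero}  x = 0
weight {suc k} x = (if x zero then 1 else 0) + weight (λ i → x (suc i))

weight-≤ : ∀ {k} (x : Fin k → Bool) → weight x ≤ k
weight-≤ {zero}  x = z≤n
weight-≤ {suc k} x with x zero
... | true  = s≤s (weight-≤ (λ i → x (suc i)))
... | false = ℕₚ.m≤n⇒m≤1+n (weight-≤ (λ i → x (suc i)))

weight-mono : ∀ {k} (x y : Fin k → Bool) → x ≼ y → weight x ≤ weight y
weight-mono {zero}  x y p = z≤n
weight-mono {suc k} x y p with x zero in ex | y zero in ey
... | false | false = weight-mono _ _ (λ i → p (suc i))
... | false | true  = ℕₚ.m≤n⇒m≤1+n (weight-mono _ _ (λ i → p (suc i)))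
... | true  | true  = s≤s (weight-mono _ _ (λ i → p (suc i)))
... | true  | false = ⊥-elim (true≢false (trans (sym (p zero ex)) ey))

weight-strict : ∀ {k} (x y : Fin k → Bool) → x ≼ y → ¬ (x ≐ y) → weight x < weight y
weight-strict {zero}  x y p x≢y = ⊥-elim (x≢y λ ())
weight-strict {suc k} x y p x≢y with x zero in ex | y zero in ey
... | false | false = weight-strict _ _ (λ i → p (suc i)) λ q → x≢y λ { zero → trans ex (sym ey) ; (suc i) → q i }
... | false | true  = s≤s (weight-mono _ _ (λ i → p (suc i)))
... | true  | true  = s≤s (weight-strict _ _ (λ i → p (suc i)) λ q → x≢y λ { zero → trans ex (sym ey) ; (suc i) → q i })
... | true  | false = ⊥-elim (true≢false (trans (sym (p zero ex)) ey))

-- For an extensional `f` consecutive points differ, because the values do; so the weight grows at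
-- every step.
chain-weight : ∀ {m} {f : BFun m} {b k z} → Ext f → Chain f b k z →
               Σ (X m) λ x → x ≼ z × f x ≡ par b k × k ≤ weight x
chain-weight fx (base {x} e p) = x , p , e , z≤n
chain-weight {b = b} fx (next {k} {x} ch e p) with chain-weight fx ch
... | x' , x'≼x , e' , k≤ = x , p , e ,
  ℕₚ.≤-<-trans k≤ (weight-strict x' x x'≼x λ q → not-¬ refl (sym (trans (sym e) (trans (sym (fx q)) e'))))

chain-bound : ∀ {m} {f : BFun m} {b k z} → Ext f → Chain f b k z → k ≤ suc m
chain-bound fx ch with chain-weight fx ch
... | x , _ , _ , k≤ = ℕₚ.≤-trans k≤ (weight-≤ x)

parity : ∀ {m} → BFun m
parity x = par false (weight x)

weight-cong : ∀ {k} {x y : Fin k → Bool} → x ≐ y → weight x ≡ weight y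
weight-cong {zero}  p = refl
weight-cong {suc k} p = cong₂ _+_ (cong (λ b → if b then 1 else 0) (p zero)) (weight-cong (λ i → p (suc i)))

initial : ∀ {n} → ℕ → Fin n → Bool
initial zero    _       = false
initial (suc k) zero    = true
initial (suc k) (suc i) = initial k i

weight-initial : ∀ {n} k → k ≤ n → weight {n} (initial k) ≡ k
weight-initial {zero}  zero    _       = refl
weight-initial {suc n} zero    _       = weight-initial {n} zero z≤n
weight-initial {suc n} (suc k) (s≤s p) = cong suc (weight-initial {n} k p)

initial-≼ : ∀ {n} k → initial {n} k ≼ initial (suc k)
initial-≼ (suc k) zero    p = refl
initial-≼ (suc k) (suc i) p = initial-≼ k i p

-- Adding one variable at a time flips the parity at every step, so the bound of `chain-bound` is
-- attained.
parity-chain : ∀ {m} k → k ≤ suc m → Chain (parity {m}) false k (initial k)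
parity-chain {m} zero    k≤ = base (cong (par false) (weight-initial {suc m} zero z≤n)) ≼-refl
parity-chain {m} (suc k) k≤ =
  next {x = initial (suc k)} (chain-raise (parity-chain k (ℕₚ.<⇒≤ k≤)) (initial-≼ k))
       (cong (par false) (weight-initial {suc m} (suc k) k≤)) ≼-refl

module Bounded (em : ExcludedMiddle (lsuc 0ℓ)) where
  open Classical em

  greatest : {P : ℕ → Set} → P 0 → ∀ N → (∀ k → P k → k ≤ N) → Σ ℕ λ k → P k × (∀ j → P j → j ≤ k)
  greatest p0 zero bound = 0 , p0 , bound
  greatest {P} p0 (suc N) bound with dec (P (suc N))
  ... | yes p = suc N , p , bound
  ... | no ¬p = greatest p0 N λ k pk → ℕₚ.≤-pred (ℕₚ.≤∧≢⇒< (bound k pk) λ { refl → ¬p pk })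

  least : {P : ℕ → Set} → ∀ N → P N → Σ ℕ λ k → P k × (∀ j → P j → k ≤ j)
  least zero p = 0 , p , λ _ _ → z≤n
  least {P} (suc N) p with dec (P 0)
  ... | yes p0 = 0 , p0 , λ _ _ → z≤n
  ... | no ¬p0 with least {λ k → P (suc k)} N p
  ...   | k , pk , k-min = suc k , pk , λ { zero p0 → ⊥-elim (¬p0 p0) ; (suc j) pj → s≤s (k-min j pj) }

⊥ᵖ ⊤ᵖ : ∀ {m} → X m
⊥ᵖ _ = false
⊤ᵖ _ = true

≼-⊤ : ∀ {m} {x : X m} → x ≼ ⊤ᵖ
≼-⊤ _ _ = refl

-- Starting at the value at `⊥ᵖ` loses nothing: a chain that starts with the other value becomes
-- longer by putting `⊥ᵖ` in front.
Alt : ∀ {m} → BFun m → ℕ → Set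
Alt f k = Chain f (f ⊥ᵖ) k ⊤ᵖ

-- Clonoids over clones containing both lattice operations

module LatticeClone (em : ExcludedMiddle (lsuc 0ℓ)) {C : BSet} (isC : IsClone C)
                    (∧∈ : fun₂ _∧_ ∈ C) (∨∈ : fun₂ _∨_ ∈ C) where
  open CloneOps isC
  open Classical em
  open Bounded em
  open MonotoneClone em isC ∧∈ ∨∈

  module _ {m n} (f : BFun m) (g : BFun n)
           (same-bot : profile f ⊥ᵖ ≡ profile g ⊥ᵖ) (same-top : profile f ⊤ᵖ ≡ profile g ⊤ᵖ) where

    -- Overriding `inner` at both constant tuples by the corresponding constant tuples keeps it
    -- monotone and makes every coordinate idempotent, hence a member of `C` even if `C` has no
    -- constants. Equality of the profiles at the ends allows the override.
    reduce : (inner : X m → X n) → (∀ {x y} → x ≼ y → inner x ≼ inner y) →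
             (∀ z → Σ (X n) λ y → (y ≐ inner z) × g y ≡ f z) → f ≤[ C ] g
    reduce inner inner-mono inner-lift =
      (λ z → proj₁ (lifted z))
      , (λ i → ext C (λ z → sym (proj₁ (proj₂ (lifted z)) i)) (outer∈ i))
      , λ z → sym (proj₂ (proj₂ (lifted z)))
      where
      choose : ∀ z → Dec (z ≐ ⊥ᵖ) → Dec (z ≐ ⊤ᵖ) → X n
      choose z (yes _) _       = ⊥ᵖ
      choose z (no _)  (yes _) = ⊤ᵖ
      choose z (no _)  (no _)  = inner z

      outer : X m → X n
      outer z = choose z (dec _) (dec _)

      lift-choose : ∀ z d d' → Σ (X n) λ y → (y ≐ choose z d d') × g y ≡ f z
      lift-choose z (yes z0) _        = profile-lift f g same-bot z0
      lift-choose z (no _)   (yes z1) = profile-lift f g same-top z1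
      lift-choose z (no _)   (no _)   = inner-lift z

      lifted : ∀ z → Σ (X n) λ y → (y ≐ outer z) × g y ≡ f z
      lifted z = lift-choose z (dec _) (dec _)

      choose-mono : ∀ {x z} dx dx' dz dz' → x ≼ z → choose x dx dx' ≼ choose z dz dz'
      choose-mono (yes _) _ _ _ x≼z i ()
      choose-mono (no ¬x0) _ (yes z0) _ x≼z i _ =
        ⊥-elim (¬x0 (λ j → ¬-not (λ xj → true≢false (trans (sym (x≼z j xj)) (z0 j)))))
      choose-mono (no _) _ (no _) (yes _) x≼z i _ = refl
      choose-mono (no _) (yes x1) (no _) (no ¬z1) x≼z i _ = ⊥-elim (¬z1 (λ j → x≼z j (x1 j)))
      choose-mono (no _) (no _) (no _) (no _) x≼z = inner-mono x≼z

      choose-bot : ∀ d d' i → choose ⊥ᵖ d d' i ≡ false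
      choose-bot (yes _) _ i = refl
      choose-bot (no ¬p) _ i = ⊥-elim (¬p (λ _ → refl))

      choose-top : ∀ d d' i → choose ⊤ᵖ d d' i ≡ true
      choose-top (yes p) _       i = ⊥-elim (true≢false (p zero))
      choose-top (no _)  (yes _) i = refl
      choose-top (no _)  (no ¬p) i = ⊥-elim (¬p (λ _ → refl))

      outer∈ : ∀ i → (λ z → outer z i) ∈ C
      outer∈ i = monotone∈ (λ z → outer z i)
        (λ {x} {y} p → choose-mono (dec _) (dec _) (dec (y ≐ ⊥ᵖ)) (dec (y ≐ ⊤ᵖ)) p i)
        (λ e → ⊥-elim (true≢false (trans (sym e) (choose-bot (dec _) (dec _) i))))
        (λ e → ⊥-elim (true≢false (trans (sym (choose-top (dec _) (dec _) i)) e)))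

    Ambiguous : ∀ {k} → BFun k → Set
    Ambiguous {k} u = Σ (X k) λ y → Σ (X k) λ y' → (y ≐ y') × (u y ≡ false) × (u y' ≡ true)

    unambiguous⇒ext : ∀ {k} (u : BFun k) → ¬ Ambiguous u → Ext u
    unambiguous⇒ext u ¬amb {x} {y} p = go (u x) (u y) refl refl
      where
      go : ∀ a b → u x ≡ a → u y ≡ b → u x ≡ u y
      go false false e e' = trans e (sym e')
      go true  true  e e' = trans e (sym e')
      go false true  e e' = ⊥-elim (¬amb (x , y , p , e , e'))
      go true  false e e' = ⊥-elim (¬amb (y , x , ≐-sym p , e' , e))

    -- Pointwise equal representatives lie below each other in `≼`, so a chain can alternate between
    -- them indefinitely.
    ambiguous-chain : ∀ {k} (u : BFun k) {b} → Ambiguous u → ∀ j → Chain u b j ⊤ᵖ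
    ambiguous-chain {k} u {b} (y , y' , p , e , e') j = chain-raise (go j) ≼-⊤
      where
      rep : Bool → X k
      rep false = y
      rep true  = y'
      rep-val : ∀ c → u (rep c) ≡ c
      rep-val false = e
      rep-val true  = e'
      rep-≼ : ∀ c → rep c ≼ y
      rep-≼ false = ≼-refl
      rep-≼ true  = ≐⇒≼ (≐-sym p)
      go : ∀ j → Chain u b j y
      go zero    = base {x = rep b} (rep-val b) (rep-≼ b)
      go (suc j) = next {x = rep c} (chain-raise (go j) (below c)) (rep-val c) (rep-≼ c)
        where
        c = par b (suc j)
        below : ∀ c → y ≼ rep c
        below false = ≼-refl
        below true  = ≐⇒≼ p

    -- If `g` takes both values on one pointwise class, every input can be sent into that class.
    -- Otherwise `z` goes to the point numbered `ℓ z` of an alternating chain of `g`, where `ℓ z` is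
    -- the length of the longest chain of `f` below `z`: this is monotone, and the parity of `ℓ z`
    -- determines the value.
    alternation-≤ : (∀ k → Alt f k → Alt g k) → f ≤[ C ] g
    alternation-≤ alt with dec (Ambiguous g)
    ... | yes (y , y' , p , e , e') = reduce (λ _ → y) (λ _ → ≼-refl) (λ z → rep (f z))
      where
      rep : ∀ c → Σ (X n) λ w → (w ≐ y) × g w ≡ c
      rep false = y , (λ _ → refl) , e
      rep true  = y' , ≐-sym p , e'
    ... | no ¬amb = reduce inner inner-mono inner-lift
      where
      g-ext : Ext g
      g-ext = unambiguous⇒ext g ¬amb

      f-ext : Ext f
      f-ext = unambiguous⇒ext f λ amb →
        -- `g` has `suc n` variables, so `suc (suc n)` is the first length its chains cannot have.
        ℕₚ.1+n≰n (chain-bound g-ext (alt (suc (suc n)) (ambiguous-chain f amb (suc (suc n)))))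

      f⊥≡g⊥ : f ⊥ᵖ ≡ g ⊥ᵖ
      f⊥≡g⊥ with profile-lift f g {⊥ᵖ} {⊥ᵖ} same-bot {⊥ᵖ} (λ _ → refl)
      ... | y , y≐ , e = trans (sym e) (g-ext y≐)

      Level : X m → Set
      Level z = Σ ℕ λ k → Chain f (f ⊥ᵖ) k z × (∀ j → Chain f (f ⊥ᵖ) j z → j ≤ k)

      level : ∀ z → Level z
      level z = greatest (base {x = ⊥ᵖ} refl (λ _ ())) (suc m) (λ k → chain-bound f-ext)

      ℓ : X m → ℕ
      ℓ z = proj₁ (level z)

      ℓ-mono : ∀ {x z} → x ≼ z → ℓ x ≤ ℓ z
      ℓ-mono {x} {z} p = proj₂ (proj₂ (level z)) (ℓ x) (chain-raise (proj₁ (proj₂ (level x))) p)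

      ℓ-val : ∀ z → f z ≡ par (f ⊥ᵖ) (ℓ z)
      ℓ-val z with f z ≟ᵇ par (f ⊥ᵖ) (ℓ z)
      ... | yes e = e
      -- With the other value, `z` itself would prolong the longest chain below it.
      ... | no ¬e = ⊥-elim (ℕₚ.1+n≰n (proj₂ (proj₂ (level z)) (suc (ℓ z))
                      (next {x = z} (proj₁ (proj₂ (level z))) (¬-not ¬e) ≼-refl)))

      g-chain : Chain g (g ⊥ᵖ) (ℓ ⊤ᵖ) ⊤ᵖ
      g-chain = alt (ℓ ⊤ᵖ) (proj₁ (proj₂ (level ⊤ᵖ)))

      inner : X m → X n
      inner z = chain-point g-chain (ℓ z)

      inner-mono : ∀ {x y} → x ≼ y → inner x ≼ inner y
      inner-mono p = chain-point-mono g-chain (ℓ-mono p)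

      inner-lift : ∀ z → Σ (X n) λ y → (y ≐ inner z) × g y ≡ f z
      inner-lift z = inner z , (λ _ → refl) ,
        trans (chain-point-val g-chain (ℓ-mono ≼-⊤))
              (trans (cong (λ b → par b (ℓ z)) (sym f⊥≡g⊥)) (sym (ℓ-val z)))

  ends : ∀ {n} → BFun n → Fin ((2 * 2) * (2 * 2))
  ends f = combine (profile f ⊥ᵖ) (profile f ⊤ᵖ)

  ends-≤ : ∀ {m n} (f : BFun m) (g : BFun n) → ends f ≡ ends g → (∀ k → Alt f k → Alt g k) → f ≤[ C ] g
  ends-≤ f g p with Finₚ.combine-injective (profile f ⊥ᵖ) (profile f ⊤ᵖ) (profile g ⊥ᵖ) (profile g ⊤ᵖ) p
  ... | p⊥ , p⊤ = alternation-≤ f g p⊥ p⊤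

  Reaches : BSet → Fin ((2 * 2) * (2 * 2)) → ℕ → Set
  Reaches K c k = Σ ℕ λ n → Σ (BFun n) λ f → f ∈ K × ends f ≡ c × Alt f k

  Unbounded : BSet → Fin ((2 * 2) * (2 * 2)) → Set
  Unbounded K c = Σ ℕ λ n → Σ (BFun n) λ f → f ∈ K × ends f ≡ c × (∀ k → Alt f k)

  unbounded⇒reaches : ∀ {K c} → Unbounded K c → ∀ k → Reaches K c k
  unbounded⇒reaches (n , f , f∈ , e , alt) k = n , f , f∈ , e , alt k

  reaches-drop : ∀ {K c j k} → j ≤ k → Reaches K c k → Reaches K c j
  reaches-drop j≤k (n , f , f∈ , e , alt) = n , f , f∈ , e , chain-drop-≤ j≤k alt

  -- The lengths reached form an initial segment of the natural numbers: `suc (suc k)` codes the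
  -- segment below `k`, which is empty for `k = 0`. If all lengths are reached, 0 and 1 tell whether
  -- a single member reaches them all; a non-extensional function can do so.
  Size : BSet → Fin ((2 * 2) * (2 * 2)) → ℕ → Set
  Size K c 0 = Unbounded K c
  Size K c 1 = ¬ Unbounded K c × (∀ k → Reaches K c k)
  Size K c (suc (suc k)) = ¬ Unbounded K c × ¬ Reaches K c k × (∀ j → ¬ Reaches K c j → k ≤ j)

  size : ∀ K c → Σ ℕ (Size K c)
  size K c with dec (Unbounded K c)
  ... | yes u = 0 , u
  ... | no ¬u with dec (Σ ℕ λ k → ¬ Reaches K c k)
  ...   | no none = 1 , ¬u , reached
    where
    reached : ∀ k → Reaches K c k
    reached k with dec (Reaches K c k)
    ... | yes r = r
    ... | no ¬r = ⊥-elim (none (k , ¬r))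
  ...   | yes (N , ¬r) with least {λ k → ¬ Reaches K c k} N ¬r
  ...     | k , ¬rk , k-min = suc (suc k) , ¬u , ¬rk , k-min

  size-unbounded : ∀ {K L c} s → Size K c s → Size L c s → Unbounded K c → Unbounded L c
  size-unbounded 0             _        uL _ = uL
  size-unbounded 1             (¬u , _) _  u = ⊥-elim (¬u u)
  size-unbounded (suc (suc k)) (¬u , _) _  u = ⊥-elim (¬u u)

  size-reaches : ∀ {K L c} s → Size K c s → Size L c s → ∀ j → Reaches K c j → Reaches L c j
  size-reaches {L = L} 0 _ uL j _ = unbounded⇒reaches {L} uL j
  size-reaches 1             _ (_ , all) j _ = all j
  size-reaches {K} {L} {c} (suc (suc k)) (_ , ¬rk , _) (_ , _ , k-min) j r with dec (Reaches L c j)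
  ... | yes r' = r'
  ... | no ¬r' = ⊥-elim (¬rk (reaches-drop {K} (k-min j ¬r') r))

  size-unique : ∀ {K L c} s t → Size K c s → Size L c t →
                (Unbounded K c → Unbounded L c) → (Unbounded L c → Unbounded K c) →
                (∀ j → Reaches K c j → Reaches L c j) → (∀ j → Reaches L c j → Reaches K c j) → s ≡ t
  size-unique 0 0 _ _ _ _ _ _ = refl
  size-unique 1 1 _ _ _ _ _ _ = refl
  size-unique 0 1 u (¬u , _) u→ u← r→ r← = ⊥-elim (¬u (u→ u))
  size-unique 0 (suc (suc _)) u (¬u , _) u→ u← r→ r← = ⊥-elim (¬u (u→ u))
  size-unique 1 0 (¬u , _) u u→ u← r→ r← = ⊥-elim (¬u (u← u))
  size-unique (suc (suc _)) 0 (¬u , _) u u→ u← r→ r← = ⊥-elim (¬u (u← u))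
  size-unique 1 (suc (suc k)) (_ , all) (_ , ¬r , _) u→ u← r→ r← = ⊥-elim (¬r (r→ k (all k)))
  size-unique (suc (suc k)) 1 (_ , ¬r , _) (_ , all) u→ u← r→ r← = ⊥-elim (¬r (r← k (all k)))
  size-unique (suc (suc k)) (suc (suc j)) (_ , ¬r , k-min) (_ , ¬r' , j-min) u→ u← r→ r← =
    cong (λ i → suc (suc i)) (ℕₚ.≤-antisym (k-min j (λ r → ¬r' (r→ j r))) (j-min k (λ r → ¬r (r← k r))))

  number : Clonoid C Ic → ℕ
  number (K , _) = encode ((2 * 2) * (2 * 2)) (λ c → proj₁ (size K c))

  -- A member of `K` has chains of all lengths or a longest one. Accordingly `L` contains a function
  -- with the same ends and chains of all lengths, or one reaching that longest length, and the
  -- member reduces to it.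
  number-⊆ : (K L : Clonoid C Ic) → number K ≡ number L → proj₁ K ⊆ proj₁ L
  number-⊆ (K , isK) (L , isL) p f f∈K = go (dec (∀ k → Alt f k))
    where
    c = ends f
    s = proj₁ (size K c)
    sizeK : Size K c s
    sizeK = proj₂ (size K c)
    sizeL : Size L c s
    sizeL = subst (Size L c) (sym (encode-injective _ (λ c → proj₁ (size K c)) (λ c → proj₁ (size L c)) p c))
                  (proj₂ (size L c))
    go : Dec (∀ k → Alt f k) → f ∈ L
    go (yes alt) with size-unbounded {K} {L} s sizeK sizeL (_ , f , f∈K , refl , alt)
    ... | _ , g , g∈L , e , alt' = ≤-mem {K = L} isL g∈L (ends-≤ f g (sym e) (λ k _ → alt' k))
    go (no ¬alt) with dec (Σ ℕ λ k → ¬ Alt f k)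
    ... | no none = ⊥-elim (¬alt λ k → case-dec k (dec (Alt f k)))
      where
      case-dec : ∀ k → Dec (Alt f k) → Alt f k
      case-dec k (yes a) = a
      case-dec k (no ¬a) = ⊥-elim (none (k , ¬a))
    ... | yes (N , ¬a) with greatest {Alt f} (base {x = ⊥ᵖ} refl (λ _ ())) N
                              (λ k a → ℕₚ.<⇒≤ (ℕₚ.≰⇒> λ N≤k → ¬a (chain-drop-≤ N≤k a)))
    ...   | k , a , k-max with size-reaches {K} {L} s sizeK sizeL k (_ , f , f∈K , refl , a)
    ...     | _ , g , g∈L , e , a' =
      ≤-mem {K = L} isL g∈L (ends-≤ f g (sym e) (λ j aj → chain-drop-≤ (k-max j aj) a'))

  number-cong : {K L : Clonoid C Ic} → K ≋c L → number K ≡ number L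
  number-cong {K , _} {L , _} (p , q) = encode-cong _ λ c →
    size-unique {K} {L} _ _ (proj₂ (size K c)) (proj₂ (size L c))
      (λ { (n , f , f∈ , r) → n , f , p f f∈ , r }) (λ { (n , f , f∈ , r) → n , f , q f f∈ , r })
      (λ { j (n , f , f∈ , r) → n , f , p f f∈ , r }) (λ { j (n , f , f∈ , r) → n , f , q f f∈ , r })

  module _ (C-mono : ∀ {n} (f : BFun n) → f ∈ C → Mono f) where

    short : ℕ → BSet
    short k = record
      { mem = λ f → ¬ Chain f false (suc k) ⊤ᵖ
      ; ext = λ f≐g ¬ch ch → ¬ch (chain-ext (λ x → sym (f≐g x)) ch) }

    shortClonoid : ℕ → Clonoid C Ic
    shortClonoid k = short k , mkClonoid (short k) λ f gs ¬ch gs∈ ch →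
      ¬ch (chain-raise (chain-map (λ x i → gs i x) (λ p i → C-mono (gs i) (gs∈ i) p) (λ _ → refl) ch) ≼-⊤)

    short-< : ∀ {i j} → i < j → ¬ (shortClonoid i ≋c shortClonoid j)
    short-< {i} {suc j} i<j (_ , q) =
      -- `parity {j}` has `suc j` variables: its chains reach length `suc j`, hence `suc i`, but not
      -- `suc (suc j)`.
      q (parity {j}) (λ ch → ℕₚ.1+n≰n (chain-bound {m = j} (λ p → cong (par false) (weight-cong p)) ch))
        (chain-raise (parity-chain (suc i) i<j) ≼-⊤)

    short-injective : ∀ {i j} → shortClonoid i ≋c shortClonoid j → i ≡ j
    short-injective {i} {j} (p , q) with ℕₚ.<-cmp i j
    ... | tri< i<j _ _ = ⊥-elim (short-< i<j (p , q))
    ... | tri≈ _ e _   = e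
    ... | tri> _ _ j<i = ⊥-elim (short-< j<i (q , p))

    countable : LatticeCountablyInfinite C Ic
    countable = schröder-bernstein
      (record { refl = refl ; sym = sym ; trans = trans }) ≋-equiv
      shortClonoid (λ { refl → (λ f p → p) , (λ f p → p) }) short-injective
      number (λ {K} {L} → number-cong {K} {L})
      (λ {K} {L} p → number-⊆ K L p , number-⊆ L K (sym p))

-- Antichains for join homomorphisms and affine functions

unit : ∀ {n} → Fin n → Fin n → Bool
unit zero    zero    = true
unit zero    (suc j) = false
unit (suc i) zero    = false
unit (suc i) (suc j) = unit i j

unit-refl : ∀ {n} (i : Fin n) → unit i i ≡ true
unit-refl zero    = refl
unit-refl (suc i) = unit-refl i

unit-≡ : ∀ {n} {i j : Fin n} → unit i j ≡ true → i ≡ j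
unit-≡ {i = zero}  {zero}  e = refl
unit-≡ {i = suc i} {suc j} e = cong suc (unit-≡ e)

unit-≢ : ∀ {n} {i j : Fin n} → i ≢ j → unit i j ≡ false
unit-≢ i≢j = ¬-not (λ e → i≢j (unit-≡ e))

double : ℕ → ℕ
double zero    = zero
double (suc k) = suc (suc (double k))

double-injective : ∀ {j k} → double j ≡ double k → j ≡ k
double-injective {zero}  {zero}  e = refl
double-injective {suc j} {suc k} e = cong suc (double-injective (ℕₚ.suc-injective (ℕₚ.suc-injective e)))

-- The parity 5 + 2k of the number of variables only matters for linear functions.
vars : ℕ → ℕ
vars k = suc (4 + double k)

vars-injective : ∀ {j k} → vars j ≡ vars k → j ≡ k
vars-injective e = double-injective (ℕₚ.+-cancelˡ-≡ 5 _ _ e)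

-- The unit vectors together with the all-ones vector.
spike : ∀ {n} → Fin (suc n) → Fin n → Bool
spike zero    _ = true
spike (suc i) j = unit i j

-- Violations of preserving joins and of additivity on disjoint supports. The join and the zero
-- tuple enter through arbitrary representatives, so that absence of `WitnessL` also makes `f`
-- extensional.
WitnessV WitnessL : ∀ {n} → BFun n → Set
WitnessV {n} f = Σ (X n) λ a → Σ (X n) λ b → Σ (X n) λ c →
  (∀ i → c i ≡ a i ∨ b i) × f a ≡ false × f b ≡ false × f c ≡ true
WitnessL {n} f = Σ (X n) λ a → Σ (X n) λ b → Σ (X n) λ c → Σ (X n) λ d →
  (∀ i → a i ∧ b i ≡ false × c i ≡ a i ∨ b i × d i ≡ false) × (f d xor f a) xor (f b xor f c) ≡ true

module Spikes (em : ExcludedMiddle (lsuc 0ℓ)) where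
  open Classical em

  spiky : ∀ k → BFun (4 + double k)
  spiky k x = ind (Σ (Fin (suc (vars k))) λ p → x ≐ spike p)

  spiky-spike : ∀ k p → spiky k (spike p) ≡ true
  spiky-spike k p = ind⁺ (p , λ _ → refl)

  spiky-ext : ∀ k → Ext (spiky k)
  spiky-ext k p = ind-cong (λ { (q , e) → q , ≐-trans (≐-sym p) e }) (λ { (q , e) → q , ≐-trans p e })

  fresh : ∀ k (v : Fin 4 → Fin (vars k)) → Σ (Fin (vars k)) λ i → ∀ j → i ≢ v j
  fresh k v with dec (Σ (Fin (vars k)) λ i → ∀ j → i ≢ v j)
  ... | yes p = p
  -- There are at least five variables and only four values to avoid.
  ... | no ¬p = ⊥-elim (ℕₚ.<⇒≱ (s≤s (s≤s (s≤s (s≤s (s≤s z≤n)))))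
                  (Finₚ.injective⇒≤ {f = λ i → proj₁ (hit i)} λ {i} {i'} e →
                    trans (proj₂ (hit i)) (trans (cong v e) (sym (proj₂ (hit i'))))))
    where
    hit : ∀ i → Σ (Fin 4) λ j → i ≡ v j
    hit i with dec (Σ (Fin 4) λ j → i ≡ v j)
    ... | yes q = q
    ... | no ¬q = ⊥-elim (¬p (i , λ j e → ¬q (j , e)))

  fresh₄ : ∀ k (a b c d : Fin (vars k)) → Σ (Fin (vars k)) λ i → i ≢ a × i ≢ b × i ≢ c × i ≢ d
  fresh₄ k a b c d with fresh k v
    where
    v : Fin 4 → Fin (vars k)
    v zero                   = a
    v (suc zero)             = b
    v (suc (suc zero))       = c
    v (suc (suc (suc zero))) = d
  ... | i , p = i , p zero , p (suc zero) , p (suc (suc zero)) , p (suc (suc (suc zero)))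

  hits : ∀ {j k} (h : X (4 + double j) → X (4 + double k)) → (∀ z → spiky j z ≡ spiky k (h z)) →
         ∀ p → Σ (Fin (suc (vars k))) λ q → h (spike p) ≐ spike q
  hits {j} h eq p = ind⁻ (trans (sym (eq (spike p))) (spiky-spike j p))

  PreservesV : ∀ {n} → BFun n → Set
  PreservesV f = Mono f × ¬ WitnessV f

  initial-step : ∀ {n} k (k<n : k < n) i → initial {n} (suc k) i ≡ initial k i ∨ unit (fromℕ< k<n) i
  initial-step {suc n} zero    k<n       zero    = refl
  initial-step {suc n} zero    k<n       (suc i) = refl
  initial-step {suc n} (suc k) (s≤s k<n) zero    = refl
  initial-step {suc n} (suc k) (s≤s k<n) (suc i) = initial-step k k<n i

  initial-all : ∀ {n} (i : Fin n) → initial n i ≡ true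
  initial-all zero    = refl
  initial-all (suc i) = initial-all i

  -- Along the initial segments a value can turn true only through the unit vector just joined.
  V-unit : ∀ {m} (f : BFun m) → PreservesV f → f ⊤ᵖ ≡ true → Σ (Fin (suc m)) λ i → f (unit i) ≡ true
  V-unit {m} f (mono , ¬w) e = go (suc m) ℕₚ.≤-refl (mono {⊤ᵖ} {initial (suc m)} (λ i _ → initial-all i) e)
    where
    go : ∀ k → k ≤ suc m → f (initial k) ≡ true → Σ (Fin (suc m)) λ i → f (unit i) ≡ true
    go zero    _  e = zero , mono {initial 0} {unit zero} (λ i ()) e
    go (suc k) k< e with f (initial k) ≟ᵇ true | f (unit (fromℕ< k<)) ≟ᵇ true
    ... | yes e' | _      = go k (ℕₚ.<⇒≤ k<) e'
    ... | no _   | yes e' = fromℕ< k< , e'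
    ... | no p   | no q   = ⊥-elim (¬w (initial k , unit (fromℕ< k<) , initial (suc k)
                                       , initial-step k k< , ¬-not p , ¬-not q , e))

  V-join : ∀ {m} (f : BFun m) → PreservesV f → ∀ {a b c} → (∀ i → c i ≡ a i ∨ b i) → f c ≡ f a ∨ f b
  V-join f (mono , ¬w) {a} {b} {c} p with f a in ea | f b in eb
  ... | true  | _    = mono {a} {c} (λ i ai → trans (p i) (cong (_∨ b i) ai)) ea
  ... | false | true = mono {b} {c} (λ i bi → trans (p i) (trans (cong (a i ∨_) bi) (∨-zeroʳ (a i)))) eb
  ... | false | false = ¬-not (λ fc → ¬w (a , b , c , p , ea , eb , fc))

  -- The join of two different unit vectors is no spike, hence neither is its image. So no unit
  -- vector goes to the all-ones vector, which would absorb the join, and no two have the same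
  -- image. As the all-ones vector is fixed, `V-unit` puts a unit vector over each coordinate, which
  -- makes `ψ` a bijection.
  V-sizes : ∀ {j k} (h : X (4 + double j) → X (4 + double k)) → (∀ i → PreservesV (λ z → h z i)) →
            (∀ z → spiky j z ≡ spiky k (h z)) → vars j ≡ vars k
  V-sizes {j} {k} h hV eq = ℕₚ.≤-antisym (Finₚ.injective⇒≤ {f = ψ} ψ-injective)
      (Finₚ.injective⇒≤ {f = λ q → proj₁ (ψ-onto q)}
         (λ {q} {q'} e → trans (sym (proj₂ (ψ-onto q))) (trans (cong ψ e) (proj₂ (ψ-onto q')))))
    where
    join : Fin (vars j) → Fin (vars j) → X (4 + double j)
    join i i' l = unit i l ∨ unit i' l

    join-dull : ∀ i i' → i ≢ i' → ∀ q → ¬ (h (join i i') ≐ spike q)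
    join-dull i i' i≢i' q e with ind⁻ (trans (eq (join i i')) (ind⁺ (q , e)))
    ... | zero , p with fresh₄ j i i' i i'
    ...   | l , l≢i , l≢i' , _ = true≢false (trans (sym (p l))
              (cong₂ _∨_ (unit-≢ (λ e → l≢i (sym e))) (unit-≢ (λ e → l≢i' (sym e)))))
    join-dull i i' i≢i' q e | suc l , p =
      i≢i' (trans (sym (unit-≡ {i = l} {i} (trans (sym (p i)) (cong (_∨ unit i' i) (unit-refl i)))))
                  (unit-≡ {i = l} {i'} (trans (sym (p i')) (trans (cong (unit i i' ∨_) (unit-refl i')) (∨-zeroʳ (unit i i'))))))

    join-image : ∀ i i' → h (join i i') ≐ λ l → h (unit i) l ∨ h (unit i') l
    join-image i i' l = V-join (λ z → h z l) (hV l) (λ _ → refl)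

    unit-image : ∀ i → Σ (Fin (vars k)) λ q → h (unit i) ≐ unit q
    unit-image i with hits {j} {k} h eq (suc i)
    ... | suc q , e = q , e
    ... | zero , e with fresh₄ j i i i i
    ...   | i' , i'≢i , _ = ⊥-elim (join-dull i i' (λ e → i'≢i (sym e)) zero
              (λ l → trans (join-image i i' l) (cong (_∨ h (unit i') l) (e l))))

    ψ : Fin (vars j) → Fin (vars k)
    ψ i = proj₁ (unit-image i)

    ψ-injective : ∀ {i i'} → ψ i ≡ ψ i' → i ≡ i'
    ψ-injective {i} {i'} e with i Finₚ.≟ i'
    ... | yes p = p
    ... | no i≢i' = ⊥-elim (join-dull i i' i≢i' (suc (ψ i)) λ l →
            trans (join-image i i' l)
              (trans (cong₂ _∨_ (proj₂ (unit-image i) l)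
                       (trans (proj₂ (unit-image i') l) (cong (λ q → unit q l) (sym e))))
                     (∨-idem (unit (ψ i) l))))

    top-image : h ⊤ᵖ ≐ ⊤ᵖ
    top-image with hits {j} {k} h eq zero
    ... | zero  , e = e
    -- If the top went to a unit vector, monotonicity would send all unit vectors to that same one.
    ... | suc q , e with ψ-injective {zero} {suc zero} (trans (at zero) (sym (at (suc zero))))
      where
      at : ∀ i → ψ i ≡ q
      at i = sym (unit-≡ (trans (sym (e (ψ i))) (proj₁ (hV (ψ i)) {unit i} {⊤ᵖ} ≼-⊤
               (trans (proj₂ (unit-image i) (ψ i)) (unit-refl (ψ i))))))
    ...   | ()

    ψ-onto : ∀ q → Σ (Fin (vars j)) λ i → ψ i ≡ q
    ψ-onto q with V-unit (λ z → h z q) (hV q) (top-image q)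
    ... | i , e = i , unit-≡ (trans (sym (proj₂ (unit-image i) q)) e)

  antichainV : Antichain PreservesV
  antichainV = record
    { ar     = λ k → 4 + double k
    ; fn     = spiky
    ; fn-ext = spiky-ext
    ; incomp = λ j k j≢k h hV eq → j≢k (vars-injective (V-sizes {j} {k} h hV eq)) }

  xsum : ∀ {k} → (Fin k → Bool) → Bool
  xsum {zero}  x = false
  xsum {suc k} x = x zero xor xsum (λ i → x (suc i))

  xsum-cong : ∀ {k} {x y : Fin k → Bool} → x ≐ y → xsum x ≡ xsum y
  xsum-cong {zero}  p = refl
  xsum-cong {suc k} p = cong₂ _xor_ (p zero) (xsum-cong (λ i → p (suc i)))

  xsum-xor : ∀ {k} (x y : Fin k → Bool) → xsum (λ i → x i xor y i) ≡ xsum x xor xsum y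
  xsum-xor {zero}  x y = refl
  xsum-xor {suc k} x y =
    trans (cong ((x zero xor y zero) xor_) (xsum-xor (λ i → x (suc i)) (λ i → y (suc i))))
          (interchange (x zero) (y zero) _ _)
    where
    interchange : ∀ a b c d → (a xor b) xor (c xor d) ≡ (a xor c) xor (b xor d)
    interchange = from-yes (∀ᵇ? λ a → ∀ᵇ? λ b → ∀ᵇ? λ c → ∀ᵇ? λ d →
      (a xor b) xor (c xor d) ≟ᵇ (a xor c) xor (b xor d))

  xsum-false : ∀ {k} → xsum {k} (λ _ → false) ≡ false
  xsum-false {zero}  = refl
  xsum-false {suc k} = xsum-false {k}

  xsum-odd : ∀ k b → xsum {suc (double k)} (λ _ → b) ≡ b
  xsum-odd zero    true  = refl
  xsum-odd zero    false = refl
  xsum-odd (suc k) true  = cong (λ s → not (not s)) (xsum-odd k true)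
  xsum-odd (suc k) false = xsum-odd k false

  xsum-unit : ∀ {k} (j : Fin k) → xsum (λ i → unit i j) ≡ true
  xsum-unit {suc k} zero    = cong not (xsum-false {k})
  xsum-unit {suc k} (suc j) = xsum-unit j

  Affine : ∀ {k} → ((Fin k → Bool) → Bool) → Set
  Affine {k} g = ∀ (a b c d : Fin k → Bool) → (∀ i → a i ∧ b i ≡ false × c i ≡ a i ∨ b i × d i ≡ false) →
                 (g d xor g a) xor (g b xor g c) ≡ false

  affine-ext : ∀ {k} {g : (Fin k → Bool) → Bool} → Affine g → ∀ {x y} → x ≐ y → g x ≡ g y
  affine-ext {g = g} aff {x} {y} p =
    cancel (g (λ _ → false)) (g x) (g y)
      (aff x (λ _ → false) y (λ _ → false) (λ i → ∧-zeroʳ (x i) , trans (sym (p i)) (sym (∨-identityʳ (x i))) , refl))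
    where
    cancel : ∀ a b c → (a xor b) xor (a xor c) ≡ false → b ≡ c
    cancel = from-yes (∀ᵇ? λ a → ∀ᵇ? λ b → ∀ᵇ? λ c → ((a xor b) xor (a xor c) ≟ᵇ false) →-dec (b ≟ᵇ c))

  coeff : ∀ {k} → ((Fin k → Bool) → Bool) → Fin k → Bool
  coeff g i = g (λ _ → false) xor g (unit i)

  -- Induction on the number of variables: the part with first coordinate false is expanded first,
  -- and `unit zero`, being disjoint from it, contributes additively.
  affine-expansion : ∀ {k} (g : (Fin k → Bool) → Bool) → Affine g →
                     ∀ x → g x ≡ g (λ _ → false) xor xsum (λ i → x i ∧ coeff g i)
  affine-expansion {zero} g aff x =
    trans (affine-ext {g = g} aff {x} {λ _ → false} (λ ())) (sym (xor-identityʳ (g (λ _ → false))))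
  affine-expansion {suc k} g aff x = go (x zero) refl
    where
    cons : Bool → (Fin k → Bool) → Fin (suc k) → Bool
    cons b y zero    = b
    cons b y (suc i) = y i

    tail : Fin k → Bool
    tail i = x (suc i)

    g' : (Fin k → Bool) → Bool
    g' y = g (cons false y)

    g'-aff : Affine g'
    g'-aff a b c d p = aff (cons false a) (cons false b) (cons false c) (cons false d)
      λ { zero → refl , refl , refl ; (suc i) → p i }

    g-ext : ∀ {x y} → x ≐ y → g x ≡ g y
    g-ext = affine-ext {g = g} aff

    S : Bool
    S = xsum (λ i → tail i ∧ coeff g (suc i))

    g'-tail : g' tail ≡ g (λ _ → false) xor S
    g'-tail = trans (affine-expansion g' g'-aff tail)
      (cong₂ _xor_ zeros (xsum-cong (λ i → cong (tail i ∧_) (cong₂ _xor_ zeros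
        (g-ext λ { zero → refl ; (suc j) → refl })))))
      where
      zeros : g' (λ _ → false) ≡ g (λ _ → false)
      zeros = g-ext λ { zero → refl ; (suc i) → refl }

    with-head : ∀ p q r s S → (p xor q) xor (r xor s) ≡ false → r ≡ p xor S →
                s ≡ p xor ((p xor q) xor S)
    with-head = from-yes (∀ᵇ? λ p → ∀ᵇ? λ q → ∀ᵇ? λ r → ∀ᵇ? λ s → ∀ᵇ? λ S →
      ((p xor q) xor (r xor s) ≟ᵇ false) →-dec ((r ≟ᵇ p xor S) →-dec (s ≟ᵇ p xor ((p xor q) xor S))))

    go : ∀ b → x zero ≡ b → g x ≡ g (λ _ → false) xor ((x zero ∧ coeff g zero) xor S)
    go false e = trans (g-ext {x} {cons false tail} λ { zero → e ; (suc i) → refl })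
      (trans g'-tail (cong (λ b → g (λ _ → false) xor ((b ∧ coeff g zero) xor S)) (sym e)))
    go true e = trans (with-head (g (λ _ → false)) (g (unit zero)) (g' tail) (g x) S
        (aff (unit zero) (cons false tail) x (λ _ → false)
          λ { zero → refl , e , refl ; (suc i) → refl , refl , refl }) g'-tail)
      (cong (λ b → g (λ _ → false) xor ((b ∧ coeff g zero) xor S)) (sym e))

  affine-xor : ∀ {k} (g : (Fin k → Bool) → Bool) → Affine g → ∀ x y z →
               g (λ i → (x i xor y i) xor z i) ≡ (g x xor g y) xor g z
  affine-xor g aff x y z =
    trans (affine-expansion g aff _)
      (trans (cong (c xor_) (trans (xsum-cong (λ i → distrib (x i) (y i) (z i) (coeff g i)))
               (trans (xsum-xor (λ i → (x i ∧ coeff g i) xor (y i ∧ coeff g i)) (λ i → z i ∧ coeff g i))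
                      (cong (_xor S z) (xsum-xor (λ i → x i ∧ coeff g i) (λ i → y i ∧ coeff g i))))))
        (trans (spread c (S x) (S y) (S z))
          (sym (cong₂ _xor_ (cong₂ _xor_ (affine-expansion g aff x) (affine-expansion g aff y))
                            (affine-expansion g aff z)))))
    where
    c = g (λ _ → false)
    S : (Fin _ → Bool) → Bool
    S x = xsum (λ i → x i ∧ coeff g i)
    distrib : ∀ a b c d → ((a xor b) xor c) ∧ d ≡ ((a ∧ d) xor (b ∧ d)) xor (c ∧ d)
    distrib = from-yes (∀ᵇ? λ a → ∀ᵇ? λ b → ∀ᵇ? λ c → ∀ᵇ? λ d →
      ((a xor b) xor c) ∧ d ≟ᵇ ((a ∧ d) xor (b ∧ d)) xor (c ∧ d))
    spread : ∀ c p q r → c xor ((p xor q) xor r) ≡ ((c xor p) xor (c xor q)) xor (c xor r)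
    spread = from-yes (∀ᵇ? λ c → ∀ᵇ? λ p → ∀ᵇ? λ q → ∀ᵇ? λ r →
      c xor ((p xor q) xor r) ≟ᵇ ((c xor p) xor (c xor q)) xor (c xor r))

  PreservesL : ∀ {n} → BFun n → Set
  PreservesL f = ¬ WitnessL f

  preservesL⇒affine : ∀ {n} (f : BFun n) → PreservesL f → Affine f
  preservesL⇒affine f ¬w a b c d p = ¬-not (λ e → ¬w (a , b , c , d , p , e))

  -- For different spikes `p`, `q` some `r` makes their sum with `r` no spike; if `p` and `q` had
  -- the same image, that sum would go to the spike `φ r`. Hence `φ` is injective. The spikes add up
  -- to zero and, as the number of variables is odd, are even in number; so their images under an
  -- affine map add up to zero too. A sum of different spikes vanishes only if it is empty or
  -- contains all of them, so `φ` is onto.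
  L-sizes : ∀ {j k} (h : X (4 + double j) → X (4 + double k)) → (∀ i → PreservesL (λ z → h z i)) →
            (∀ z → spiky j z ≡ spiky k (h z)) → vars j ≡ vars k
  L-sizes {j} {k} h hL eq = ℕₚ.suc-injective (ℕₚ.≤-antisym (Finₚ.injective⇒≤ {f = φ} φ-injective)
      (Finₚ.injective⇒≤ {f = λ q → proj₁ (φ-onto q)}
         (λ {q} {q'} e → trans (sym (proj₂ (φ-onto q))) (trans (cong φ e) (proj₂ (φ-onto q'))))))
    where
    φ : Fin (suc (vars j)) → Fin (suc (vars k))
    φ p = proj₁ (hits {j} {k} h eq p)

    φ-image : ∀ p → h (spike p) ≐ spike (φ p)
    φ-image p = proj₂ (hits {j} {k} h eq p)

    h-aff : ∀ l → Affine (λ z → h z l)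
    h-aff l = preservesL⇒affine (λ z → h z l) (hL l)

    triple : ∀ p q r → X (4 + double j)
    triple p q r l = (spike p l xor spike q l) xor spike r l

    Dull : ∀ p q → Set
    Dull p q = Σ (Fin (suc (vars j))) λ r → ∀ s → ¬ (triple p q r ≐ spike s)

    dull-units : ∀ {i i'} → i ≢ i' → Dull (suc i) (suc i')
    dull-units {i} {i'} i≢i' with fresh₄ j i i' i i'
    ... | l , l≢i , l≢i' , _ = suc l , dull
      where
      at-i : triple (suc i) (suc i') (suc l) i ≡ true
      at-i = cong₂ _xor_ (cong₂ _xor_ (unit-refl i) (unit-≢ (λ e → i≢i' (sym e)))) (unit-≢ l≢i)
      at-i' : triple (suc i) (suc i') (suc l) i' ≡ true
      at-i' = cong₂ _xor_ (cong₂ _xor_ (unit-≢ i≢i') (unit-refl i')) (unit-≢ l≢i')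
      dull : ∀ s → ¬ (triple (suc i) (suc i') (suc l) ≐ spike s)
      dull (suc s) e = i≢i' (trans (sym (unit-≡ {i = s} {i} (trans (sym (e i)) at-i)))
                                   (unit-≡ {i = s} {i'} (trans (sym (e i')) at-i')))
      dull zero e with fresh₄ j i i' l l
      ... | a , a≢i , a≢i' , a≢l , _ = true≢false (trans (sym (e a))
        (cong₂ _xor_ (cong₂ _xor_ (unit-≢ (λ q → a≢i (sym q))) (unit-≢ (λ q → a≢i' (sym q))))
                     (unit-≢ (λ q → a≢l (sym q)))))

    dull-top : ∀ i → Dull zero (suc i)
    dull-top i with fresh₄ j i i i i
    ... | l , l≢i , _ = suc l , dull
      where
      away : ∀ a → a ≢ i → a ≢ l → triple zero (suc i) (suc l) a ≡ true
      away a a≢i a≢l = cong₂ _xor_ (cong not (unit-≢ (λ q → a≢i (sym q)))) (unit-≢ (λ q → a≢l (sym q)))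
      dull : ∀ s → ¬ (triple zero (suc i) (suc l) ≐ spike s)
      dull zero e = true≢false (trans (sym (e i)) (cong₂ _xor_ (cong not (unit-refl i)) (unit-≢ l≢i)))
      dull (suc s) e with fresh₄ j i l i l
      ... | a , a≢i , a≢l , _ with fresh₄ j i l a a
      ...   | b , b≢i , b≢l , b≢a , _ =
        b≢a (trans (sym (unit-≡ {i = s} {b} (trans (sym (e b)) (away b b≢i b≢l))))
                   (unit-≡ {i = s} {a} (trans (sym (e a)) (away a a≢i a≢l))))

    dull : ∀ p q → p ≢ q → Dull p q
    dull zero    zero     p≢q = ⊥-elim (p≢q refl)
    dull zero    (suc i)  p≢q = dull-top i
    dull (suc i) (suc i') p≢q = dull-units (λ e → p≢q (cong suc e))
    dull (suc i) zero     p≢q with dull-top i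
    ... | r , d = r , λ s e → d s (λ l → trans (cong (_xor spike r l) (xor-comm true (unit i l))) (e l))

    φ-injective : ∀ {p q} → φ p ≡ φ q → p ≡ q
    φ-injective {p} {q} e with p Finₚ.≟ q
    ... | yes p≡q = p≡q
    ... | no p≢q with dull p q p≢q
    ...   | r , d with ind⁻ (trans (eq (triple p q r)) (trans (spiky-ext k image) (ind⁺ (φ r , λ _ → refl))))
      where
      cancel : ∀ a b → (a xor a) xor b ≡ b
      cancel = from-yes (∀ᵇ? λ a → ∀ᵇ? λ b → (a xor a) xor b ≟ᵇ b)
      image : h (triple p q r) ≐ spike (φ r)
      image l = trans (affine-xor (λ z → h z l) (h-aff l) (spike p) (spike q) (spike r))
        (trans (cong₂ _xor_ (cong₂ _xor_ (φ-image p l)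
                               (trans (φ-image q l) (cong (λ t → spike t l) (sym e)))) (φ-image r l))
               (cancel (spike (φ p) l) (spike (φ r) l)))
    ...     | s , e' = ⊥-elim (d s e')

    total : ∀ l → xsum (λ p → spike (φ p) l) ≡ false
    total l = trans (xsum-cong (λ p → sym (φ-image p l)))
        (trans (cong (_xor U) (trans (affine-expansion f (h-aff l) ⊤ᵖ)
                 (trans (cong (f ⊥ᵖ xor_) (xsum-xor (λ _ → f ⊥ᵖ) (λ i → f (unit i))))
                        (cong (λ b → f ⊥ᵖ xor (b xor U)) (xsum-odd (suc (suc j)) (f ⊥ᵖ))))))
               (cancel (f ⊥ᵖ) U))
      where
      f : BFun (4 + double j)
      f z = h z l
      U : Bool
      U = xsum (λ i → f (unit i))
      cancel : ∀ a b → (a xor (a xor b)) xor b ≡ false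
      cancel = from-yes (∀ᵇ? λ a → ∀ᵇ? λ b → (a xor (a xor b)) xor b ≟ᵇ false)

    -- The number of preimages of `q` under `φ` modulo 2. Coordinate `l` of the vanishing sum
    -- equates it at `zero` and at `suc l`.
    σ : Fin (suc (vars k)) → Bool
    σ q = xsum (λ p → unit (φ p) q)

    σ-constant : ∀ q → σ q ≡ σ zero
    σ-constant zero    = refl
    σ-constant (suc l) = xor-≡ (σ zero) (σ (suc l))
        (trans (sym (xsum-xor (λ p → unit (φ p) zero) (λ p → unit (φ p) (suc l))))
               (trans (xsum-cong (λ p → split (φ p))) (total l)))
      where
      split : ∀ q → unit q zero xor unit q (suc l) ≡ spike q l
      split zero    = refl
      split (suc i) = refl
      xor-≡ : ∀ a b → a xor b ≡ false → b ≡ a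
      xor-≡ = from-yes (∀ᵇ? λ a → ∀ᵇ? λ b → (a xor b ≟ᵇ false) →-dec (b ≟ᵇ a))

    σ-true : ∀ q → σ q ≡ true
    σ-true q = trans (σ-constant q) (trans (sym (σ-constant (φ zero)))
        (trans (xsum-cong λ p → ≡-by-true (λ e → trans (cong (λ t → unit t zero) (φ-injective {p} {zero} (unit-≡ e))) refl)
                                          (λ e → trans (cong (λ t → unit (φ t) (φ zero)) (unit-≡ {i = p} {zero} e)) (unit-refl (φ zero))))
               (xsum-unit {suc (vars j)} zero)))

    φ-onto : ∀ q → Σ (Fin (suc (vars j))) λ p → φ p ≡ q
    φ-onto q with dec (Σ (Fin (suc (vars j))) λ p → φ p ≡ q)
    ... | yes r = r
    ... | no ¬r = ⊥-elim (true≢false (trans (sym (σ-true q))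
                    (trans (xsum-cong (λ p → unit-≢ (λ e → ¬r (p , e)))) (xsum-false {suc (vars j)}))))

  antichainL : Antichain PreservesL
  antichainL = record
    { ar     = λ k → 4 + double k
    ; fn     = spiky
    ; fn-ext = spiky-ext
    ; incomp = λ j k j≢k h hL eq → j≢k (vars-injective (L-sizes {j} {k} h hL eq)) }

-- Antichain for functions preserving disjointness

WitnessU : ∀ {n} → BFun n → Set
WitnessU {n} f = Σ (X n) λ a → Σ (X n) λ b → (∀ i → a i ∧ b i ≡ false) × f a ≡ true × f b ≡ true

record Graph : Set₁ where
  field
    size   : ℕ
    Adj    : Fin size → Fin size → Set
    symm   : ∀ {u v} → Adj u v → Adj v u
    irrefl : ∀ {u} → ¬ Adj u u

open Graph

record Hom (G H : Graph) : Set where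
  field
    map  : Fin (size G) → Fin (size H)
    pres : ∀ {u v} → Adj G u v → Adj H (map u) (map v)

open Hom

data Walk (G : Graph) : ℕ → Fin (size G) → Fin (size G) → Set where
  stay : ∀ {v} → Walk G 0 v v
  step : ∀ {n u v w} → Adj G u v → Walk G n v w → Walk G (suc n) u w

walk-map : ∀ {G H} (φ : Hom G H) {n u v} → Walk G n u v → Walk H n (map φ u) (map φ v)
walk-map φ stay       = stay
walk-map φ (step e w) = step (pres φ e) (walk-map φ w)

walk-++ : ∀ {G m n u v w} → Walk G m u v → Walk G n v w → Walk G (m + n) u w
walk-++ stay       q = q
walk-++ (step e p) q = step e (walk-++ p q)

module GraphFunctions (em : ExcludedMiddle (lsuc 0ℓ)) where
  open Classical em

  PreservesU : ∀ {n} → BFun n → Set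
  PreservesU f = ¬ WitnessU f

  -- Two such sets are disjoint exactly when the vertices are adjacent; the
  -- extra coordinate zero only keeps the arity positive.
  nonEdges : ∀ G → Fin (size G) → X (size G * size G)
  nonEdges G v zero    = false
  nonEdges G v (suc i) =
    let (p , q) = remQuot (size G) i in ind ((p ≡ v ⊎ q ≡ v) × ¬ Adj G p q)

  adjacent⇒disjoint : ∀ G {u v} → Adj G u v → ∀ i → nonEdges G u i ∧ nonEdges G v i ≡ false
  adjacent⇒disjoint G e zero = refl
  adjacent⇒disjoint G {u} {v} e (suc i) = ¬-not (λ t → clash (ind⁻ (left t)) (ind⁻ (right t)))
    where
    p = proj₁ (remQuot (size G) i)
    q = proj₂ (remQuot {size G} (size G) i)
    left : ∀ {a b} → a ∧ b ≡ true → a ≡ true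
    left {true} _ = refl
    right : ∀ {a b} → a ∧ b ≡ true → b ≡ true
    right {true} t = t
    clash : (p ≡ u ⊎ q ≡ u) × ¬ Adj G p q → (p ≡ v ⊎ q ≡ v) × ¬ Adj G p q → ⊥
    clash (inj₁ refl , _)  (inj₁ refl , _) = irrefl G e
    clash (inj₁ refl , ¬e) (inj₂ refl , _) = ¬e e
    clash (inj₂ refl , ¬e) (inj₁ refl , _) = ¬e (symm G e)
    clash (inj₂ refl , _)  (inj₂ refl , _) = irrefl G e

  disjoint⇒adjacent : ∀ G {u v} → (∀ i → nonEdges G u i ∧ nonEdges G v i ≡ false) → Adj G u v
  disjoint⇒adjacent G {u} {v} d with dec (Adj G u v)
  ... | yes e = e
  ... | no ¬e = ⊥-elim (true≢false (trans (sym (cong₂ _∧_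
          (ind⁺ (inj₁ (cong proj₁ rq) , ¬adj)) (ind⁺ (inj₂ (cong proj₂ rq) , ¬adj)))) (d (suc (combine u v)))))
    where
    rq : remQuot {size G} (size G) (combine u v) ≡ (u , v)
    rq = Finₚ.remQuot-combine u v
    ¬adj : ¬ Adj G (proj₁ (remQuot {size G} (size G) (combine u v))) (proj₂ (remQuot {size G} (size G) (combine u v)))
    ¬adj = subst (λ { (p , q) → ¬ Adj G p q }) (sym rq) ¬e

  graphFn : ∀ G → BFun (size G * size G)
  graphFn G x = ind (Σ (Fin (size G)) λ v → x ≐ nonEdges G v)

  graphFn-ext : ∀ G → Ext (graphFn G)
  graphFn-ext G p = ind-cong (λ { (v , e) → v , ≐-trans (≐-sym p) e }) (λ { (v , e) → v , ≐-trans p e })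

  -- A reduction maps vertex sets to vertex sets, and coordinates without `WitnessU` keep disjoint
  -- tuples disjoint; by the choice of `nonEdges` this is preservation of adjacency.
  reduction⇒hom : ∀ G H (h : X (size G * size G) → X (size H * size H)) → (∀ i → PreservesU (λ z → h z i)) →
                  (∀ z → graphFn G z ≡ graphFn H (h z)) → Hom G H
  reduction⇒hom G H h hU eq = record { map = λ v → proj₁ (image v) ; pres = pres' }
    where
    image : ∀ v → Σ (Fin (size H)) λ w → h (nonEdges G v) ≐ nonEdges H w
    image v = ind⁻ (trans (sym (eq (nonEdges G v))) (ind⁺ (v , λ _ → refl)))
    pres' : ∀ {u v} → Adj G u v → Adj H (proj₁ (image u)) (proj₁ (image v))
    pres' {u} {v} e = disjoint⇒adjacent H λ i →
      trans (cong₂ _∧_ (sym (proj₂ (image u) i)) (sym (proj₂ (image v) i))) (disjoint i)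
      where
      disjoint : ∀ i → h (nonEdges G u) i ∧ h (nonEdges G v) i ≡ false
      disjoint i with h (nonEdges G u) i in eu | h (nonEdges G v) i in ev
      ... | false | _     = refl
      ... | true  | false = refl
      ... | true  | true  = ⊥-elim (hU i (nonEdges G u , nonEdges G v , adjacent⇒disjoint G e , eu , ev))

-- Shift graphs: colourings and odd closed walks

cons : ℕ → (ℕ → ℕ) → (ℕ → ℕ)
cons b a zero    = b
cons b a (suc i) = a i

-- Tuples are initial segments of sequences, which turns shifting into precomposition with `suc`.
Local : ∀ {A : Set} → ℕ → ((ℕ → ℕ) → A) → Set
Local r c = ∀ a b → (∀ i → i < r → a i ≡ b i) → c a ≡ c b

Increasing : (ℕ → ℕ) → Set
Increasing a = ∀ i → a i < a (suc i)

increasing-≤ : ∀ {a} → Increasing a → ∀ {i j} → i ≤ j → a i ≤ a j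
increasing-≤ inc {i} {j} i≤j with ℕₚ.m≤n⇒m<n∨m≡n i≤j
... | inj₂ refl = ℕₚ.≤-refl
increasing-≤ inc {i} {suc j} i≤j | inj₁ (s≤s i≤j') = ℕₚ.≤-trans (increasing-≤ inc i≤j') (ℕₚ.<⇒≤ (inc j))

module Shift (em : ExcludedMiddle (lsuc 0ℓ)) where
  open Classical em

  -- In graph terms: the shift graph on increasing `(r + 1)`-tuples of numbers below `N` has no
  -- proper colouring with `k` colours.
  Repeats : ℕ → ℕ → ℕ → Set
  Repeats r k N = (c : (ℕ → ℕ) → Fin k) → Local (suc r) c →
    Σ (ℕ → ℕ) λ a → Increasing a × a (suc r) < N × c a ≡ c (λ i → a (suc i))

  -- A k-colouring of the (r+2)-tuples induces a 2^k-colouring of the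
  -- (r+1)-tuples, by the set of colours of the tuples extending it to the left.
  repeats : ∀ r k → Σ ℕ (Repeats r k)
  repeats zero k = suc k , λ c loc → colours c loc (Finₚ.pigeonhole {k} {suc k} ℕₚ.≤-refl (λ i → c (toℕ i +_)))
    where
    colours : (c : (ℕ → ℕ) → Fin k) → Local 1 c →
              (Σ (Fin (suc k)) λ i → Σ (Fin (suc k)) λ j → (toℕ i < toℕ j) × c (toℕ i +_) ≡ c (toℕ j +_)) →
              Σ (ℕ → ℕ) λ a → Increasing a × a 1 < suc k × c a ≡ c (λ i → a (suc i))
    colours c loc (i , j , i<j , e) = cons (toℕ i) (toℕ j +_) , inc
      , subst (_< suc k) (sym (ℕₚ.+-identityʳ (toℕ j))) (Finₚ.toℕ<n j)
      , trans (loc _ _ (λ { zero _ → sym (ℕₚ.+-identityʳ (toℕ i)) ; (suc _) (s≤s ()) })) e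
      where
      inc : Increasing (cons (toℕ i) (toℕ j +_))
      inc zero    = subst (toℕ i <_) (sym (ℕₚ.+-identityʳ (toℕ j))) i<j
      inc (suc t) = ℕₚ.+-monoʳ-< (toℕ j) (ℕₚ.n<1+n t)
  repeats (suc r) k = proj₁ rec , result
    where
    rec = repeats r (2 ^ k)
    result : Repeats (suc r) k (proj₁ rec)
    result c loc = extend (proj₂ rec c' c'-local)
      where
      Left : (ℕ → ℕ) → Fin k → Set
      Left a q = Σ ℕ λ b → b < a 0 × c (cons b a) ≡ q
      c' : (ℕ → ℕ) → Fin (2 ^ k)
      c' a = funToFin (λ q → bit (ind (Left a q)))
      Left-local : ∀ {a b} → (∀ i → i < suc r → a i ≡ b i) → ∀ {q} → Left a q → Left b q
      Left-local {a} {b} p (x , x< , e) = x , subst (x <_) (p 0 (s≤s z≤n)) x< ,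
        trans (loc _ _ (λ { zero _ → refl ; (suc i) (s≤s i<) → sym (p i i<) })) e
      c'-local : Local (suc r) c'
      c'-local a b p = funToFin-cong {k} {2} (λ q → cong bit
        (ind-cong {Left a q} {Left b q} (Left-local p) (Left-local (λ i i< → sym (p i i<)))))
      extend : (Σ (ℕ → ℕ) λ a → Increasing a × a (suc r) < proj₁ rec × c' a ≡ c' (λ i → a (suc i))) →
               Σ (ℕ → ℕ) λ a → Increasing a × a (suc (suc r)) < proj₁ rec × c a ≡ c (λ i → a (suc i))
      -- The colour of `a` lies in the set attached to its shift, witnessed by `a 0`. The sets are
      -- equal, so some `b` below `a 0` extends `a` to a tuple of the same colour as `a`.
      extend (a , inc , bound , e) with ind⁻ {Left a (c a)} (trans
          (bit-injective (funToFin-injective {f = λ q → bit (ind (Left a q))}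
                            {λ q → bit (ind (Left (λ i → a (suc i)) q))} e (c a)))
          (ind⁺ (a 0 , inc 0 , loc _ _ (λ { zero _ → refl ; (suc i) _ → refl }))))
      ... | b , b< , e' = cons b a , (λ { zero → b< ; (suc i) → inc i }) , bound , e'

  module ShiftGraph (r' N' : ℕ) where

    -- Two entries are the least for which a shift of an increasing tuple is a different tuple; a
    -- positive `N` provides the default value of `clamp`.
    r N : ℕ
    r = suc (suc r')
    N = suc N'

    abstract
      vertices : ℕ
      vertices = N ^ r

      clamp : ∀ n → Dec (n < N) → Fin N
      clamp n (yes p) = fromℕ< p
      clamp n (no _)  = zero

      tuple : (ℕ → ℕ) → Fin vertices
      tuple a = funToFin {r} {N} (λ i → clamp (a (toℕ i)) (a (toℕ i) ℕₚ.<? N))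

      entry : Fin vertices → ∀ i → Dec (i < r) → ℕ
      entry v i (yes p) = toℕ (finToFun {N} {r} v (fromℕ< p))
      entry v i (no _)  = 0

      at : Fin vertices → ℕ → ℕ
      at v i = entry v i (i ℕₚ.<? r)

      at-tuple : ∀ a i → i < r → a i < N → at (tuple a) i ≡ a i
      at-tuple a i i<r ai<N = go (i ℕₚ.<? r)
        where
        go : ∀ d → entry (tuple a) i d ≡ a i
        go (no ¬p) = ⊥-elim (¬p i<r)
        go (yes p) = trans (cong toℕ (Finₚ.finToFun-funToFin
                              (λ j → clamp (a (toℕ j)) (a (toℕ j) ℕₚ.<? N)) (fromℕ< p)))
                           (trans (clamped (a (toℕ (fromℕ< p))) (subst (λ j → a j < N) (sym (Finₚ.toℕ-fromℕ< p)) ai<N)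
                                  (a (toℕ (fromℕ< p)) ℕₚ.<? N))
                                  (cong a (Finₚ.toℕ-fromℕ< p)))
          where
          clamped : ∀ n → n < N → ∀ d → toℕ (clamp n d) ≡ n
          clamped n _   (yes q) = Finₚ.toℕ-fromℕ< q
          clamped n n<N (no ¬q) = ⊥-elim (¬q n<N)

      tuple-local : Local r tuple
      tuple-local a b p = funToFin-cong {r} {N} (λ i → cong (λ n → clamp n (n ℕₚ.<? N)) (p (toℕ i) (Finₚ.toℕ<n i)))

    Inc : (ℕ → ℕ) → Set
    Inc u = ∀ i → suc i < r → u i < u (suc i)

    -- All tuples are vertices; requiring both ends to be increasing leaves the remaining ones
    -- isolated.
    Shifts : (ℕ → ℕ) → (ℕ → ℕ) → Set
    Shifts u v = Inc u × Inc v × (∀ i → suc i < r → u (suc i) ≡ v i)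

    shifts-irrefl : ∀ {u} → ¬ Shifts u u
    shifts-irrefl (inc , _ , s) = ℕₚ.<⇒≢ (inc 0 (s≤s (s≤s z≤n))) (sym (s 0 (s≤s (s≤s z≤n))))

    graph : Graph
    graph = record
      { size   = vertices
      ; Adj    = λ u v → Shifts (at u) (at v) ⊎ Shifts (at v) (at u)
      ; symm   = λ { (inj₁ s) → inj₂ s ; (inj₂ s) → inj₁ s }
      ; irrefl = λ { (inj₁ s) → shifts-irrefl s ; (inj₂ s) → shifts-irrefl s } }

    windows-shift : ∀ a → Increasing a → a r < N → Adj graph (tuple a) (tuple (λ i → a (suc i)))
    windows-shift a inc ar<N = inj₁ (inc₀ , inc₁ , λ i si<r →
        trans (at-a (suc i) si<r) (sym (at-a⁺ i (ℕₚ.<⇒≤ si<r))))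
      where
      at-a : ∀ i → i < r → at (tuple a) i ≡ a i
      at-a i i<r = at-tuple a i i<r (ℕₚ.≤-<-trans (increasing-≤ inc (ℕₚ.<⇒≤ i<r)) ar<N)
      at-a⁺ : ∀ i → i < r → at (tuple (λ i → a (suc i))) i ≡ a (suc i)
      at-a⁺ i i<r = at-tuple (λ i → a (suc i)) i i<r (ℕₚ.≤-<-trans (increasing-≤ inc i<r) ar<N)
      inc₀ : Inc (at (tuple a))
      inc₀ i si<r = subst₂ _<_ (sym (at-a i (ℕₚ.<⇒≤ si<r))) (sym (at-a (suc i) si<r)) (inc i)
      inc₁ : Inc (at (tuple (λ i → a (suc i))))
      inc₁ i si<r = subst₂ _<_ (sym (at-a⁺ i (ℕₚ.<⇒≤ si<r))) (sym (at-a⁺ (suc i) si<r)) (inc (suc i))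

    -- A homomorphism colours tuples by vertices of `H`; an edge with equal colours at its ends
    -- would become a loop.
    no-hom : ∀ H {k} → size H ≤ k → proj₁ (repeats (suc r') k) ≤ N → ¬ Hom graph H
    no-hom H {k} H≤k bound φ with proj₂ (repeats (suc r') k) (λ a → inject≤ (map φ (tuple a)) H≤k)
                                    (λ a b p → cong (λ v → inject≤ (map φ v) H≤k) (tuple-local a b p))
    ... | a , inc , a< , e = irrefl H (subst (Adj H (map φ (tuple a))) (sym (Finₚ.inject≤-injective H≤k H≤k _ _ e))
            (pres φ (windows-shift a inc (ℕₚ.<-≤-trans a< bound))))

    -- `F` and `B` count the forward and backward steps. Each step moves the surviving entries by
    -- one position, and the side condition keeps all positions met on the way within the tuple.
    displacement : ∀ {ℓ u v} → Walk graph ℓ u v →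
      Σ ℕ λ F → Σ ℕ λ B → F + B ≡ ℓ × (∀ i → i + (F + B) < r → at u (i + F) ≡ at v (i + B))
    displacement stay = 0 , 0 , refl , λ i _ → refl
    displacement {u = u} {w} (step {v = v} (inj₁ (_ , _ , s)) wk) with displacement wk
    ... | F , B , refl , d = suc F , B , refl , λ i i< →
      trans (cong (at u) (ℕₚ.+-suc i F))
        (trans (s (i + F) (ℕₚ.≤-<-trans (ℕₚ.≤-trans (ℕₚ.≤-reflexive (sym (ℕₚ.+-suc i F)))
                  (ℕₚ.+-monoʳ-≤ i (s≤s (ℕₚ.m≤m+n F B)))) i<))
               (d i (ℕₚ.≤-<-trans (ℕₚ.+-monoʳ-≤ i (ℕₚ.n≤1+n (F + B))) i<)))
    displacement {u = u} {w} (step {v = v} (inj₂ (_ , _ , s)) wk) with displacement wk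
    ... | F , B , refl , d = F , suc B , ℕₚ.+-suc F B , λ i i< →
      trans (sym (s (i + F) (ℕₚ.≤-<-trans (ℕₚ.≤-trans (ℕₚ.≤-reflexive (sym (ℕₚ.+-suc i F)))
                  (ℕₚ.+-monoʳ-≤ i (ℕₚ.≤-trans (s≤s (ℕₚ.m≤m+n F B)) (ℕₚ.≤-reflexive (sym (ℕₚ.+-suc F B)))))) i<)))
        (trans (d (suc i) (ℕₚ.≤-<-trans (ℕₚ.≤-reflexive (trans (sym (ℕₚ.+-suc i (F + B)))
                   (cong (i +_) (sym (ℕₚ.+-suc F B))))) i<))
               (cong (at w) (sym (ℕₚ.+-suc i B))))

    inc-< : ∀ {u} → Inc u → ∀ {i j} → i < j → j < r → u i < u j
    inc-< inc {i} {suc j} (s≤s i≤j) sj<r with ℕₚ.m≤n⇒m<n∨m≡n i≤j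
    ... | inj₂ refl = inc i sj<r
    ... | inj₁ i<j  = ℕₚ.<-trans (inc-< inc i<j (ℕₚ.<⇒≤ sj<r)) (inc j sj<r)

    adjacent-inc : ∀ {v w} → Adj graph v w → Inc (at v)
    adjacent-inc (inj₁ (inc , _))     = inc
    adjacent-inc (inj₂ (_ , inc , _)) = inc

    balanced : ∀ {v} → Inc (at v) → ∀ F B → F + B < r → at v F ≡ at v B → F ≡ B
    balanced {v} inc F B F+B<r e with ℕₚ.<-cmp F B
    ... | tri≈ _ F≡B _ = F≡B
    ... | tri< F<B _ _ = ⊥-elim (ℕₚ.<⇒≢ (inc-< {at v} inc F<B (ℕₚ.≤-<-trans (ℕₚ.m≤n+m B F) F+B<r)) e)
    ... | tri> _ _ B<F = ⊥-elim (ℕₚ.<⇒≢ (inc-< {at v} inc B<F (ℕₚ.≤-<-trans (ℕₚ.m≤m+n F B) F+B<r)) (sym e))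

    -- In a closed walk shorter than `r` the displacement equates entries `F` and `B` of one
    -- increasing tuple, which forces as many forward as backward steps.
    closed-even : ∀ {ℓ v} → Walk graph ℓ v v → ℓ < r → Σ ℕ λ s → s + s ≡ ℓ
    closed-even stay _ = 0 , refl
    closed-even {v = v} wk@(step e _) ℓ<r = from-displacement (displacement wk)
      where
      from-displacement : (Σ ℕ λ F → Σ ℕ λ B → F + B ≡ _ × (∀ i → i + (F + B) < r → at v (i + F) ≡ at v (i + B))) →
                          Σ ℕ λ s → s + s ≡ _
      from-displacement (F , B , eq , d) = F , trans (cong (F +_) (balanced (adjacent-inc e) F B F+B<r (d 0 F+B<r))) eq
        where
        F+B<r : F + B < r
        F+B<r = subst (_< r) (sym eq) ℓ<r

    windows : (ℕ → ℕ) → ℕ → Fin vertices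
    windows a s = tuple (λ i → a (s + i))

    bounded-window : ∀ {a} → Increasing a → ∀ s → a (s + r) < N → Adj graph (windows a s) (windows a (suc s))
    bounded-window {a} inc s b = subst (Adj graph (windows a s))
      (tuple-local _ _ (λ i _ → cong a (ℕₚ.+-suc s i)))
      (windows-shift (λ i → a (s + i)) (λ i → subst (a (s + i) <_) (sym (cong a (ℕₚ.+-suc s i))) (inc (s + i))) b)

    walk-up : ∀ {a} → Increasing a → ∀ n s → (∀ t → t < n → a (s + t + r) < N) →
              Walk graph n (windows a s) (windows a (s + n))
    walk-up {a} inc zero s b = subst (λ t → Walk graph 0 (windows a s) (windows a t)) (sym (ℕₚ.+-identityʳ s)) stay
    walk-up {a} inc (suc n) s b = subst (λ t → Walk graph (suc n) (windows a s) (windows a t)) (sym (ℕₚ.+-suc s n))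
      (step (bounded-window {a} inc s (subst (λ t → a (t + r) < N) (ℕₚ.+-identityʳ s) (b 0 (s≤s z≤n))))
            (walk-up {a} inc n (suc s) (λ t t<n → subst (λ u → a (u + r) < N) (ℕₚ.+-suc s t) (b (suc t) (s≤s t<n)))))

    walk-down : ∀ {a} → Increasing a → ∀ n → (∀ t → t < n → a (t + r) < N) →
                Walk graph n (windows a n) (windows a 0)
    walk-down {a} inc zero    b = stay
    walk-down {a} inc (suc n) b = step (symm graph (bounded-window {a} inc n (b n ℕₚ.≤-refl)))
                                   (walk-down {a} inc n (λ t t<n → b t (ℕₚ.<-trans t<n (ℕₚ.n<1+n n))))

    skip : ℕ → ℕ → ℕ
    skip zero    i       = suc i
    skip (suc q) zero    = zero
    skip (suc q) (suc i) = suc (skip q i)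

    skip-increasing : ∀ q → Increasing (skip q)
    skip-increasing zero    i       = ℕₚ.n<1+n _
    skip-increasing (suc q) zero    = s≤s z≤n
    skip-increasing (suc q) (suc i) = s≤s (skip-increasing q i)

    skip-≤ : ∀ q i → skip q i ≤ suc i
    skip-≤ zero    i       = ℕₚ.≤-refl
    skip-≤ (suc q) zero    = z≤n
    skip-≤ (suc q) (suc i) = s≤s (skip-≤ q i)

    skip-below : ∀ q i → i < q → skip q i ≡ i
    skip-below (suc q) zero    _         = refl
    skip-below (suc q) (suc i) (s≤s i<q) = cong suc (skip-below q i i<q)

    skip-above : ∀ q i → skip q (q + i) ≡ suc (q + i)
    skip-above zero    i = refl
    skip-above (suc q) i = cong suc (skip-above q i)

    -- Slide the window 0 … r-1 up by r+1 along all numbers, then back down by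
    -- r along the numbers other than r.
    odd-walk : r + r < N → Σ (Fin vertices) λ v → Walk graph (suc (r + r)) v v
    odd-walk b = windows (λ i → i) 0 , walk-++
        (walk-up {λ i → i} (λ i → ℕₚ.n<1+n i) (suc r) 0 (λ { t (s≤s t≤r) → ℕₚ.≤-<-trans (ℕₚ.+-monoˡ-≤ r t≤r) b }))
        (subst₂ (Walk graph r)
          (tuple-local _ _ (λ i _ → skip-above r i))
          (tuple-local _ _ (λ i i<r → skip-below r i i<r))
          (walk-down {skip r} (skip-increasing r) r λ t t<r →
            ℕₚ.≤-<-trans (ℕₚ.≤-trans (skip-≤ r (t + r)) (ℕₚ.+-monoˡ-≤ r t<r)) b))

  -- Every graph in the sequence has odd girth and chromatic number larger than
  -- the length of an odd closed walk, and the number of vertices, of each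
  -- earlier one.
  module Stage (B : ℕ) where
    colourBound : ℕ
    colourBound = proj₁ (repeats (suc B) B)

    -- The first summand defeats colourings with `B` colours; the second leaves room for `odd-walk`,
    -- which needs `r + r < N`.
    open ShiftGraph B (colourBound + (suc (suc B) + suc (suc B))) public

    next-stage : ℕ
    next-stage = B + suc (r + r) + vertices

    stage-hom : ∀ H → size H ≤ B → ¬ Hom graph H
    stage-hom H H≤B = no-hom H H≤B (ℕₚ.m≤n⇒m≤1+n (ℕₚ.m≤m+n colourBound (r + r)))

    stage-walk : Σ (Fin vertices) λ v → Walk graph (suc (r + r)) v v
    stage-walk = odd-walk (s≤s (ℕₚ.m≤n+m (r + r) colourBound))

  stage : ℕ → ℕ
  stage zero    = 0
  stage (suc k) = Stage.next-stage (stage k)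

  stage-mono : ∀ {j k} → j ≤ k → stage j ≤ stage k
  stage-mono {j} {k} j≤k with ℕₚ.m≤n⇒m<n∨m≡n j≤k
  ... | inj₂ refl = ℕₚ.≤-refl
  stage-mono {j} {suc k} j≤k | inj₁ (s≤s j≤k') = ℕₚ.≤-trans (stage-mono j≤k')
    (ℕₚ.≤-trans (ℕₚ.m≤m+n (stage k) _) (ℕₚ.m≤m+n _ (Stage.vertices (stage k))))

  stageGraph : ℕ → Graph
  stageGraph k = Stage.graph (stage k)

  double-odd : ∀ s t → s + s ≢ suc (t + t)
  double-odd zero    t       ()
  double-odd (suc s) zero    e = ℕₚ.1+n≢0 (ℕₚ.suc-injective (trans (cong suc (sym (ℕₚ.+-suc s s))) e))
  double-odd (suc s) (suc t) e = double-odd s t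
    (ℕₚ.suc-injective (ℕₚ.suc-injective (trans (cong suc (sym (ℕₚ.+-suc s s)))
      (trans e (cong (λ n → suc (suc n)) (ℕₚ.+-suc t t))))))

  stages-incomparable : ∀ j k → j ≢ k → ¬ Hom (stageGraph j) (stageGraph k)
  stages-incomparable j k j≢k φ with ℕₚ.<-cmp j k
  ... | tri≈ _ e _ = j≢k e
  ... | tri> _ _ k<j = Stage.stage-hom (stage j) (stageGraph k)
          (ℕₚ.≤-trans (ℕₚ.m≤n+m (Stage.vertices (stage k)) _) (stage-mono k<j)) φ
  ... | tri< j<k _ _ with Stage.closed-even (stage k) (walk-map φ (proj₂ (Stage.stage-walk (stage j))))
            (ℕₚ.≤-<-trans (ℕₚ.≤-trans (ℕₚ.≤-trans (ℕₚ.m≤n+m _ (stage j)) (ℕₚ.m≤m+n _ (Stage.vertices (stage j))))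
                            (stage-mono j<k)) (ℕₚ.m<n⇒m<1+n (ℕₚ.n<1+n (stage k))))
  ...   | s , e = double-odd s (Stage.r (stage j)) e

  open GraphFunctions em

  antichainU : Antichain PreservesU
  antichainU = record
    { ar     = λ k → size (stageGraph k) * size (stageGraph k)
    ; fn     = λ k → graphFn (stageGraph k)
    ; fn-ext = λ k → graphFn-ext (stageGraph k)
    ; incomp = λ j k j≢k h hU eq →
        stages-incomparable j k j≢k (reduction⇒hom (stageGraph j) (stageGraph k) h hU eq) }

-- Clones without the discriminator

module Minors {C : BSet} (isC : IsClone C) where
  open CloneOps isC

  minor₂ : ∀ {n} {f : BFun n} → f ∈ C → (tab : Bool → Bool → X n) →
           (∀ i → fun₂ (λ x y → tab x y i) ∈ C) → fun₂ (λ x y → f (tab x y)) ∈ C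
  minor₂ {f = f} f∈ tab tab∈ = IsClone.closed isC f (λ i z → tab (z zero) (z (suc zero)) i) f∈ tab∈

  minor₃ : ∀ {n} {f : BFun n} → f ∈ C → (tab : Bool → Bool → Bool → X n) →
           (∀ i → fun₃ (λ w x y → tab w x y i) ∈ C) → fun₃ (λ w x y → f (tab w x y)) ∈ C
  minor₃ {f = f} f∈ tab tab∈ =
    IsClone.closed isC f (λ i z → tab (z zero) (z (suc zero)) (z (suc (suc zero))) i) f∈ tab∈

-- A minor is formed by putting one variable into all coordinates with the same bits `a i`, `b i`:
-- `p` where the first bit is true, `q` where only the second is, `r` where neither is.
pick : Bool → Bool → Bool → Bool → Bool → Bool
pick true  _     p q r = p
pick false true  p q r = q
pick false false p q r = r

pick∈ : ∀ {C} (isC : IsClone C) a b (p q r : BFun 2) → p ∈ C → q ∈ C → r ∈ C →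
        (λ z → pick a b (p z) (q z) (r z)) ∈ C
pick∈ isC true  _     p q r p∈ q∈ r∈ = p∈
pick∈ isC false true  p q r p∈ q∈ r∈ = q∈
pick∈ isC false false p q r p∈ q∈ r∈ = r∈

WitnessM : ∀ {n} → BFun n → Set
WitnessM {n} f = Σ (X n) λ a → Σ (X n) λ b → a ≼ b × f a ≡ true × f b ≡ false

-- In the tables below the first argument plays the role of the constant false.
Picks : ∀ {n} → (Bool → Bool → Bool → X n) → Set
Picks {n} tab = Σ (X n) λ a → Σ (X n) λ b → ∀ i w x y → pick (a i) (b i) x y w ≡ tab w x y i

pick-a : ∀ p q → p ∧ q ≡ false → pick p q true false false ≡ p
pick-a = from-yes (∀ᵇ? λ p → ∀ᵇ? λ q → (p ∧ q ≟ᵇ false) →-dec (pick p q true false false ≟ᵇ p))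

pick-b : ∀ p q → p ∧ q ≡ false → pick p q false true false ≡ q
pick-b = from-yes (∀ᵇ? λ p → ∀ᵇ? λ q → (p ∧ q ≟ᵇ false) →-dec (pick p q false true false ≟ᵇ q))

pick-∨ : ∀ p q → pick p q true true false ≡ p ∨ q
pick-∨ = from-yes (∀ᵇ? λ p → ∀ᵇ? λ q → pick p q true true false ≟ᵇ p ∨ q)

pick-false : ∀ p q → pick p q false false false ≡ false
pick-false = from-yes (∀ᵇ? λ p → ∀ᵇ? λ q → pick p q false false false ≟ᵇ false)

-- Where a value of `f` is prescribed the table holds the witness tuple itself, as `f` may
-- distinguish it from pointwise equal ones.
U-table : ∀ {n} {f : BFun n} → WitnessU f →
          Σ (Bool → Bool → Bool → X n) λ tab → Picks tab × f (tab false true false) ≡ true × f (tab false false true) ≡ true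
U-table {n} (a , b , d , fa , fb) = tab , (a , b , tab-pick) , fa , fb
  where
  tab : Bool → Bool → Bool → X n
  tab false true  false = a
  tab false false true  = b
  tab w     x     y     = λ i → pick (a i) (b i) x y w

  tab-pick : ∀ i w x y → pick (a i) (b i) x y w ≡ tab w x y i
  tab-pick i false true  false = pick-a (a i) (b i) (d i)
  tab-pick i false false true  = pick-b (a i) (b i) (d i)
  tab-pick i false true  true  = refl
  tab-pick i false false false = refl
  tab-pick i true  x     y     = refl

Odd : Bool → Bool → Bool → Bool → Set
Odd p q r s = (p xor q) xor (r xor s) ≡ true

L-table : ∀ {n} {f : BFun n} → WitnessL f →
          Σ (Bool → Bool → Bool → X n) λ tab → Picks tab ×
            Odd (f (tab false false false)) (f (tab false true false)) (f (tab false false true)) (f (tab false true true))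
L-table {n} (a , b , c , o , d , e) = tab , (a , b , tab-pick) , e
  where
  tab : Bool → Bool → Bool → X n
  tab false true  false = a
  tab false false true  = b
  tab false true  true  = c
  tab false false false = o
  tab true  x     y     = λ i → pick (a i) (b i) x y true

  tab-pick : ∀ i w x y → pick (a i) (b i) x y w ≡ tab w x y i
  tab-pick i false true  false = pick-a (a i) (b i) (proj₁ (d i))
  tab-pick i false false true  = pick-b (a i) (b i) (proj₁ (d i))
  tab-pick i false true  true  = trans (pick-∨ (a i) (b i)) (sym (proj₁ (proj₂ (d i))))
  tab-pick i false false false = trans (pick-false (a i) (b i)) (sym (proj₂ (proj₂ (d i))))
  tab-pick i true  x     y     = refl

-- Functions need not be extensional, so f ᵈ ᵈ can differ from f; restricting
-- to extensional functions makes the dual of a clone a clone.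
dualSet : BSet → BSet
dualSet C = record
  { mem = λ f → Ext f × (f ᵈ) ∈ C
  ; ext = λ { {f = f} {g} f≐g (fx , f∈) → (λ {x} {y} p → trans (sym (f≐g x)) (trans (fx p) (f≐g y)))
                                , ext C (λ x → cong not (f≐g (neg x))) f∈ } }

dualClone : ∀ {C} → IsClone C → IsClone (dualSet C)
dualClone {C} isC = record
  { projections = λ i → (λ p → p i) , ext C (λ x → sym (not-involutive (x i))) (IsClone.projections isC i)
  ; closed = λ { f gs (fx , f∈) gs∈ →
      (λ p → fx (λ i → proj₁ (gs∈ i) p))
      , ext C (λ x → cong not (fx (λ i → not-involutive (gs i (neg x)))))
          (IsClone.closed isC (f ᵈ) (λ i → (gs i) ᵈ) f∈ (λ i → proj₂ (gs∈ i))) } }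

dual₁ : (Bool → Bool) → Bool → Bool
dual₁ u x = not (u (not x))

dual₂ : (Bool → Bool → Bool) → Bool → Bool → Bool
dual₂ b x y = not (b (not x) (not y))

dual₃ : (Bool → Bool → Bool → Bool) → Bool → Bool → Bool → Bool
dual₃ t x y z = not (t (not x) (not y) (not z))

fun₁-ext : ∀ u → Ext (fun₁ u)
fun₁-ext u p = cong u (p zero)

fun₃-ext : ∀ t → Ext (fun₃ t)
fun₃-ext t {x} {y} p = trans (cong₂ (λ a b → t a b (x (suc (suc zero)))) (p zero) (p (suc zero)))
                             (cong (t (y zero) (y (suc zero))) (p (suc (suc zero))))

module _ {C : BSet} where
  to-dual₃ : ∀ t → fun₃ t ∈ C → fun₃ (dual₃ t) ∈ dualSet C
  to-dual₃ t t∈ = fun₃-ext (dual₃ t) , ext C (λ x →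
      sym (trans (not-involutive _) (fun₃-ext t (λ i → not-involutive (x i))))) t∈

  from-dual₁ : ∀ b c → (∀ x → dual₁ b x ≡ c x) → fun₁ b ∈ dualSet C → fun₁ c ∈ C
  from-dual₁ b c p b∈ = ext₁ C {dual₁ b} p (proj₂ b∈)

  from-dual₂ : ∀ b c → (∀ x y → dual₂ b x y ≡ c x y) → fun₂ b ∈ dualSet C → fun₂ c ∈ C
  from-dual₂ b c p b∈ = ext₂ C {dual₂ b} p (proj₂ b∈)

  from-dual₃ : ∀ t c → (∀ x y z → dual₃ t x y z ≡ c x y z) → fun₃ t ∈ dualSet C → fun₃ c ∈ C
  from-dual₃ t c p t∈ = ext₃ C {dual₃ t} p (proj₂ t∈)

  to-dual₁ : ∀ u v → (∀ x → u x ≡ dual₁ v x) → fun₁ u ∈ C → fun₁ v ∈ dualSet C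
  to-dual₁ u v p u∈ = fun₁-ext v , ext₁ C {u} {dual₁ v} p u∈

module Witnesses {C : BSet} (isC : IsClone C) where
  open CloneOps isC
  open Minors isC

  direct-minor : ∀ {n} {f : BFun n} {tab} → f ∈ C → Picks tab → fun₃ (λ w x y → f (tab w x y)) ∈ C
  direct-minor {tab = tab} f∈ (a , b , p) = minor₃ f∈ tab λ i → ext₃ C {λ w x y → pick (a i) (b i) x y w} (p i)
    (pick∈ isC (a i) (b i) (proj (suc zero)) (proj (suc (suc zero))) (proj zero) (π _) (π _) (π _))

  dual-minor : ∀ {n} {f : BFun n} {tab} → f ∈ C → Picks tab → fun₃ (λ w x y → (f ᵈ) (tab w x y)) ∈ dualSet C
  dual-minor {n} {f} {tab} f∈ (a , b , p) =
      fun₃-ext (λ w x y → (f ᵈ) (tab w x y))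
    , ext C (λ z → sym (not-involutive _))
        (minor₃ f∈ (λ w x y → neg (tab (not w) (not x) (not y)))
          λ i → ext₃ C {λ w x y → pick (a i) (b i) x y w}
            (λ w x y → trans (pick-not (a i) (b i) x y w) (cong not (p i (not w) (not x) (not y))))
            (pick∈ isC (a i) (b i) (proj (suc zero)) (proj (suc (suc zero))) (proj zero) (π _) (π _) (π _)))
    where
    pick-not : ∀ p q x y w → pick p q x y w ≡ not (pick p q (not x) (not y) (not w))
    pick-not = from-yes (∀ᵇ? λ p → ∀ᵇ? λ q → ∀ᵇ? λ x → ∀ᵇ? λ y → ∀ᵇ? λ w →
      pick p q x y w ≟ᵇ not (pick p q (not x) (not y) (not w)))

  M-minor : ∀ {n} {f : BFun n} → f ∈ C → WitnessM f →
            Σ (Bool → Bool → Bool → Bool) λ t → fun₃ t ∈ C × t false false true ≡ true × t false true true ≡ false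
  M-minor {n} {f} f∈ (a , b , a≼b , fa , fb) = (λ w x y → f (tab w x y)) , minor₃ f∈ tab tab∈ , fa , fb
    where
    tab : Bool → Bool → Bool → X n
    tab false false true  = a
    tab false true  true  = b
    tab w     x     y     = λ i → pick (a i) (b i) y x w

    tab-pick : ∀ i w x y → pick (a i) (b i) y x w ≡ tab w x y i
    tab-pick i false false true  = from-yes (∀ᵇ? λ p → ∀ᵇ? λ q → pick p q true false false ≟ᵇ p) (a i) (b i)
    tab-pick i false true  true  = from-yes (∀ᵇ? λ p → ∀ᵇ? λ q →
        ((p ≟ᵇ true) →-dec (q ≟ᵇ true)) →-dec (pick p q true true false ≟ᵇ q)) (a i) (b i) (a≼b i)
    tab-pick i false false false = refl
    tab-pick i false true  false = refl
    tab-pick i true  x     y     = refl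

    tab∈ : ∀ i → fun₃ (λ w x y → tab w x y i) ∈ C
    tab∈ i = ext₃ C {λ w x y → pick (a i) (b i) y x w} (tab-pick i)
      (pick∈ isC (a i) (b i) (proj (suc (suc zero))) (proj (suc zero)) (proj zero) (π _) (π _) (π _))

-- Deriving the discriminator from ternary functions

minority : Bool → Bool → Bool → Bool
minority x y z = (x xor y) xor z

table₂ : Bool → Bool → Bool → Bool → Bool → Bool → Bool
table₂ p q r s false false = p
table₂ p q r s true  false = q
table₂ p q r s false true  = r
table₂ p q r s true  true  = s

tabulate₂ : ∀ (b : Bool → Bool → Bool) x y →
            b x y ≡ table₂ (b false false) (b true false) (b false true) (b true true) x y
tabulate₂ b false false = refl
tabulate₂ b true  false = refl
tabulate₂ b false true  = refl
tabulate₂ b true  true  = refl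

table₃ : (p q r s p' q' r' s' : Bool) → Bool → Bool → Bool → Bool
table₃ p q r s p' q' r' s' false = table₂ p q r s
table₃ p q r s p' q' r' s' true  = table₂ p' q' r' s'

tabulate₃ : ∀ (t : Bool → Bool → Bool → Bool) w x y → t w x y ≡
  table₃ (t false false false) (t false true false) (t false false true) (t false true true)
         (t true false false) (t true true false) (t true false true) (t true true true) w x y
tabulate₃ t false = tabulate₂ (t false)
tabulate₃ t true  = tabulate₂ (t true)

agree₁? : ∀ (u v : Bool → Bool) → Dec (∀ x → u x ≡ v x)
agree₁? u v = ∀ᵇ? λ x → u x ≟ᵇ v x

agree₂? : ∀ (u v : Bool → Bool → Bool) → Dec (∀ x y → u x y ≡ v x y)
agree₂? u v = ∀ᵇ? λ x → agree₁? (u x) (v x)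

agree₃? : ∀ (u v : Bool → Bool → Bool → Bool) → Dec (∀ x y z → u x y z ≡ v x y z)
agree₃? u v = ∀ᵇ? λ x → agree₂? (u x) (v x)

module Cases {C : BSet} (isC : IsClone C) where
  open CloneOps isC

  private
    x₂ y₂ : BFun 1
    x₂ = proj zero
    y₂ = proj (suc zero)
    x₃ y₃ z₃ : BFun 2
    x₃ = proj zero
    y₃ = proj (suc zero)
    z₃ = proj (suc (suc zero))

  app-table : ∀ {p q r s p' q' r' s' m} {u v w : BFun m} → fun₃ (table₃ p q r s p' q' r' s') ∈ C →
              u ∈ C → v ∈ C → w ∈ C → (λ x → table₃ p q r s p' q' r' s' (u x) (v x) (w x)) ∈ C
  app-table {p} {q} {r} {s} {p'} {q'} {r'} {s'} = app₃ (table₃ p q r s p' q' r' s')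

  -- On lattice terms the bounds x∧y∧z and x∨y∨z play the constants, which
  -- turns a non-monotone function into a relative complement.
  disc-from-lattice : ∀ {q p' q' r'} → fun₂ _∧_ ∈ C → fun₂ _∨_ ∈ C →
                      fun₃ (table₃ false q true false p' q' r' true) ∈ C → fun₃ disc₃ ∈ C
  disc-from-lattice {q} {p'} {q'} {r'} ∧∈ ∨∈ F∈ =
    ext₃ C {λ x y z → maj x (table₃ false q true false p' q' r' true ((x ∧ y) ∧ z) y ((x ∨ y) ∨ z)) z}
      (from-yes (∀ᵇ? λ q → ∀ᵇ? λ p' → ∀ᵇ? λ q' → ∀ᵇ? λ r' → agree₃?
        (λ x y z → maj x (table₃ false q true false p' q' r' true ((x ∧ y) ∧ z) y ((x ∨ y) ∨ z)) z) disc₃) q p' q' r')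
      (app₃ maj (lattice⇒maj isC ∧∈ ∨∈) (π zero)
        (app₃ (table₃ false q true false p' q' r' true) F∈
          (app₂ _∧_ ∧∈ (app₂ _∧_ ∧∈ (π zero) (π (suc zero))) (π (suc (suc zero)))) (π (suc zero))
          (app₂ _∨_ ∨∈ (app₂ _∨_ ∨∈ (π zero) (π (suc zero))) (π (suc (suc zero)))))
        (π (suc (suc zero))))

  -- Identifying arguments gives a join unless the entries it exposes contain false. Three tables
  -- escape: the discriminator up to the order of its arguments, the minority, and one for which a
  -- nested term gives the join.
  idempotent-U : ∀ {s p' q' r'} → fun₃ (table₃ false true true s p' q' r' true) ∈ C →
                 fun₂ _∨_ ∈ C ⊎ fun₃ disc₃ ∈ C ⊎ fun₃ minority ∈ C
  idempotent-U {s} {p'} {q'} {true} G∈ = inj₁ (ext₂ C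
    (from-yes (∀ᵇ? λ s → ∀ᵇ? λ p' → ∀ᵇ? λ q' → agree₂? (λ x y → table₃ false true true s p' q' true true y x y) _∨_) s p' q')
    (app-table {u = y₂} {x₂} {y₂} G∈ (π _) (π _) (π _)))
  idempotent-U {s} {p'} {true} {false} G∈ = inj₁ (ext₂ C
    (from-yes (∀ᵇ? λ s → ∀ᵇ? λ p' → agree₂? (λ x y → table₃ false true true s p' true false true x x y) _∨_) s p')
    (app-table {u = x₂} {x₂} {y₂} G∈ (π _) (π _) (π _)))
  idempotent-U {true} {true} {false} {false} G∈ = inj₁ (ext₂ C
    (from-yes (agree₂? (λ x y → table₃ false true true true true false false true x y y) _∨_))
    (app-table {u = x₂} {y₂} {y₂} G∈ (π _) (π _) (π _)))
  idempotent-U {true} {false} {false} {false} G∈ = inj₂ (inj₁ (ext₃ C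
    (from-yes (agree₃? (λ x y z → table₃ false true true true false false false true y x z) disc₃)) (app-table {u = y₃} {x₃} {z₃} G∈ (π _) (π _) (π _))))
  idempotent-U {false} {true} {false} {false} G∈ = inj₂ (inj₂ (ext₃ C
    (from-yes (agree₃? (table₃ false true true false true false false true) minority)) G∈))
  idempotent-U {false} {false} {false} {false} G∈ = inj₁ (ext₂ C
    (from-yes (agree₂? (λ x y → t (t x y y) x y) _∨_))
    (app₃ t {q = x₂} {y₂} G∈ (app₃ t {p = x₂} {y₂} {y₂} G∈ (π _) (π _) (π _)) (π _) (π _)))
    where
    t = table₃ false true true false false false false true

  ∧-from-minority : fun₃ minority ∈ C → fun₂ _∨_ ∈ C → fun₂ _∧_ ∈ C
  ∧-from-minority m∈ ∨∈ = ext₂ C (from-yes (agree₂? (λ x y → minority x y (x ∨ y)) _∧_))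
    (app₃ minority {p = x₂} {y₂} m∈ (π _) (π _) (app₂ _∨_ {s = x₂} {y₂} ∨∈ (π _) (π _)))

  ∨-from-minority : fun₃ minority ∈ C → fun₂ _∧_ ∈ C → fun₂ _∨_ ∈ C
  ∨-from-minority m∈ ∧∈ = ext₂ C (from-yes (agree₂? (λ x y → minority x y (x ∧ y)) _∨_))
    (app₃ minority {p = x₂} {y₂} m∈ (π _) (π _) (app₂ _∧_ {s = x₂} {y₂} ∧∈ (π _) (π _)))

  idempotent-binary : ∀ {a b} → ¬ (fun₂ _∨_ ∈ C) → ¬ (fun₂ _∧_ ∈ C) → fun₂ (table₂ false a b true) ∈ C → a ≡ not b
  idempotent-binary {true}  {true}  ¬∨ ¬∧ b∈ = ⊥-elim (¬∨ (ext₂ C (from-yes (agree₂? (table₂ false true true true) _∨_)) b∈))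
  idempotent-binary {false} {false} ¬∨ ¬∧ b∈ = ⊥-elim (¬∧ (ext₂ C (from-yes (agree₂? (table₂ false false false true) _∧_)) b∈))
  idempotent-binary {true}  {false} ¬∨ ¬∧ b∈ = refl
  idempotent-binary {false} {true}  ¬∨ ¬∧ b∈ = refl

  -- If all binary functions of C are projections, a ternary one is self-dual,
  -- so it is determined by its values at w = false.
  disc-from-minority : ∀ {q r s p' q' r'} → fun₃ minority ∈ C → ¬ (fun₂ _∨_ ∈ C) → ¬ (fun₂ _∧_ ∈ C) →
                       Odd false q r s → fun₃ (table₃ false q r s p' q' r' true) ∈ C → fun₃ disc₃ ∈ C
  disc-from-minority {q} {r} {s} {p'} {q'} {r'} m∈ ¬∨ ¬∧ odd E∈
    with idempotent-binary {p'} {s} ¬∨ ¬∧ (ext₂ C (from-yes (∀ᵇ? λ q → ∀ᵇ? λ r → ∀ᵇ? λ s → ∀ᵇ? λ p' → ∀ᵇ? λ q' → ∀ᵇ? λ r' →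
           agree₂? (λ x y → table₃ false q r s p' q' r' true x y y) (table₂ false p' s true)) q r s p' q' r')
           (app-table {u = x₂} {y₂} {y₂} E∈ (π _) (π _) (π _)))
       | idempotent-binary {q'} {r} ¬∨ ¬∧ (ext₂ C (from-yes (∀ᵇ? λ q → ∀ᵇ? λ r → ∀ᵇ? λ s → ∀ᵇ? λ p' → ∀ᵇ? λ q' → ∀ᵇ? λ r' →
           agree₂? (λ x y → table₃ false q r s p' q' r' true x x y) (table₂ false q' r true)) q r s p' q' r')
           (app-table {u = x₂} {x₂} {y₂} E∈ (π _) (π _) (π _)))
       | idempotent-binary {r'} {q} ¬∨ ¬∧ (ext₂ C (from-yes (∀ᵇ? λ q → ∀ᵇ? λ r → ∀ᵇ? λ s → ∀ᵇ? λ p' → ∀ᵇ? λ q' → ∀ᵇ? λ r' →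
           agree₂? (λ x y → table₃ false q r s p' q' r' true x y x) (table₂ false r' q true)) q r s p' q' r')
           (app-table {u = x₂} {y₂} {x₂} E∈ (π _) (π _) (π _)))
  ... | refl | refl | refl = self-dual q r s odd E∈
    where
    self-dual : ∀ q r s → Odd false q r s → fun₃ (table₃ false q r s (not s) (not r) (not q) true) ∈ C → fun₃ disc₃ ∈ C
    self-dual true  true  true  _ t∈ = ext₃ C
      (from-yes (agree₃? (λ x y z → table₃ false true true true false false false true y x z) disc₃)) (app-table {u = y₃} {x₃} {z₃} t∈ (π _) (π _) (π _))
    self-dual true  false false _ t∈ = ext₃ C
      (from-yes (agree₃? (λ x y z → table₃ false true false false true true false true x z y) disc₃))
      (app-table {u = x₃} {z₃} {y₃} t∈ (π _) (π _) (π _))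
    self-dual false true  false _ t∈ = ext₃ C
      (from-yes (agree₃? (table₃ false false true false true false true true) disc₃)) t∈
    self-dual false false true  _ t∈ = ext₃ C
      (from-yes (agree₃? (λ x y z → minority (table₃ false false false true false true true true x y z) x z) disc₃))
      (app₃ minority {q = x₃} {z₃} m∈ t∈ (π _) (π _))
    self-dual true  true  false ()
    self-dual true  false true  ()
    self-dual false true  true  ()
    self-dual false false false ()

  module WithZero (zero∈ : fun₁ (λ _ → false) ∈ C) where
    section : ∀ {p q r s p' q' r' s'} → fun₃ (table₃ p q r s p' q' r' s') ∈ C → fun₂ (table₂ p q r s) ∈ C
    section t∈ = app-table {v = x₂} {y₂} t∈ (app₁ (λ _ → false) {s = x₂} zero∈ (π _)) (π _) (π _)

    disc-from-∧xor : fun₂ _xor_ ∈ C → fun₂ _∧_ ∈ C → fun₃ disc₃ ∈ C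
    disc-from-∧xor ⊕∈ ∧∈ = ext₃ C
      (from-yes (agree₃? (λ x y z → ((x ∧ y) xor (y ∧ z)) xor ((x ∧ z) xor (x xor z))) disc₃))
      (app₂ _xor_ ⊕∈ (app₂ _xor_ ⊕∈ (app₂ _∧_ {s = x₃} {y₃} ∧∈ (π _) (π _)) (app₂ _∧_ {s = y₃} {z₃} ∧∈ (π _) (π _)))
                     (app₂ _xor_ ⊕∈ (app₂ _∧_ {s = x₃} {z₃} ∧∈ (π _) (π _)) (app₂ _xor_ {s = x₃} {z₃} ⊕∈ (π _) (π _))))

    disc-from-xor : ∀ {q r s} → fun₂ _xor_ ∈ C → Odd false q r s → fun₂ (table₂ false q r s) ∈ C → fun₃ disc₃ ∈ C
    disc-from-xor {q} {r} {s} ⊕∈ odd e∈ = disc-from-∧xor ⊕∈ (∧∈ q r s odd e∈)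
      where
      ∧∈ : ∀ q r s → Odd false q r s → fun₂ (table₂ false q r s) ∈ C → fun₂ _∧_ ∈ C
      ∧∈ false false true _ e∈ = ext₂ C (from-yes (agree₂? (table₂ false false false true) _∧_)) e∈
      ∧∈ true false false _ e∈ = ext₂ C (from-yes (agree₂? (λ x y → x xor table₂ false true false false x y) _∧_))
        (app₂ _xor_ {s = x₂} ⊕∈ (π _) e∈)
      ∧∈ false true false _ e∈ = ext₂ C (from-yes (agree₂? (λ x y → y xor table₂ false false true false x y) _∧_))
        (app₂ _xor_ {s = y₂} ⊕∈ (π _) e∈)
      ∧∈ true true true _ e∈ = ext₂ C (from-yes (agree₂? (λ x y → (x xor y) xor table₂ false true true true x y) _∧_))
        (app₂ _xor_ ⊕∈ (app₂ _xor_ {s = x₂} {y₂} ⊕∈ (π _) (π _)) e∈)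
      ∧∈ true  true  false ()
      ∧∈ true  false true  ()
      ∧∈ false true  true  ()
      ∧∈ false false false ()

    -- Meets are definable from relative complements: x ∧ z = z ∖ (z ∖ x).
    disc-from-difference : fun₂ (λ x z → not x ∧ z) ∈ C → fun₂ _∨_ ∈ C → fun₃ disc₃ ∈ C
    disc-from-difference k∈ ∨∈ = ext₃ C
      (from-yes (agree₃? (λ x y z → (k y x ∨ k (k x z) z) ∨ k y z) disc₃))
      (app₂ _∨_ ∨∈ (app₂ _∨_ ∨∈ (app₂ k {s = y₃} {x₃} k∈ (π _) (π _))
                                 (app₂ k {t = z₃} k∈ (app₂ k {s = x₃} {z₃} k∈ (π _) (π _)) (π _)))
                    (app₂ k {s = y₃} {z₃} k∈ (π _) (π _)))
      where
      k : Bool → Bool → Bool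
      k x z = not x ∧ z

    -- With first argument zero, the first table is addition or a difference and the second is
    -- addition or a join. Addition together with the odd third table gives meets; otherwise
    -- difference and join suffice.
    zero-case : ∀ {q₁ q₂ q₃ q₄ q₅ s₁ s₂ s₃ s₄ s₅ q r s p' q' r' s'} →
      fun₃ (table₃ false q₁ true false q₂ q₃ q₄ q₅) ∈ C →
      fun₃ (table₃ false true true s₁ s₂ s₃ s₄ s₅) ∈ C →
      fun₃ (table₃ false q r s p' q' r' s') ∈ C → Odd false q r s → fun₃ disc₃ ∈ C
    zero-case {true} F∈ _ E∈ odd = disc-from-xor
      (ext₂ C (from-yes (agree₂? (table₂ false true true false) _xor_)) (section F∈)) odd (section E∈)
    zero-case {false} {s₁ = false} _ G∈ E∈ odd = disc-from-xor
      (ext₂ C (from-yes (agree₂? (table₂ false true true false) _xor_)) (section G∈)) odd (section E∈)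
    zero-case {false} {s₁ = true} F∈ G∈ _ _ = disc-from-difference
      (ext₂ C (from-yes (agree₂? (table₂ false false true false) (λ x z → not x ∧ z))) (section F∈))
      (ext₂ C (from-yes (agree₂? (table₂ false true true true) _∨_)) (section G∈))

  module WithNot (not∈ : fun₁ not ∈ C) where
    disc-from-maj : fun₃ maj ∈ C → fun₃ disc₃ ∈ C
    disc-from-maj m∈ = ext₃ C (from-yes (agree₃? (λ x y z → maj x (not y) z) disc₃))
      (app₃ maj {p = x₃} {r = z₃} m∈ (π _) (app₁ not {s = y₃} not∈ (π _)) (π _))

    module _ {p' q' r' s'} (e∈ : fun₃ (table₃ false false false true p' q' r' s') ∈ C) where

      disc-from-zero : fun₁ (λ _ → false) ∈ C → fun₃ disc₃ ∈ C
      disc-from-zero zero∈ = disc-from-maj (lattice⇒maj isC ∧∈ (ext₂ C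
          (from-yes (agree₂? (λ x y → not (not x ∧ not y)) _∨_))
          (app₁ not not∈ (app₂ _∧_ ∧∈ (app₁ not {s = x₂} not∈ (π _)) (app₁ not {s = y₂} not∈ (π _))))))
        where
        ∧∈ : fun₂ _∧_ ∈ C
        ∧∈ = ext₂ C (from-yes (agree₂? (table₂ false false false true) _∧_)) (WithZero.section zero∈ e∈)

    private
      x₁ : BFun 0
      x₁ = proj zero
      ¬x₁ : (λ x → not (x zero)) ∈ C
      ¬x₁ = app₁ not {s = x₁} not∈ (π _)

    -- If some substitution of `x` or its negation for all arguments is constant, the constant false
    -- is available. The one table for which the substitutions tried all fail is majority.
    not-table : ∀ {p' q' r' s'} → fun₃ (table₃ false false false true p' q' r' s') ∈ C → fun₃ disc₃ ∈ C
    not-table {p'} {q'} {r'} {false} e∈ = disc-from-zero e∈ (ext₁ C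
      (from-yes (∀ᵇ? λ p' → ∀ᵇ? λ q' → ∀ᵇ? λ r' → agree₁? (λ x → table₃ false false false true p' q' r' false x x x) (λ _ → false)) p' q' r')
      (app-table {u = x₁} {x₁} {x₁} e∈ (π _) (π _) (π _)))
    not-table {true} {q'} {r'} {true} e∈ = disc-from-zero e∈ (ext₁ C
      (from-yes (∀ᵇ? λ q' → ∀ᵇ? λ r' → agree₁? (λ x → not (table₃ false false false true true q' r' true (not x) x x)) (λ _ → false)) q' r')
      (app₁ not not∈ (app-table {v = x₁} {x₁} e∈ ¬x₁ (π _) (π _))))
    not-table {false} {false} {r'} {true} e∈ = disc-from-zero e∈ (ext₁ C
      (from-yes (∀ᵇ? λ r' → agree₁? (λ x → table₃ false false false true false false r' true x x (not x)) (λ _ → false)) r')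
      (app-table {u = x₁} {x₁} e∈ (π _) (π _) ¬x₁))
    not-table {false} {true} {false} {true} e∈ = disc-from-zero e∈ (ext₁ C
      (from-yes (agree₁? (λ x → table₃ false false false true false true false true x (not x) x) (λ _ → false)))
      (app-table {u = x₁} {w = x₁} e∈ (π _) ¬x₁ (π _)))
    not-table {false} {true} {true} {true} e∈ = disc-from-maj
      (ext₃ C (from-yes (agree₃? (table₃ false false false true false true true true) maj)) e∈)

    flip : Bool → Bool → Bool
    flip false x = x
    flip true  x = not x

    flip∈ : ∀ b {m} {s : BFun m} → s ∈ C → (λ x → flip b (s x)) ∈ C
    flip∈ false s∈ = s∈
    flip∈ true  s∈ = app₁ not not∈ s∈

    normal? : ∀ p q r s α β γ → Dec (∀ x y → flip γ (table₂ p q r s (flip α x) (flip β y)) ≡ table₂ false false false true x y)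
    normal? p q r s α β γ = agree₂? (λ x y → flip γ (table₂ p q r s (flip α x) (flip β y))) (table₂ false false false true)

    odd-normal : ∀ p q r s → Odd p q r s → Σ Bool λ α → Σ Bool λ β → Σ Bool λ γ →
      ∀ x y → flip γ (table₂ p q r s (flip α x) (flip β y)) ≡ table₂ false false false true x y
    odd-normal false false false true  _ = false , false , false , from-yes (normal? false false false true false false false)
    odd-normal false true  false false _ = false , true  , false , from-yes (normal? false true false false false true false)
    odd-normal false false true  false _ = true  , false , false , from-yes (normal? false false true false true false false)
    odd-normal true  false false false _ = true  , true  , false , from-yes (normal? true false false false true true false)
    odd-normal true  true  true  false _ = false , false , true  , from-yes (normal? true true true false false false true)
    odd-normal true  false true  true  _ = false , true  , true  , from-yes (normal? true false true true false true true)
    odd-normal true  true  false true  _ = true  , false , true  , from-yes (normal? true true false true true false true)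
    odd-normal false true  true  true  _ = true  , true  , true  , from-yes (normal? false true true true true true true)
    odd-normal false false false false ()
    odd-normal false false true  true  ()
    odd-normal false true  false true  ()
    odd-normal false true  true  false ()
    odd-normal true  false false true  ()
    odd-normal true  false true  false ()
    odd-normal true  true  false false ()
    odd-normal true  true  true  true  ()

    -- A binary section with an odd number of true values is a meet up to negating arguments and
    -- result, and these negations are in `C`.
    not-case : ∀ {p q r s p' q' r' s'} → Odd p q r s → fun₃ (table₃ p q r s p' q' r' s') ∈ C → fun₃ disc₃ ∈ C
    not-case {p} {q} {r} {s} {p'} {q'} {r'} {s'} odd e∈ with odd-normal p q r s odd
    ... | α , β , γ , normal = not-table {e' false false} {e' true false} {e' false true} {e' true true}
        (ext₃ C agree (flip∈ γ (app₃ (table₃ p q r s p' q' r' s') {p = x₃} e∈ (π _) (flip∈ α (π (suc zero))) (flip∈ β (π (suc (suc zero)))))))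
      where
      e' : Bool → Bool → Bool
      e' x y = flip γ (table₂ p' q' r' s' (flip α x) (flip β y))
      agree : ∀ w x y → flip γ (table₃ p q r s p' q' r' s' w (flip α x) (flip β y)) ≡
              table₃ false false false true (e' false false) (e' true false) (e' false true) (e' true true) w x y
      agree false = normal
      agree true  = tabulate₂ e'

HasM HasU HasL : BSet → Set
HasM D = Σ (Bool → Bool → Bool → Bool) λ t → fun₃ t ∈ D × t false false true ≡ true × t false true true ≡ false
HasU D = Σ (Bool → Bool → Bool → Bool) λ t → fun₃ t ∈ D × t false true false ≡ true × t false false true ≡ true
HasL D = Σ (Bool → Bool → Bool → Bool) λ t → fun₃ t ∈ D ×
           Odd (t false false false) (t false true false) (t false false true) (t false true true)

as-table : ∀ D t {p q r s p' q' r' s'} → fun₃ t ∈ D →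
  t false false false ≡ p → t false true false ≡ q → t false false true ≡ r → t false true true ≡ s →
  t true false false ≡ p' → t true true false ≡ q' → t true false true ≡ r' → t true true true ≡ s' →
  fun₃ (table₃ p q r s p' q' r' s') ∈ D
as-table D t t∈ refl refl refl refl refl refl refl refl = ext₃ D (tabulate₃ t) t∈

module Unary {D : BSet} (isD : IsClone D) where
  open CloneOps isD

  diagonal : ∀ t → fun₃ t ∈ D → fun₁ (λ x → t x x x) ∈ D
  diagonal t t∈ = app₃ t {p = proj zero} {proj zero} {proj zero} t∈ (π _) (π _) (π _)

  module _ (¬not : ¬ (fun₁ not ∈ D)) where

    preserves-false : ¬ (fun₁ (λ _ → true) ∈ D) → ∀ t → fun₃ t ∈ D → t false false false ≡ false
    preserves-false ¬one t t∈ = ¬-not (λ e → go (t true true true) e refl)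
      where
      go : ∀ b → t false false false ≡ true → t true true true ≡ b → ⊥
      go true  e e' = ¬one (ext₁ D {λ x → t x x x} {λ _ → true} (λ { false → e ; true → e' }) (diagonal t t∈))
      go false e e' = ¬not (ext₁ D {λ x → t x x x} {not} (λ { false → e ; true → e' }) (diagonal t t∈))

    preserves-true : ¬ (fun₁ (λ _ → false) ∈ D) → ∀ t → fun₃ t ∈ D → t true true true ≡ true
    preserves-true ¬zero t t∈ = ¬-not (λ e → go (t false false false) refl e)
      where
      go : ∀ b → t false false false ≡ b → t true true true ≡ false → ⊥
      go false e e' = ¬zero (ext₁ D {λ x → t x x x} {λ _ → false} (λ { false → e ; true → e' }) (diagonal t t∈))
      go true  e e' = ¬not (ext₁ D {λ x → t x x x} {not} (λ { false → e ; true → e' }) (diagonal t t∈))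

  zero-disc : fun₁ (λ _ → false) ∈ D → (∀ t → fun₃ t ∈ D → t false false false ≡ false) →
              HasM D → HasU D → HasL D → fun₃ disc₃ ∈ D
  zero-disc zero∈ pres (F , F∈ , F₁ , F₂) (G , G∈ , G₁ , G₂) (E , E∈ , odd) =
    Cases.WithZero.zero-case isD zero∈
      (as-table D F F∈ (pres F F∈) refl F₁ F₂ refl refl refl refl)
      (as-table D G G∈ (pres G G∈) G₁ G₂ refl refl refl refl refl)
      (as-table D E E∈ (pres E E∈) refl refl refl refl refl refl refl)
      (subst (λ p → Odd p (E false true false) (E false false true) (E false true true)) (pres E E∈) odd)

module NotPreserved (em : ExcludedMiddle (lsuc 0ℓ)) {C : BSet} (isC : IsClone C)
                    (hasM : HasM C) (hasU : HasU C) (hasL : HasL C)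
                    (hasUᵈ : HasU (dualSet C)) (hasLᵈ : HasL (dualSet C)) where
  open CloneOps isC
  open Classical em
  open Cases isC
  module Cᵈ = Cases (dualClone isC)

  -- Monotonicity is self-dual: dualising turns the argument that was false into one that is true,
  -- and exchanging the outer arguments puts a false one first again.
  hasMᵈ : HasM (dualSet C)
  hasMᵈ = let F , F∈ , F₁ , F₂ = hasM in
    dual₃ (λ w x y → F y x w)
    , to-dual₃ {C} (λ w x y → F y x w) (app₃ F {p = proj (suc (suc zero))} {proj (suc zero)} {proj zero} F∈ (π _) (π _) (π _))
    , cong not F₂ , cong not F₁

  dual-disc : fun₃ disc₃ ∈ dualSet C → fun₃ disc₃ ∈ C
  dual-disc = from-dual₃ {C} disc₃ disc₃ (from-yes (agree₃? (dual₃ disc₃) disc₃))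

  dual-minority : fun₃ minority ∈ dualSet C → fun₃ minority ∈ C
  dual-minority = from-dual₃ {C} minority minority (from-yes (agree₃? (dual₃ minority) minority))

  dual-∧ : fun₂ _∨_ ∈ dualSet C → fun₂ _∧_ ∈ C
  dual-∧ = from-dual₂ {C} _∨_ _∧_ (from-yes (agree₂? (dual₂ _∨_) _∧_))

  module Idempotent (pres0 : ∀ t → fun₃ t ∈ C → t false false false ≡ false)
                    (pres1 : ∀ t → fun₃ t ∈ C → t true true true ≡ true) where

    pres0ᵈ : ∀ t → fun₃ t ∈ dualSet C → t false false false ≡ false
    pres0ᵈ t t∈ = not-injective (pres1 (dual₃ t) (proj₂ t∈))

    pres1ᵈ : ∀ t → fun₃ t ∈ dualSet C → t true true true ≡ true
    pres1ᵈ t t∈ = not-injective (pres0 (dual₃ t) (proj₂ t∈))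

    lattice-case : fun₂ _∧_ ∈ C → fun₂ _∨_ ∈ C → fun₃ disc₃ ∈ C
    lattice-case ∧∈ ∨∈ = let F , F∈ , F₁ , F₂ = hasM in disc-from-lattice ∧∈ ∨∈
      (as-table C F F∈ (pres0 F F∈) refl F₁ F₂ refl refl refl (pres1 F F∈))

    minority-case : fun₃ minority ∈ C → fun₃ disc₃ ∈ C
    minority-case m∈ with dec (fun₂ _∨_ ∈ C) | dec (fun₂ _∧_ ∈ C)
    ... | yes ∨∈ | _      = lattice-case (∧-from-minority m∈ ∨∈) ∨∈
    ... | no _   | yes ∧∈ = lattice-case ∧∈ (∨-from-minority m∈ ∧∈)
    ... | no ¬∨  | no ¬∧  = let E , E∈ , odd = hasL in disc-from-minority m∈ ¬∨ ¬∧
      (subst (λ p → Odd p (E false true false) (E false false true) (E false true true)) (pres0 E E∈) odd)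
      (as-table C E E∈ (pres0 E E∈) refl refl refl refl refl refl (pres1 E E∈))

    joins : fun₂ _∨_ ∈ C ⊎ fun₃ disc₃ ∈ C ⊎ fun₃ minority ∈ C
    joins = let G , G∈ , G₁ , G₂ = hasU in
      idempotent-U (as-table C G G∈ (pres0 G G∈) G₁ G₂ refl refl refl refl (pres1 G G∈))

    meets : fun₂ _∨_ ∈ dualSet C ⊎ fun₃ disc₃ ∈ dualSet C ⊎ fun₃ minority ∈ dualSet C
    meets = let G , G∈ , G₁ , G₂ = hasUᵈ in
      Cᵈ.idempotent-U (as-table (dualSet C) G G∈ (pres0ᵈ G G∈) G₁ G₂ refl refl refl refl (pres1ᵈ G G∈))

    idempotent-disc : fun₃ disc₃ ∈ C
    idempotent-disc with joins | meets
    ... | inj₂ (inj₁ d∈) | _              = d∈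
    ... | inj₂ (inj₂ m∈) | _              = minority-case m∈
    ... | inj₁ _         | inj₂ (inj₁ d∈) = dual-disc d∈
    ... | inj₁ _         | inj₂ (inj₂ m∈) = minority-case (dual-minority m∈)
    ... | inj₁ ∨∈        | inj₁ ∧∈        = lattice-case (dual-∧ ∧∈) ∨∈

  not-from-constants : fun₁ (λ _ → false) ∈ C → fun₁ (λ _ → true) ∈ C → fun₁ not ∈ C
  not-from-constants zero∈ one∈ = let F , F∈ , F₁ , F₂ = hasM in
    ext₁ C {λ x → F false x true} {not} (λ { false → F₁ ; true → F₂ })
    (app₃ F {q = proj zero} F∈ zero∈ (π _) one∈)

  -- The split is by the unary functions: negation, which both constants together would produce; one
  -- constant, where true is dual to false; or neither, where all ternary members are idempotent.
  disc∈ : disc ∈ C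
  disc∈ = disc₃⇒disc {C} (go (dec (fun₁ not ∈ C)) (dec (fun₁ (λ _ → false) ∈ C)) (dec (fun₁ (λ _ → true) ∈ C)))
    where
    open Unary
    go : Dec (fun₁ not ∈ C) → Dec (fun₁ (λ _ → false) ∈ C) → Dec (fun₁ (λ _ → true) ∈ C) → fun₃ disc₃ ∈ C
    go (yes not∈) _ _ = let E , E∈ , odd = hasL in
      WithNot.not-case not∈ odd (as-table C E E∈ refl refl refl refl refl refl refl refl)
    go (no ¬not) (yes zero∈) (yes one∈) = ⊥-elim (¬not (not-from-constants zero∈ one∈))
    go (no ¬not) (yes zero∈) (no ¬one) =
      zero-disc isC zero∈ (preserves-false isC ¬not ¬one) hasM hasU hasL
    go (no ¬not) (no ¬zero) (no ¬one) =
      Idempotent.idempotent-disc (preserves-false isC ¬not ¬one) (preserves-true isC ¬not ¬zero)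
    go (no ¬not) (no ¬zero) (yes one∈) = dual-disc
      (zero-disc (dualClone isC) (to-dual₁ {C} (λ _ → true) (λ _ → false) (λ _ → refl) one∈)
        (preserves-false (dualClone isC)
          (λ n∈ → ¬not (from-dual₁ {C} not not (from-yes (agree₁? (dual₁ not) not)) n∈))
          (λ o∈ → ¬zero (from-dual₁ {C} (λ _ → true) (λ _ → false) (λ _ → refl) o∈)))
        hasMᵈ hasUᵈ hasLᵈ)

-- Monotone clones lacking a lattice operation

module MonotoneCase (em : ExcludedMiddle (lsuc 0ℓ)) {C : BSet} (isC : IsClone C)
                    (mono : ∀ {n} (f : BFun n) → f ∈ C → Mono f) where
  open CloneOps isC
  open Classical em
  open Minors isC

  -- Identifying the outer arguments of `G` gives a monotone function that is true at both mixed
  -- inputs: a join, unless it is already true at the bottom, and then `G` has a constant diagonal.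
  join-or-one : HasU C → fun₂ _∨_ ∈ C ⊎ fun₁ (λ _ → true) ∈ C
  join-or-one (G , G∈ , G₁ , G₂) = go (G false false false) refl
    where
    raise : ∀ {w x y w' x' y'} → (w ≡ true → w' ≡ true) → (x ≡ true → x' ≡ true) → (y ≡ true → y' ≡ true) →
            G w x y ≡ true → G w' x' y' ≡ true
    raise {w} {x} {y} {w'} {x'} {y'} p q r =
      mono (fun₃ G) G∈ {vec w x y} {vec w' x' y'}
        λ { zero → p ; (suc zero) → q ; (suc (suc zero)) → r }
      where
      vec : Bool → Bool → Bool → X 2
      vec w x y zero             = w
      vec w x y (suc zero)       = x
      vec w x y (suc (suc zero)) = y
    go : ∀ b → G false false false ≡ b → fun₂ _∨_ ∈ C ⊎ fun₁ (λ _ → true) ∈ C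
    go true e = inj₂ (ext₁ C {λ x → G x x x} (λ x → raise (λ ()) (λ ()) (λ ()) e)
      (app₃ G {p = proj zero} {proj zero} {proj zero} G∈ (π _) (π _) (π _)))
    go false e = inj₁ (ext₂ C {λ x y → G y x y} {_∨_}
      (λ { false false → e
         ; true  false → G₁
         ; false true  → raise (λ ()) (λ ()) (λ z → z) G₂
         ; true  true  → raise (λ ()) (λ z → z) (λ ()) G₁ })
      (app₃ G {p = proj (suc zero)} {proj zero} {proj (suc zero)} G∈ (π _) (π _) (π _)))

  -- z plays the meet of the two arguments, except possibly at (true , true).
  preserves-meet : ∀ {z} → fun₂ z ∈ C → z false false ≡ false → z true false ≡ false → z false true ≡ false →
                   fun₁ (λ _ → true) ∈ C → ¬ (fun₂ _∨_ ∈ C) → ∀ {n} (f : BFun n) → f ∈ C → ¬ WitnessV (f ᵈ)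
  preserves-meet {z} z∈ z₀ z₁ z₂ one∈ ¬∨ {n} f f∈ (a , b , c , p , fa , fb , fc) =
      ¬∨ (ext₂ C {λ x y → f (tab x y)} values (minor₂ f∈ tab λ i → ext₂ C (coordinate-tab i) (coordinate∈ i)))
    where
    coordinate : Bool → Bool → Bool → Bool → Bool
    coordinate false false x y = true
    coordinate false true  x y = x
    coordinate true  false x y = y
    coordinate true  true  x y = z x y

    tab : Bool → Bool → X n
    tab true  false = neg a
    tab false true  = neg b
    tab false false = neg c
    tab true  true  = λ i → coordinate (a i) (b i) true true

    coordinate-tab : ∀ i x y → coordinate (a i) (b i) x y ≡ tab x y i
    coordinate-tab i true true = refl
    coordinate-tab i true false with a i | b i
    ... | false | false = refl
    ... | false | true  = refl
    ... | true  | false = refl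
    ... | true  | true  = z₁
    coordinate-tab i false true with a i | b i
    ... | false | false = refl
    ... | false | true  = refl
    ... | true  | false = refl
    ... | true  | true  = z₂
    coordinate-tab i false false with a i | b i | c i | p i
    ... | false | false | _ | refl = refl
    ... | false | true  | _ | refl = refl
    ... | true  | false | _ | refl = refl
    ... | true  | true  | _ | refl = z₀

    coordinate∈ : ∀ i → fun₂ (coordinate (a i) (b i)) ∈ C
    coordinate∈ i with a i | b i
    ... | false | false = app₁ (λ _ → true) {s = proj zero} one∈ (π _)
    ... | false | true  = π zero
    ... | true  | false = π (suc zero)
    ... | true  | true  = z∈

    values : ∀ x y → f (tab x y) ≡ x ∨ y
    values true  false = not-injective fa
    values false true  = not-injective fb
    values false false = not-injective fc
    values true  true  = mono f f∈ {neg a} below (not-injective fa)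
      where
      below : neg a ≼ tab true true
      below i e with a i | b i
      below i e | false | false = refl
      below i e | false | true  = refl
      below i () | true | _

  -- A violation at `a`, `b` would turn `f` into the missing meet: coordinates in `a` only become
  -- `x`, in `b` only `y`, in neither false, and in both `o x y`. Here `o` plays the join except
  -- possibly at `(false , false)`, where monotonicity settles the value.
  preserves-join : ∀ {o} → fun₂ o ∈ C → o true true ≡ true → o true false ≡ true → o false true ≡ true →
                   fun₁ (λ _ → false) ∈ C → ¬ (fun₂ _∧_ ∈ C) → ∀ {n} (f : BFun n) → f ∈ C → ¬ WitnessV f
  preserves-join {o} o∈ o₀ o₁ o₂ zero∈ ¬∧ {n} f f∈ (a , b , c , p , fa , fb , fc) =
      ¬∧ (ext₂ C {λ x y → f (tab x y)} values (minor₂ f∈ tab λ i → ext₂ C (coordinate-tab i) (coordinate∈ i)))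
    where
    coordinate : Bool → Bool → Bool → Bool → Bool
    coordinate false false x y = false
    coordinate true  false x y = x
    coordinate false true  x y = y
    coordinate true  true  x y = o x y

    tab : Bool → Bool → X n
    tab true  false = a
    tab false true  = b
    tab true  true  = c
    tab false false = λ i → coordinate (a i) (b i) false false

    coordinate-tab : ∀ i x y → coordinate (a i) (b i) x y ≡ tab x y i
    coordinate-tab i false false = refl
    coordinate-tab i true false with a i | b i
    ... | false | false = refl
    ... | false | true  = refl
    ... | true  | false = refl
    ... | true  | true  = o₁
    coordinate-tab i false true with a i | b i
    ... | false | false = refl
    ... | false | true  = refl
    ... | true  | false = refl
    ... | true  | true  = o₂
    coordinate-tab i true true with a i | b i | c i | p i
    ... | false | false | _ | refl = refl
    ... | false | true  | _ | refl = refl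
    ... | true  | false | _ | refl = refl
    ... | true  | true  | _ | refl = o₀

    coordinate∈ : ∀ i → fun₂ (coordinate (a i) (b i)) ∈ C
    coordinate∈ i with a i | b i
    ... | false | false = app₁ (λ _ → false) {s = proj zero} zero∈ (π _)
    ... | true  | false = π zero
    ... | false | true  = π (suc zero)
    ... | true  | true  = o∈

    values : ∀ x y → f (tab x y) ≡ x ∧ y
    values true  false = fa
    values false true  = fb
    values true  true  = fc
    values false false = ¬-not (λ e → true≢false (trans (sym (mono f f∈ {tab false false} below e)) fa))
      where
      below : tab false false ≼ a
      below i e with a i | b i
      below i () | false | false
      below i () | false | true
      below i e | true | _ = refl

  dual-antitone : ∀ {n} {f : BFun n} → Mono f → Mono (f ᵈ)
  dual-antitone {f = f} m {x} {y} p e = cong not (¬-not λ fy →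
      true≢false (trans (sym (m {neg y} {neg x} q fy)) (not-injective e)))
    where
    q : neg y ≼ neg x
    q i yi = cong not (¬-not (λ xi → true≢false (trans (sym (p i xi)) (not-injective yi))))

-- Generated clones and the trichotomy

Gen-clone : ∀ F → IsClone ⟨ F ⟩
Gen-clone F = record { projections = gproj ; closed = λ f gs → gcomp }

Gen-⊆ : ∀ {F C} → IsClone C → F ⊆ C → ⟨ F ⟩ ⊆ C
Gen-⊆ isC F⊆C _ (gproj i)         = IsClone.projections isC i
Gen-⊆ isC F⊆C f (ggen f∈)         = F⊆C f f∈
Gen-⊆ isC F⊆C _ (gcomp {f = f} {gs} f∈ gs∈) =
  IsClone.closed isC f gs (Gen-⊆ isC F⊆C f f∈) (λ i → Gen-⊆ isC F⊆C (gs i) (gs∈ i))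
Gen-⊆ {C = C} isC F⊆C g (gext {f = f} p f∈) = ext C p (Gen-⊆ isC F⊆C f f∈)

monotoneSet : BSet
monotoneSet = record
  { mem = Mono
  ; ext = λ f≐g m {x} {y} p e → trans (sym (f≐g y)) (m p (trans (f≐g x) e)) }

monotone-clone : IsClone monotoneSet
monotone-clone = record
  { projections = λ i p → p i
  ; closed      = λ f gs m ms p → m (λ i → ms i p) }

AndOr01-monotone : AndOr01 ⊆ monotoneSet
AndOr01-monotone f (isAnd p) = ext monotoneSet {f = and₂} p λ {x} {y} q e → meet (x zero) (x (suc zero)) (q zero) (q (suc zero)) e
  where
  meet : ∀ a b {a' b'} → (a ≡ true → a' ≡ true) → (b ≡ true → b' ≡ true) → a ∧ b ≡ true → a' ∧ b' ≡ true
  meet true true p q e = cong₂ _∧_ (p refl) (q refl)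
AndOr01-monotone f (isOr p) = ext monotoneSet {f = or₂} p λ {x} {y} q e → join (x zero) (x (suc zero)) (y zero) (q zero) (q (suc zero)) e
  where
  join : ∀ a b a' {b'} → (a ≡ true → a' ≡ true) → (b ≡ true → b' ≡ true) → a ∨ b ≡ true → a' ∨ b' ≡ true
  join a     b     true  p q e = refl
  join true  b     false p q e with p refl
  ... | ()
  join false true  false p q e = q refl
AndOr01-monotone f (is0 p) = ext monotoneSet {f = const0} p (λ _ ())
AndOr01-monotone f (is1 p) = ext monotoneSet {f = const1} p (λ _ _ → refl)

module Main (em : ExcludedMiddle (lsuc 0ℓ)) {C : BSet} (isC : IsClone C) where
  open Classical em

  Has : (∀ {n} → BFun n → Set) → Set
  Has W = Σ ℕ λ n → Σ (BFun n) λ f → f ∈ C × W f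

  lattice⊆ : fun₂ _∧_ ∈ C → fun₂ _∨_ ∈ C → ⟨ AndOr ⟩ ⊆ C
  lattice⊆ ∧∈ ∨∈ = Gen-⊆ isC λ { f (isAnd p) → ext C p ∧∈ ; f (isOr p) → ext C p ∨∈ }

  monotone⊆ : (∀ {n} (f : BFun n) → f ∈ C → Mono f) → C ⊆ ⟨ AndOr01 ⟩
  monotone⊆ mono f f∈ = MonotoneClone.monotone∈ em (Gen-clone AndOr01)
    (ggen (isAnd (λ _ → refl))) (ggen (isOr (λ _ → refl))) f (mono f f∈)
    (λ _ → CloneOps.app₁ (Gen-clone AndOr01) (λ _ → true) (ggen (is1 (λ _ → refl))) (gproj zero))
    (λ _ → CloneOps.app₁ (Gen-clone AndOr01) (λ _ → false) (ggen (is0 (λ _ → refl))) (gproj zero))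

  interval-countable : ⟨ AndOr ⟩ ⊆ C → C ⊆ ⟨ AndOr01 ⟩ → LatticeCountablyInfinite C Ic
  interval-countable lower upper = LatticeClone.countable em isC
    (lower and₂ (ggen (isAnd (λ _ → refl)))) (lower or₂ (ggen (isOr (λ _ → refl))))
    (λ f f∈ → Gen-⊆ monotone-clone AndOr01-monotone f (upper f f∈))

  avoids : {W : ∀ {n} → BFun n → Set} → ¬ Has W → ∀ {n} (f : BFun n) → f ∈ C → ¬ W f
  avoids ¬w f f∈ w = ¬w (_ , f , f∈ , w)

  monotone-if-avoids : ¬ Has WitnessM → ∀ {n} (f : BFun n) → f ∈ C → Mono f
  monotone-if-avoids ¬w f f∈ {x} {y} p e = ¬-not (λ fy → ¬w (_ , f , f∈ , x , y , p , e , fy))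

  -- Without joins, `join-or-one` yields the constant true and the members preserve meets; `z` is
  -- the meet or the constant false, whichever `C` contains. With joins but without meets the
  -- constant false is present and joins are preserved.
  monotone-continuum : HasU C → HasU (dualSet C) → (∀ {n} (f : BFun n) → f ∈ C → Mono f) →
                       ¬ (⟨ AndOr ⟩ ⊆ C) → LatticeContinuum C Ic
  monotone-continuum hasU hasUᵈ mono ¬lower = go (dec (fun₂ _∨_ ∈ C)) (dec (fun₂ _∧_ ∈ C))
    where
    open MonotoneCase em
    open CloneOps isC
    open Spikes em
    dual-mono : ∀ {n} (f : BFun n) → f ∈ dualSet C → Mono f
    dual-mono f (fx , f∈) {x} {y} p e =
      trans (fx (λ i → sym (not-involutive (y i)))) (not-injective-true (dual-antitone isC mono (mono (f ᵈ) f∈) p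
        (trans (not-involutive _) (trans (fx (λ i → not-involutive (x i))) e))))
      where
      not-injective-true : ∀ {b} → not (not b) ≡ true → b ≡ true
      not-injective-true {true} _ = refl

    meet-or-zero : fun₂ _∧_ ∈ C ⊎ fun₁ (λ _ → false) ∈ C
    meet-or-zero with join-or-one (dualClone isC) dual-mono hasUᵈ
    ... | inj₁ j = inj₁ (from-dual₂ {C} _∨_ _∧_ (from-yes (agree₂? (dual₂ _∨_) _∧_)) j)
    ... | inj₂ o = inj₂ (from-dual₁ {C} (λ _ → true) (λ _ → false) (λ _ → refl) o)

    meets : ∀ {z} → fun₂ z ∈ C → z false false ≡ false → z true false ≡ false → z false true ≡ false →
            ¬ (fun₂ _∨_ ∈ C) → fun₁ (λ _ → true) ∈ C → LatticeContinuum C Ic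
    meets {z} z∈ z₀ z₁ z₂ ¬∨ one∈ = continuum isC
      (dualAntichain {PreservesV} {λ f → PreservesV (f ᵈ)} (λ f q → q) antichainV)
      λ f f∈ → dual-antitone isC mono (mono f f∈) , preserves-meet isC mono {z} z∈ z₀ z₁ z₂ one∈ ¬∨ f f∈

    joins : ∀ {o} → fun₂ o ∈ C → o true true ≡ true → o true false ≡ true → o false true ≡ true →
            ¬ (fun₂ _∧_ ∈ C) → fun₁ (λ _ → false) ∈ C → LatticeContinuum C Ic
    joins {o} o∈ o₀ o₁ o₂ ¬∧ zero∈ = continuum isC {PreservesV} antichainV
      λ f f∈ → mono f f∈ , preserves-join isC mono {o} o∈ o₀ o₁ o₂ zero∈ ¬∧ f f∈

    go : Dec (fun₂ _∨_ ∈ C) → Dec (fun₂ _∧_ ∈ C) → LatticeContinuum C Ic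
    go (yes ∨∈) (yes ∧∈) = ⊥-elim (¬lower (lattice⊆ ∧∈ ∨∈))
    go (no ¬∨) _ with join-or-one isC mono hasU | meet-or-zero
    ... | inj₁ ∨∈   | _          = ⊥-elim (¬∨ ∨∈)
    ... | inj₂ one∈ | inj₁ ∧∈    = meets {_∧_} ∧∈ refl refl refl ¬∨ one∈
    ... | inj₂ one∈ | inj₂ zero∈ = meets {λ _ _ → false}
            (app₁ (λ _ → false) {s = proj zero} zero∈ (π _)) refl refl refl ¬∨ one∈
    go (yes ∨∈) (no ¬∧) with meet-or-zero
    ... | inj₁ ∧∈    = ⊥-elim (¬∧ ∧∈)
    ... | inj₂ zero∈ = joins {_∨_} ∨∈ refl refl refl ¬∧ zero∈

  otherwise-continuum : ¬ (disc ∈ C) → ¬ ((⟨ AndOr ⟩ ⊆ C) × (C ⊆ ⟨ AndOr01 ⟩)) → LatticeContinuum C Ic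
  otherwise-continuum ¬disc ¬interval =
    go (dec (Has WitnessU)) (dec (Has λ f → WitnessU (f ᵈ))) (dec (Has WitnessL)) (dec (Has λ f → WitnessL (f ᵈ)))
       (dec (Has WitnessM))
    where
    open Spikes em using (PreservesL; antichainL)
    open GraphFunctions em using (PreservesU)
    open Shift em using (antichainU)
    open Witnesses isC

    getU : Has WitnessU → HasU C
    getU (n , f , f∈ , w) = let tab , p , e = U-table w in (λ w x y → f (tab w x y)) , direct-minor {f = f} {tab} f∈ p , e

    getUᵈ : Has (λ f → WitnessU (f ᵈ)) → HasU (dualSet C)
    getUᵈ (n , f , f∈ , w) = let tab , p , e = U-table w in (λ w x y → (f ᵈ) (tab w x y)) , dual-minor {f = f} {tab} f∈ p , e

    getL : Has WitnessL → HasL C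
    getL (n , f , f∈ , w) = let tab , p , e = L-table {f = f} w in (λ w x y → f (tab w x y)) , direct-minor {f = f} {tab} f∈ p , e

    getLᵈ : Has (λ f → WitnessL (f ᵈ)) → HasL (dualSet C)
    getLᵈ (n , f , f∈ , w) = let tab , p , e = L-table {f = f ᵈ} w in (λ w x y → (f ᵈ) (tab w x y)) , dual-minor {f = f} {tab} f∈ p , e

    go : Dec (Has WitnessU) → Dec (Has λ f → WitnessU (f ᵈ)) → Dec (Has WitnessL) →
         Dec (Has λ f → WitnessL (f ᵈ)) → Dec (Has WitnessM) → LatticeContinuum C Ic
    go (no ¬u) _ _ _ _ = continuum isC antichainU (avoids {WitnessU} ¬u)
    go (yes _) (no ¬u) _ _ _ = continuum isC
      (dualAntichain {PreservesU} {λ f → PreservesU (f ᵈ)} (λ f q → q) antichainU) (avoids {λ f → WitnessU (f ᵈ)} ¬u)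
    go (yes _) (yes _) (no ¬l) _ _ = continuum isC antichainL (avoids {WitnessL} ¬l)
    go (yes _) (yes _) (yes _) (no ¬l) _ = continuum isC
      (dualAntichain {PreservesL} {λ f → PreservesL (f ᵈ)} (λ f q → q) antichainL) (avoids {λ f → WitnessL (f ᵈ)} ¬l)
    go (yes u) (yes u') (yes l) (yes l') (yes (n , f , f∈ , w)) =
      ⊥-elim (¬disc (NotPreserved.disc∈ em isC (M-minor f∈ w) (getU u) (getL l) (getUᵈ u') (getLᵈ l')))
    go (yes u) (yes u') (yes _) (yes _) (no ¬m) =
      monotone-continuum (getU u) (getUᵈ u') mono (λ lower → ¬interval (lower , monotone⊆ mono))
      where
      mono : ∀ {n} (f : BFun n) → f ∈ C → Mono f
      mono = monotone-if-avoids ¬m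

theorem1p2 : ExcludedMiddle (lsuc 0ℓ) →
    (C : BSet) → IsClone C →
    ((LatticeFinite C Ic ⇔ disc ∈ C)
    × (LatticeCountablyInfinite C Ic ⇔ ((⟨ AndOr ⟩ ⊆ C) × (C ⊆ ⟨ AndOr01 ⟩)))
    × ((¬ (disc ∈ C) → ¬ ((⟨ AndOr ⟩ ⊆ C) × (C ⊆ ⟨ AndOr01 ⟩)) → LatticeContinuum C Ic)))
theorem1p2 em C isC =
    mk⇔ finite⇒ (Discriminator.disc⇒finite em isC)
  , mk⇔ countable⇒ (λ { (lower , upper) → interval-countable lower upper })
  , otherwise-continuum
  where
  open Classical em
  open Main em isC

  Interval : Set
  Interval = (⟨ AndOr ⟩ ⊆ C) × (C ⊆ ⟨ AndOr01 ⟩)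

  finite⇒ : LatticeFinite C Ic → disc ∈ C
  finite⇒ fin with dec (disc ∈ C) | dec Interval
  ... | yes d | _ = d
  ... | no ¬d | yes (lower , upper) = ⊥-elim (¬finite×countable fin (interval-countable lower upper))
  ... | no ¬d | no ¬i = ⊥-elim (¬finite×continuum fin (otherwise-continuum ¬d ¬i))

  countable⇒ : LatticeCountablyInfinite C Ic → Interval
  countable⇒ cnt with dec (disc ∈ C) | dec Interval
  ... | _     | yes i = i
  ... | yes d | no ¬i = ⊥-elim (¬finite×countable (Discriminator.disc⇒finite em isC d) cnt)
  ... | no ¬d | no ¬i = ⊥-elim (¬countable×continuum cnt (otherwise-continuum ¬d ¬i))
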